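{- Define subsets $I,S_1,S_2\subseteq\mathbb{G}[t]$ as follows: \begin{itemize} \item $I$ is the set of all linear combinations of elements of $T_{iso}$; \item $S_1$ is the set of all linear combinations of elements of $T_{loop}\cup T_{multi}$; \item $S_2$ is the set of all linear combinations of elements of $T_{os+}$, \end{itemize} where linear combinations are taken with coefficients in $\mathbb{C}[t]$. Then $\mathrm{Span}(I,S_1,S_2)=Ker(XB)$.
   Context: Write $[n]=\{1,\dots,n\}$. A graph is a finite vertex set $V(G)$ together with a finite multiset $E(G)$ of unordered pairs of not necessarily distinct vertices (loops and multi-edges are allowed). $\mathbb{G}$ is the $\mathbb{C}$-vector space freely generated by all (labelled) graphs whose vertex set is $[n]$ for some $n\ge1$, together with a zero graph (the graph with no vertices). $\mathbb{G}[t]$ consists of formal linear combinations of these graphs with coefficients in $\mathbb{C}[t]$. Tutte symmetric function: for a graph $G$, $XB_G(t;x_1,x_2,\dots)=\sum_{\kappa}(1+t)^{e(\kappa)}\prod_{v\in V(G)}x_{\kappa(v)}\in\Lambda[t]$, where the sum is over all maps $\kappa:V(G)\to\{1,2,3,\dots\}$, $e(\kappa)$ is the number of edges of $G$ (with multiplicity; every loop is counted) whose endpoints receive the same value under $\kappa$, and $\Lambda[t]$ is the ring of polynomials in $t$ over the algebra $\Lambda$ of symmetric functions over $\mathbb{C}$ in $x_1,x_2,\dots$. Extend $\mathbb{C}[t]$-linearly to $XB:\mathbb{G}[t]\to\Lambda[t]$, with kernel $Ker(XB)$. Extension: for a graph $G$ and a multiset $E$ of edges with endpoints in $V(G)$,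 $G\uplus E$ is the graph with vertex set $V(G)$ and edge multiset $E(G)\uplus E$ (multiplicities are added). For $L=\sum_{i} c_i(t)H_i$ with all $H_i$ graphs on $[n]$ and a graph $G$ on $[N]$, $N\ge n$, set $Ext(L;G)=\sum_i c_i(t)\,(G\uplus E(H_i))$. In what follows, for a multiset $E$ of edges on $[n]$ write $([n],E)$ for the graph with vertex set $[n]$ and edge multiset $E$. Define the elements of $\mathbb{G}[t]$ $$\ell_{loop}=([1],\{11\})-(t+1)\,([1],\emptyset),$$ $$\ell_{multi}=([2],\{12,12\})-(t+2)\,([2],\{12\})+(t+1)\,([2],\emptyset),$$ $$\ell_{os+}=([3],\{12,23\})+([3],\{13\})-([3],\{12\})-([3],\{13,23\}).$$ $T_{iso}$ is the set of all elements $G-H$ where $G,H$ are labelled graphs (basis elements of $\mathbb{G}$) that are isomorphic as unlabelled graphs. $T_{loop}$, $T_{multi}$, $T_{os+}$ are the sets of all elements of the form $Ext(\ell_{loop};G)$, $Ext(\ell_{multi};G)$, $Ext(\ell_{os+};G)$ respectively, where $G$ ranges over all graphs with vertex set $[N]$, with $N\ge 1$, $N\ge2$, $N\ge3$ respectively. -}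

module Defs where

open import Algebra.Bundles using (CommutativeRing; RawRing)
open import Algebra.Module.Bundles.Raw using (RawLeftModule)
import Algebra.Module.Construct.TensorUnit as TensorUnit
open import Data.Bool.Base using (true; false; if_then_else_)
open import Data.Fin.Base as Fin using (Fin; zero; suc; fromℕ; inject₁)
open import Data.Fin.Patterns
open import Data.Fin.Permutation
  using (Permutation; Permutation′; _⟨$⟩ʳ_; _⟨$⟩ˡ_; inverseʳ)
import Data.Fin.Properties as Fin
open import Data.Fin.Relation.Unary.Top using (view; ‵fromℕ; ‵inject₁)
open import Data.List.Base
  using (List; []; _∷_; _++_; map; foldr; filter; length; applyUpTo)
open import Data.List.Relation.Unary.All using (All)
open import Data.Nat.Base as ℕ using (ℕ; zero; suc; _≤_; _⊔_)
import Data.Nat.Properties as ℕ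
open import Data.Product.Base as Product
  using (∃; Σ; _×_; _,_; proj₂; map₁; map₂)
open import Data.Rational as ℚ
  using (ℚ; 0ℚ; 1ℚ; ½; ∣_∣; Positive; NonZero; 1/_)
import Data.Rational.Properties as ℚ
open import Data.Sum.Base using (_⊎_)
open import Data.Vec.Base as Vec using (Vec; []; _∷_; _∷ʳ_; lookup; tabulate)
open import Data.Vec.Properties
  using (lookup-map; lookup∘tabulate; tabulate∘lookup; tabulate-cong)
open import Function.Base using (id)
open import Function.Bundles using (_⇔_; mk⇔; module Injection)
open import Function.Properties.Inverse using (↔⇒↣)
open import Level using (0ℓ)
open import Relation.Binary.PropositionalEquality as ≡ using (_≡_; _≢_)
open import Relation.Nullary.Decidable
  using (Dec; does; yes; no; map′; _×-dec_; _⊎-dec_; does-⇔; dec-true; dec-false)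
open import Relation.Nullary.Negation using (¬_)
open import Relation.Unary using (Pred; Decidable; _∈_; _∪_)

module RingIdentities (R : CommutativeRing 0ℓ 0ℓ) where
  open CommutativeRing R
  open import Algebra.Properties.Ring (CommutativeRing.ring R)
  open import Relation.Binary.Reasoning.Setoid setoid
  open import Algebra.Solver.Ring.NaturalCoefficients.Default commutativeSemiring
    using (solve; _:+_; _:*_; _:=_)

  -- The solver is for semirings; -1 is passed to it as a variable u.

  private
    u : Carrier
    u = - 1#

    minus : ∀ {x x′ y y′} → x ≈ x′ → y ≈ y′ → x - y ≈ x′ + u * y′
    minus {y = y} x≈x′ y≈y′ =
      +-cong x≈x′ (trans (sym (-1*x≈-x y)) (*-congˡ y≈y′))

  sum-difference : ∀ x y x′ y′ →
    (x - x′) + (y - y′) ≈ (x + y) - (x′ + y′)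
  sum-difference x y x′ y′ = begin
    (x - x′) + (y - y′)
      ≈⟨ +-cong (minus refl refl) (minus refl refl) ⟩
    (x + u * x′) + (y + u * y′)
      ≈⟨ solve 5 (λ u x y x′ y′ →
           (x :+ u :* x′) :+ (y :+ u :* y′) := (x :+ y) :+ u :* (x′ :+ y′))
           refl u x y x′ y′ ⟩
    (x + y) + u * (x′ + y′)
      ≈⟨ minus refl refl ⟨
    (x + y) - (x′ + y′) ∎

  neg-difference : ∀ x x′ → - (x - x′) ≈ - x - - x′
  neg-difference x x′ = sym (-‿+-comm x (- x′))

  chain-difference : ∀ x y z → (x - y) + (y - z) ≈ x - z
  chain-difference x y z = begin
    (x - y) + (y - z)      ≈⟨ +-assoc x (- y) (y - z) ⟩
    x + (- y + (y - z))    ≈⟨ +-congˡ (+-assoc (- y) y (- z)) ⟨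
    x + ((- y + y) - z)    ≈⟨ +-congˡ (+-congʳ (-‿inverseˡ y)) ⟩
    x + (0# - z)           ≈⟨ +-congˡ (+-identityˡ (- z)) ⟩
    x - z                  ∎

  product-difference : ∀ x y x′ y′ →
    x * (y - y′) + y′ * (x - x′) ≈ x * y - x′ * y′
  product-difference x y x′ y′ = begin
    x * (y - y′) + y′ * (x - x′)
      ≈⟨ +-cong (x[y-z]≈xy-xz x y y′)
                (trans (*-comm y′ (x - x′)) ([y-z]x≈yx-zx y′ x x′)) ⟩
    (x * y - x * y′) + (x * y′ - x′ * y′)
      ≈⟨ chain-difference (x * y) (x * y′) (x′ * y′) ⟩
    x * y - x′ * y′ ∎

  flip-difference : ∀ x y → - (x - y) ≈ y - x
  flip-difference x y = begin
    - (x - y)    ≈⟨ neg-difference x y ⟩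
    - x - - y    ≈⟨ +-congˡ (-‿involutive y) ⟩
    - x + y      ≈⟨ +-comm (- x) y ⟩
    y - x        ∎

  recentre : ∀ x y → y + (x - y) ≈ x
  recentre x y = begin
    y + (x - y)    ≈⟨ +-congˡ (+-comm x (- y)) ⟩
    y + (- y + x)  ≈⟨ +-assoc y (- y) x ⟨
    (y - y) + x    ≈⟨ +-congʳ (-‿inverseʳ y) ⟩
    0# + x         ≈⟨ +-identityˡ x ⟩
    x              ∎

  assoc-re : ∀ a b c d e f →
    (a * c - b * d) * e - (a * d + b * c) * f ≈
    a * (c * e - d * f) - b * (c * f + d * e)
  assoc-re a b c d e f = begin
    (a * c - b * d) * e - (a * d + b * c) * f
      ≈⟨ minus (*-congʳ (minus refl refl)) refl ⟩
    (a * c + u * (b * d)) * e + u * ((a * d + b * c) * f)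
      ≈⟨ solve 7 (λ u a b c d e f →
           (a :* c :+ u :* (b :* d)) :* e :+ u :* ((a :* d :+ b :* c) :* f) :=
           a :* (c :* e :+ u :* (d :* f)) :+ u :* (b :* (c :* f :+ d :* e)))
           refl u a b c d e f ⟩
    a * (c * e + u * (d * f)) + u * (b * (c * f + d * e))
      ≈⟨ minus (*-congˡ (minus refl refl)) refl ⟨
    a * (c * e - d * f) - b * (c * f + d * e) ∎

  assoc-im : ∀ a b c d e f →
    (a * c - b * d) * f + (a * d + b * c) * e ≈
    a * (c * f + d * e) + b * (c * e - d * f)
  assoc-im a b c d e f = begin
    (a * c - b * d) * f + (a * d + b * c) * e
      ≈⟨ +-congʳ (*-congʳ (minus refl refl)) ⟩
    (a * c + u * (b * d)) * f + (a * d + b * c) * e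
      ≈⟨ solve 7 (λ u a b c d e f →
           (a :* c :+ u :* (b :* d)) :* f :+ (a :* d :+ b :* c) :* e :=
           a :* (c :* f :+ d :* e) :+ b :* (c :* e :+ u :* (d :* f)))
           refl u a b c d e f ⟩
    a * (c * f + d * e) + b * (c * e + u * (d * f))
      ≈⟨ +-congˡ (*-congˡ (minus refl refl)) ⟨
    a * (c * f + d * e) + b * (c * e - d * f) ∎

  distrib-re : ∀ a b c d e f →
    a * (c + e) - b * (d + f) ≈ (a * c - b * d) + (a * e - b * f)
  distrib-re a b c d e f = begin
    a * (c + e) - b * (d + f)
      ≈⟨ +-cong (distribˡ a c e) (-‿cong (distribˡ b d f)) ⟩
    (a * c + a * e) - (b * d + b * f)
      ≈⟨ sum-difference (a * c) (a * e) (b * d) (b * f) ⟨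
    (a * c - b * d) + (a * e - b * f) ∎

  distrib-im : ∀ a b c d e f →
    a * (d + f) + b * (c + e) ≈ (a * d + b * c) + (a * f + b * e)
  distrib-im = solve 6 (λ a b c d e f →
    a :* (d :+ f) :+ b :* (c :+ e) :=
    (a :* d :+ b :* c) :+ (a :* f :+ b :* e)) refl

  comm-re : ∀ a b c d → a * c - b * d ≈ c * a - d * b
  comm-re a b c d = +-cong (*-comm a c) (-‿cong (*-comm b d))

  comm-im : ∀ a b c d → a * d + b * c ≈ c * b + d * a
  comm-im a b c d =
    trans (+-comm (a * d) (b * c)) (+-cong (*-comm b c) (*-comm a d))

  identity-re : ∀ a b → 1# * a - 0# * b ≈ a
  identity-re a b = begin
    1# * a - 0# * b  ≈⟨ +-cong (*-identityˡ a) (-‿cong (zeroˡ b)) ⟩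
    a - 0#           ≈⟨ +-congˡ -0#≈0# ⟩
    a + 0#           ≈⟨ +-identityʳ a ⟩
    a                ∎

  identity-im : ∀ a b → 1# * b + 0# * a ≈ b
  identity-im a b = begin
    1# * b + 0# * a  ≈⟨ +-cong (*-identityˡ b) (zeroˡ a) ⟩
    b + 0#           ≈⟨ +-identityʳ b ⟩
    b                ∎

open ≡ using (refl; sym; trans; cong; cong₂; subst)

-- "N ≼ i" says that the index i lies beyond N.
module Limits {I : Set} (_≼_ : ℕ → I → Set) where

  Null : (I → ℚ) → Set
  Null f = ∀ ε → 0ℚ ℚ.< ε → ∃ λ N → ∀ i → N ≼ i → ∣ f i ∣ ℚ.< ε

  EventuallyBounded : (I → ℚ) → Set
  EventuallyBounded f =
    ∃ λ b → Positive b × ∃ λ N → ∀ i → N ≼ i → ∣ f i ∣ ℚ.≤ b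

  null-cong : ∀ {f g} → (∀ i → f i ≡ g i) → Null f → Null g
  null-cong f≗g nf ε ε>0 with nf ε ε>0
  ... | N , p = N , λ i N≼i → subst (λ q → ∣ q ∣ ℚ.< ε) (f≗g i) (p i N≼i)

  null-0 : ∀ {f} → (∀ i → f i ≡ 0ℚ) → Null f
  null-0 f≗0 ε ε>0 =
    0 , λ i _ → subst (λ q → ∣ q ∣ ℚ.< ε) (sym (f≗0 i)) ε>0

  null-neg : ∀ {f} → Null f → Null (λ i → ℚ.- f i)
  null-neg {f} nf ε ε>0 with nf ε ε>0
  ... | N , p =
    N , λ i N≼i → subst (ℚ._< ε) (sym (ℚ.∣-p∣≡∣p∣ (f i))) (p i N≼i)

  module Closure
    (weaken : ∀ {M N i} → M ℕ.≤ N → N ≼ i → M ≼ i)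
    where

    private
      ½ε+½ε : ∀ ε → ½ ℚ.* ε ℚ.+ ½ ℚ.* ε ≡ ε
      ½ε+½ε ε = trans (sym (ℚ.*-distribʳ-+ ε ½ ½)) (ℚ.*-identityˡ ε)

    null-+ : ∀ {f g} → Null f → Null g → Null (λ i → f i ℚ.+ g i)
    null-+ {f} {g} nf ng ε ε>0
      with nf (½ ℚ.* ε) (ℚ.*-monoʳ-<-pos ½ ε>0)
         | ng (½ ℚ.* ε) (ℚ.*-monoʳ-<-pos ½ ε>0)
    ... | M , p | N , q = M ⊔ N , λ i M⊔N≼i → ℚ.≤-<-trans
      (ℚ.∣p+q∣≤∣p∣+∣q∣ (f i) (g i))
      (subst (∣ f i ∣ ℚ.+ ∣ g i ∣ ℚ.<_) (½ε+½ε ε)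
        (ℚ.+-mono-< (p i (weaken (ℕ.m≤m⊔n M N) M⊔N≼i))
                    (q i (weaken (ℕ.m≤n⊔m M N) M⊔N≼i))))

    null-* : ∀ {f g} → EventuallyBounded f → Null g →
             Null (λ i → f i ℚ.* g i)
    null-* {f} {g} (b , b-pos , M , p) ng ε ε>0 = go
      where
      instance
        _ : Positive b
        _ = b-pos
        _ : NonZero b
        _ = ℚ.pos⇒nonZero b
        _ : Positive (1/ b)
        _ = ℚ.1/pos⇒pos b

      b*ε/b : b ℚ.* (1/ b ℚ.* ε) ≡ ε
      b*ε/b = trans (sym (ℚ.*-assoc b (1/ b) ε))
        (trans (cong (ℚ._* ε) (ℚ.*-inverseʳ b)) (ℚ.*-identityˡ ε))

      go : ∃ λ N → ∀ i → N ≼ i → ∣ f i ℚ.* g i ∣ ℚ.< ε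
      go with ng (1/ b ℚ.* ε)
                 (subst (ℚ._< 1/ b ℚ.* ε) (ℚ.*-zeroʳ (1/ b))
                   (ℚ.*-monoʳ-<-pos (1/ b) ε>0))
      ... | N , q = M ⊔ N , λ i M⊔N≼i →
        subst (ℚ._< ε) (sym (ℚ.∣p*q∣≡∣p∣*∣q∣ (f i) (g i)))
          (ℚ.≤-<-trans
            (ℚ.*-monoʳ-≤-nonNeg ∣ g i ∣ {{ℚ.∣-∣-nonNeg (g i)}}
              (p i (weaken (ℕ.m≤m⊔n M N) M⊔N≼i)))
            (subst (b ℚ.* ∣ g i ∣ ℚ.<_) b*ε/b
              (ℚ.*-monoʳ-<-pos b (q i (weaken (ℕ.m≤n⊔m M N) M⊔N≼i)))))

_≼₂_ : ℕ → ℕ × ℕ → Set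
N ≼₂ (m , n) = N ℕ.≤ m × N ℕ.≤ n

≼₂-weaken : ∀ {M N i} → M ℕ.≤ N → N ≼₂ i → M ≼₂ i
≼₂-weaken M≤N (N≤m , N≤n) = ℕ.≤-trans M≤N N≤m , ℕ.≤-trans M≤N N≤n

open Limits ℕ._≤_
open Closure ℕ.≤-trans
module Limits₂ = Limits _≼₂_
module Closure₂ = Limits₂.Closure ≼₂-weaken

-- Real numbers are Cauchy sequences of rationals, equal when the difference
-- tends to 0.
record ℝ : Set where
  field
    term   : ℕ → ℚ
    cauchy : Limits₂.Null (λ (m , n) → term m ℚ.- term n)

open ℝ

infix 4 _≈ʳ_

-- A record rather than a bare definition, so that x and y can be inferred
-- from x ≈ʳ y.
record _≈ʳ_ (x y : ℝ) : Set where
  constructor null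
  field difference-null : Null (λ n → term x n ℚ.- term y n)

open _≈ʳ_

module ℚ-identities = RingIdentities ℚ.+-*-commutativeRing

private
  bounded : ∀ x → EventuallyBounded (term x)
  bounded x with cauchy x 1ℚ (ℚ.positive⁻¹ 1ℚ)
  ... | N , p = ∣ term x N ∣ ℚ.+ 1ℚ
              , ℚ.nonNeg+pos⇒pos ∣ term x N ∣ {{ℚ.∣-∣-nonNeg (term x N)}} 1ℚ
              , N , λ n N≤n → subst (λ q → ∣ q ∣ ℚ.≤ ∣ term x N ∣ ℚ.+ 1ℚ)
                  (ℚ-identities.recentre (term x n) (term x N))
                  (ℚ.≤-trans
                    (ℚ.∣p+q∣≤∣p∣+∣q∣ (term x N) (term x n ℚ.- term x N))
                    (ℚ.+-monoʳ-≤ ∣ term x N ∣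
                      (ℚ.<⇒≤ (p (n , N) (N≤n , ℕ.≤-refl)))))

  bounded₁ : ∀ x → Limits₂.EventuallyBounded (λ (m , _) → term x m)
  bounded₁ x with bounded x
  ... | b , b>0 , N , p = b , b>0 , N , λ (m , _) (N≤m , _) → p m N≤m

  bounded₂ : ∀ x → Limits₂.EventuallyBounded (λ (_ , n) → term x n)
  bounded₂ x with bounded x
  ... | b , b>0 , N , p = b , b>0 , N , λ (_ , n) (_ , N≤n) → p n N≤n

infixl 6 _+ʳ_
infixl 7 _*ʳ_
infix  8 -ʳ_

constant : ℚ → ℝ
constant q .term _ = q
constant q .cauchy = Limits₂.null-0 (λ _ → ℚ.+-inverseʳ q)

_+ʳ_ : ℝ → ℝ → ℝ
(x +ʳ y) .term n = term x n ℚ.+ term y n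
(x +ʳ y) .cauchy = Limits₂.null-cong
  (λ (m , n) → ℚ-identities.sum-difference
    (term x m) (term y m) (term x n) (term y n))
  (Closure₂.null-+ (cauchy x) (cauchy y))

-ʳ_ : ℝ → ℝ
(-ʳ x) .term n = ℚ.- term x n
(-ʳ x) .cauchy = Limits₂.null-cong
  (λ (m , n) → ℚ-identities.neg-difference (term x m) (term x n))
  (Limits₂.null-neg (cauchy x))

_*ʳ_ : ℝ → ℝ → ℝ
(x *ʳ y) .term n = term x n ℚ.* term y n
(x *ʳ y) .cauchy = Limits₂.null-cong
  (λ (m , n) → ℚ-identities.product-difference
    (term x m) (term y m) (term x n) (term y n))
  (Closure₂.null-+
    (Closure₂.null-* (bounded₁ x) (cauchy y))
    (Closure₂.null-* (bounded₂ y) (cauchy x)))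

private
  pointwise : ∀ {x y} → (∀ n → term x n ≡ term y n) → x ≈ʳ y
  pointwise {x} {y} x≗y = null (null-0 λ n →
    trans (cong (ℚ._- term y n) (x≗y n)) (ℚ.+-inverseʳ (term y n)))

ℝ-commutativeRing : CommutativeRing 0ℓ 0ℓ
ℝ-commutativeRing = record
  { Carrier = ℝ
  ; _≈_ = _≈ʳ_
  ; _+_ = _+ʳ_
  ; _*_ = _*ʳ_
  ; -_ = -ʳ_
  ; 0# = constant 0ℚ
  ; 1# = constant 1ℚ
  ; isCommutativeRing = record
    { isRing = record
      { +-isAbelianGroup = record
        { isGroup = record
          { isMonoid = record
            { isSemigroup = record
              { isMagma = record
                { isEquivalence = record
                  { refl  = pointwise λ _ → refl
                  ; sym   = λ {x} {y} (null p) → null (null-cong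
                      (λ n → ℚ-identities.flip-difference (term x n) (term y n))
                      (null-neg p))
                  ; trans = λ {x} {y} {z} (null p) (null q) → null (null-cong
                      (λ n → ℚ-identities.chain-difference
                        (term x n) (term y n) (term z n))
                      (null-+ p q))
                  }
                ; ∙-cong = λ {x} {x′} {y} {y′} (null p) (null q) → null (null-cong
                    (λ n → ℚ-identities.sum-difference
                      (term x n) (term y n) (term x′ n) (term y′ n))
                    (null-+ p q))
                }
              ; assoc = λ x y z → pointwise λ n →
                  ℚ.+-assoc (term x n) (term y n) (term z n)
              }
            ; identity = (λ x → pointwise λ n → ℚ.+-identityˡ (term x n))
                       , (λ x → pointwise λ n → ℚ.+-identityʳ (term x n))
            }
          ; inverse = (λ x → pointwise λ n → ℚ.+-inverseˡ (term x n))
                    , (λ x → pointwise λ n → ℚ.+-inverseʳ (term x n))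
          ; ⁻¹-cong = λ {x} {y} (null p) → null (null-cong
              (λ n → ℚ-identities.neg-difference (term x n) (term y n))
              (null-neg p))
          }
        ; comm = λ x y → pointwise λ n → ℚ.+-comm (term x n) (term y n)
        }
      ; *-cong = λ {x} {x′} {y} {y′} (null p) (null q) → null (null-cong
          (λ n → ℚ-identities.product-difference
            (term x n) (term y n) (term x′ n) (term y′ n))
          (null-+ (null-* (bounded x) q) (null-* (bounded y′) p)))
      ; *-assoc = λ x y z → pointwise λ n →
          ℚ.*-assoc (term x n) (term y n) (term z n)
      ; *-identity = (λ x → pointwise λ n → ℚ.*-identityˡ (term x n))
                   , (λ x → pointwise λ n → ℚ.*-identityʳ (term x n))
      ; distrib = (λ x y z → pointwise λ n →
                      ℚ.*-distribˡ-+ (term x n) (term y n) (term z n))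
                , (λ x y z → pointwise λ n →
                      ℚ.*-distribʳ-+ (term x n) (term y n) (term z n))
      }
    ; *-comm = λ x y → pointwise λ n → ℚ.*-comm (term x n) (term y n)
    }
  }

module AdjoinI (R : CommutativeRing 0ℓ 0ℓ) where
  open CommutativeRing R
    renaming (refl to ≈-refl; sym to ≈-sym; trans to ≈-trans)

  record Complex : Set where
    constructor _+i_
    field re im : Carrier

  open Complex public

  private module Identities = RingIdentities R

  infix 4 _≈ᶜ_
  record _≈ᶜ_ (z w : Complex) : Set where
    constructor _,_
    field
      re-≈ : re z ≈ re w
      im-≈ : im z ≈ im w

  infixl 6 _+ᶜ_
  infixl 7 _*ᶜ_

  _+ᶜ_ _*ᶜ_ : Complex → Complex → Complex
  (a +i b) +ᶜ (c +i d) = (a + c) +i (b + d)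
  (a +i b) *ᶜ (c +i d) = (a * c - b * d) +i (a * d + b * c)

  -ᶜ_ : Complex → Complex
  -ᶜ (a +i b) = (- a) +i (- b)

  private
    trans′ : ∀ {x y z} → x ≈ᶜ y → y ≈ᶜ z → x ≈ᶜ z
    trans′ (p , q) (p′ , q′) = ≈-trans p p′ , ≈-trans q q′

    *-comm′ : ∀ x y → x *ᶜ y ≈ᶜ y *ᶜ x
    *-comm′ (a +i b) (c +i d) =
      Identities.comm-re a b c d , Identities.comm-im a b c d

    +-cong′ : ∀ {x y u v} → x ≈ᶜ y → u ≈ᶜ v → x +ᶜ u ≈ᶜ y +ᶜ v
    +-cong′ (p , q) (p′ , q′) = +-cong p p′ , +-cong q q′

    distribˡ′ : ∀ x y z → x *ᶜ (y +ᶜ z) ≈ᶜ x *ᶜ y +ᶜ x *ᶜ z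
    distribˡ′ (a +i b) (c +i d) (e +i f) =
      Identities.distrib-re a b c d e f , Identities.distrib-im a b c d e f

    identityˡ′ : ∀ x → (1# +i 0#) *ᶜ x ≈ᶜ x
    identityˡ′ (a +i b) = Identities.identity-re a b , Identities.identity-im a b

  commutativeRing : CommutativeRing 0ℓ 0ℓ
  commutativeRing = record
    { Carrier = Complex
    ; _≈_ = _≈ᶜ_
    ; _+_ = _+ᶜ_
    ; _*_ = _*ᶜ_
    ; -_ = -ᶜ_
    ; 0# = 0# +i 0#
    ; 1# = 1# +i 0#
    ; isCommutativeRing = record
      { isRing = record
        { +-isAbelianGroup = record
          { isGroup = record
            { isMonoid = record
              { isSemigroup = record
                { isMagma = record
                  { isEquivalence = record
                    { refl  = ≈-refl , ≈-refl
                    ; sym   = λ (p , q) → ≈-sym p , ≈-sym q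
                    ; trans = trans′
                    }
                  ; ∙-cong = +-cong′
                  }
                ; assoc = λ x y z → +-assoc (re x) (re y) (re z)
                                  , +-assoc (im x) (im y) (im z)
                }
              ; identity = (λ x → +-identityˡ (re x) , +-identityˡ (im x))
                         , (λ x → +-identityʳ (re x) , +-identityʳ (im x))
              }
            ; inverse = (λ x → -‿inverseˡ (re x) , -‿inverseˡ (im x))
                      , (λ x → -‿inverseʳ (re x) , -‿inverseʳ (im x))
            ; ⁻¹-cong = λ (p , q) → -‿cong p , -‿cong q
            }
          ; comm = λ x y → +-comm (re x) (re y) , +-comm (im x) (im y)
          }
        ; *-cong = λ (p , q) (p′ , q′) →
              +-cong (*-cong p p′) (-‿cong (*-cong q q′))
            , +-cong (*-cong p q′) (*-cong q p′)
        ; *-assoc = λ (a +i b) (c +i d) (e +i f) →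
              Identities.assoc-re a b c d e f , Identities.assoc-im a b c d e f
        ; *-identity = identityˡ′
                     , λ x → trans′ (*-comm′ x (1# +i 0#)) (identityˡ′ x)
        ; distrib = distribˡ′
                  , λ x y z → trans′ (*-comm′ (y +ᶜ z) x)
                      (trans′ (distribˡ′ x y z)
                        (+-cong′ (*-comm′ x y) (*-comm′ x z)))
        }
      ; *-comm = *-comm′
      }
    }

ℂ-commutativeRing : CommutativeRing 0ℓ 0ℓ
ℂ-commutativeRing = AdjoinI.commutativeRing ℝ-commutativeRing

module LinearCombinations {R : Set} (M : RawLeftModule R 0ℓ 0ℓ) where
  open RawLeftModule M

  linearCombination : List (R × Carrierᴹ) → Carrierᴹ
  linearCombination = foldr (λ (c , x) y → c *ₗ x +ᴹ y) 0ᴹ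

  Span : Pred Carrierᴹ 0ℓ → Pred Carrierᴹ 0ℓ
  Span P x = ∃ λ terms →
    All (λ (_ , y) → y ∈ P) terms × x ≈ᴹ linearCombination terms

-- Polynomials in t with coefficients in M, as lists of coefficients with the
-- constant term first.
module Polynomials {R : Set} (M : RawLeftModule R 0ℓ 0ℓ) where
  open RawLeftModule M

  coefficient : List Carrierᴹ → ℕ → Carrierᴹ
  coefficient []      _       = 0ᴹ
  coefficient (x ∷ _) zero    = x
  coefficient (_ ∷ p) (suc k) = coefficient p k

  infix 4 _≈ₚ_

  _≈ₚ_ : List Carrierᴹ → List Carrierᴹ → Set
  p ≈ₚ q = ∀ k → coefficient p k ≈ᴹ coefficient q k

  infixl 6 _+ₚ_

  _+ₚ_ : List Carrierᴹ → List Carrierᴹ → List Carrierᴹ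
  []      +ₚ q       = q
  (x ∷ p) +ₚ []      = x ∷ p
  (x ∷ p) +ₚ (y ∷ q) = (x +ᴹ y) ∷ (p +ₚ q)

  infixr 7 _*ₚ_

  _*ₚ_ : List R → List Carrierᴹ → List Carrierᴹ
  []      *ₚ q = []
  (a ∷ p) *ₚ q = map (a *ₗ_) q +ₚ (0ᴹ ∷ p *ₚ q)

  -- The module M[t] over R[t].
  polynomialModule : RawLeftModule (List R) 0ℓ 0ℓ
  polynomialModule = record
    { Carrierᴹ = List Carrierᴹ
    ; _≈ᴹ_ = _≈ₚ_
    ; _+ᴹ_ = _+ₚ_
    ; _*ₗ_ = _*ₚ_
    ; 0ᴹ = []
    ; -ᴹ_ = map -ᴹ_
    }

polynomialRing : RawRing 0ℓ 0ℓ → RawRing 0ℓ 0ℓ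
polynomialRing R = record
  { Carrier = List (RawRing.Carrier R)
  ; _≈_ = _≈ₚ_
  ; _+_ = _+ₚ_
  ; _*_ = _*ₚ_
  ; -_ = map (RawRing.-_ R)
  ; 0# = []
  ; 1# = RawRing.1# R ∷ []
  }
  where open Polynomials (TensorUnit.rawLeftModule {R = R})

-- A finite multiset of unordered pairs of elements of [n], listed in any
-- order and with the endpoints of each edge in any order.  The vertex i of
-- [n] is the element i - 1 of Fin n.
Edges : ℕ → Set
Edges n = List (Fin n × Fin n)

SameEdge : ∀ {n} → Fin n × Fin n → Fin n × Fin n → Set
SameEdge (u , v) (u′ , v′) = (u ≡ u′ × v ≡ v′) ⊎ (u ≡ v′ × v ≡ u′)

sameEdge? : ∀ {n} (e e′ : Fin n × Fin n) → Dec (SameEdge e e′)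
sameEdge? (u , v) (u′ , v′) =
  ((u Fin.≟ u′) ×-dec (v Fin.≟ v′)) ⊎-dec ((u Fin.≟ v′) ×-dec (v Fin.≟ u′))

multiplicity : ∀ {n} → Edges n → Fin n → Fin n → ℕ
multiplicity E u v = length (filter (sameEdge? (u , v)) E)

-- The graphs with vertex set [n]; n = 0 gives the zero graph.
Graph : Set
Graph = ∃ Edges

infix 4 _≋_ _≋?_ _≅_

-- Equality of labelled graphs: the same vertex set [m] = [n] and the same
-- multiset of edges.
_≋_ : Graph → Graph → Set
(m , E) ≋ (n , F) = Σ (m ≡ n) λ m≡n → ∀ u v →
  multiplicity E u v ≡ multiplicity F (Fin.cast m≡n u) (Fin.cast m≡n v)

_≋?_ : ∀ G H → Dec (G ≋ H)
(m , E) ≋? (n , F) with m ℕ.≟ n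
... | no  m≢n = no λ (m≡n , _) → m≢n m≡n
... | yes m≡n = map′ (m≡n ,_) proj₂
  (Fin.all? λ u → Fin.all? λ v → multiplicity E u v ℕ.≟ _)

_≅_ : Graph → Graph → Set
(m , E) ≅ (n , F) = Σ (Permutation m n) λ σ → ∀ u v →
  multiplicity E u v ≡ multiplicity F (σ ⟨$⟩ʳ u) (σ ⟨$⟩ʳ v)

Colouring : ℕ → ℕ → Set
Colouring m n = Vec (Fin m) n

occurrences : ∀ {m n} → Colouring m n → Fin m → ℕ
occurrences κ i = Vec.count (i Fin.≟_) κ

-- The product of the x_κ(v) is the monomial with exponent vector α.
HasMonomial : ∀ {m n} → Vec ℕ m → Colouring m n → Set
HasMonomial α κ = ∀ i → occurrences κ i ≡ lookup α i

hasMonomial? : ∀ {m n} (α : Vec ℕ m) (κ : Colouring m n) → Dec (HasMonomial α κ)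
hasMonomial? α κ = Fin.all? λ i → occurrences κ i ℕ.≟ lookup α i

-- The number of edges whose endpoints have the same colour.
e : ∀ {m n} → Colouring m n → Edges n → ℕ
e κ E = length (filter (λ (u , v) → lookup κ u Fin.≟ lookup κ v) E)

permute : ∀ {m} → Permutation′ m → Vec ℕ m → Vec ℕ m
permute π α = tabulate λ i → lookup α (π ⟨$⟩ʳ i)

private
  module ColouringProperties where
    filter-length-cong :
      ∀ {A : Set} {P Q : Pred A 0ℓ} (P? : Decidable P) (Q? : Decidable Q) →
      (∀ x → does (P? x) ≡ does (Q? x)) →
      ∀ xs → length (filter P? xs) ≡ length (filter Q? xs)
    filter-length-cong P? Q? eq [] = refl
    filter-length-cong P? Q? eq (x ∷ xs)
      with does (P? x) | does (Q? x) | eq x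
    ... | true  | _ | refl = cong suc (filter-length-cong P? Q? eq xs)
    ... | false | _ | refl = filter-length-cong P? Q? eq xs

    module _ {m m′} (f : Fin m → Fin m′) (f-inj : ∀ {i j} → f i ≡ f j → i ≡ j) where

      does-inj : ∀ i j → does (f i Fin.≟ f j) ≡ does (i Fin.≟ j)
      does-inj i j = does-⇔ (mk⇔ f-inj (cong f)) (f i Fin.≟ f j) (i Fin.≟ j)

      e-map : ∀ {n} (κ : Colouring m n) E → e (Vec.map f κ) E ≡ e κ E
      e-map κ = filter-length-cong _ _ λ (u , v) → trans
        (cong₂ (λ i j → does (i Fin.≟ j)) (lookup-map u f κ) (lookup-map v f κ))
        (does-inj (lookup κ u) (lookup κ v))

      occurrences-map : ∀ {n} (κ : Colouring m n) i →
                        occurrences (Vec.map f κ) (f i) ≡ occurrences κ i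
      occurrences-map []      i = refl
      occurrences-map (j ∷ κ) i
        rewrite does-inj i j with does (i Fin.≟ j)
      ... | true  = cong suc (occurrences-map κ i)
      ... | false = occurrences-map κ i

    occurrences-avoid : ∀ {m m′ n} (f : Fin m → Fin m′) {i} → (∀ j → i ≢ f j) →
                        (κ : Colouring m n) → occurrences (Vec.map f κ) i ≡ 0
    occurrences-avoid f i∉f []      = refl
    occurrences-avoid f {i} i∉f (j ∷ κ)
      rewrite dec-false (i Fin.≟ f j) (i∉f j) = occurrences-avoid f i∉f κ

    permutation-injective : ∀ {m} (π : Permutation′ m) {i j} →
                            π ⟨$⟩ʳ i ≡ π ⟨$⟩ʳ j → i ≡ j
    permutation-injective π = Injection.injective (↔⇒↣ π)

    hasMonomial-permute : ∀ {m n} (π : Permutation′ m) α (κ : Colouring m n) →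
      HasMonomial (permute π α) κ ⇔ HasMonomial α (Vec.map (π ⟨$⟩ʳ_) κ)
    hasMonomial-permute π α κ = mk⇔ to from
      where
      to : HasMonomial (permute π α) κ → HasMonomial α (Vec.map (π ⟨$⟩ʳ_) κ)
      to h i = subst (λ i → occurrences (Vec.map (π ⟨$⟩ʳ_) κ) i ≡ lookup α i)
        (inverseʳ π)
        (trans (occurrences-map (π ⟨$⟩ʳ_) (permutation-injective π) κ (π ⟨$⟩ˡ i))
          (trans (h (π ⟨$⟩ˡ i)) (lookup∘tabulate _ (π ⟨$⟩ˡ i))))

      from : HasMonomial α (Vec.map (π ⟨$⟩ʳ_) κ) → HasMonomial (permute π α) κ
      from h i = trans (sym (occurrences-map (π ⟨$⟩ʳ_) (permutation-injective π) κ i))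
        (trans (h (π ⟨$⟩ʳ i)) (sym (lookup∘tabulate _ i)))

    lookup-∷ʳ-inject₁ : ∀ {m} (α : Vec ℕ m) x i →
                        lookup (α ∷ʳ x) (inject₁ i) ≡ lookup α i
    lookup-∷ʳ-inject₁ (_ ∷ _) x zero    = refl
    lookup-∷ʳ-inject₁ (_ ∷ α) x (suc i) = lookup-∷ʳ-inject₁ α x i

    lookup-∷ʳ-fromℕ : ∀ {m} (α : Vec ℕ m) x → lookup (α ∷ʳ x) (fromℕ m) ≡ x
    lookup-∷ʳ-fromℕ []      x = refl
    lookup-∷ʳ-fromℕ (_ ∷ α) x = lookup-∷ʳ-fromℕ α x

    hasMonomial-∷ʳ : ∀ {m n} α (κ : Colouring m n) →
      HasMonomial (α ∷ʳ 0) (Vec.map inject₁ κ) ⇔ HasMonomial α κ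
    hasMonomial-∷ʳ {m} α κ = mk⇔ to from
      where
      to : HasMonomial (α ∷ʳ 0) (Vec.map inject₁ κ) → HasMonomial α κ
      to h i = trans (sym (occurrences-map inject₁ Fin.inject₁-injective κ i))
        (trans (h (inject₁ i)) (lookup-∷ʳ-inject₁ α 0 i))

      from : HasMonomial α κ → HasMonomial (α ∷ʳ 0) (Vec.map inject₁ κ)
      from h i with view i
      ... | ‵fromℕ     = trans
        (occurrences-avoid inject₁ (λ _ → Fin.fromℕ≢inject₁) κ)
        (sym (lookup-∷ʳ-fromℕ α 0))
      ... | ‵inject₁ j = trans
        (occurrences-map inject₁ Fin.inject₁-injective κ j)
        (trans (h j) (sym (lookup-∷ʳ-inject₁ α 0 j)))

    sum-increment : ∀ {m} (j : Fin m) (f : Fin m → ℕ) →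
      Vec.sum (tabulate λ i → (if does (i Fin.≟ j) then suc else id) (f i)) ≡
      suc (Vec.sum (tabulate f))
    sum-increment zero    f = refl
    sum-increment (suc j) f = trans
      (cong (f zero ℕ.+_) (sum-increment j (λ i → f (suc i))))
      (ℕ.+-suc (f zero) _)

    sum-zeros : ∀ m → Vec.sum (tabulate {n = m} λ _ → 0) ≡ 0
    sum-zeros zero    = refl
    sum-zeros (suc m) = sum-zeros m

    sum-occurrences : ∀ {m n} (κ : Colouring m n) →
                      Vec.sum (tabulate (occurrences κ)) ≡ n
    sum-occurrences {m} []      = sum-zeros m
    sum-occurrences     (j ∷ κ) =
      trans (sum-increment j (occurrences κ)) (cong suc (sum-occurrences κ))

    degree : ∀ {m n} (α : Vec ℕ m) (κ : Colouring m n) →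
             HasMonomial α κ → Vec.sum α ≡ n
    degree α κ h = trans
      (cong Vec.sum (trans (sym (tabulate∘lookup α)) (tabulate-cong λ i → sym (h i))))
      (sum-occurrences κ)

module TutteSymmetricFunction (K : CommutativeRing 0ℓ 0ℓ) where

  open CommutativeRing K
    using (Carrier; _≈_; _+_; _*_; -_; 0#; 1#; rawRing; ring; setoid;
           +-cong; +-congˡ; +-identityˡ; +-identityʳ; *-congˡ; zeroʳ; -‿cong;
           +-commutativeMonoid)
    renaming (refl to ≈-refl; sym to ≈-sym; trans to ≈-trans;
              reflexive to ≈-reflexive)
  open import Algebra.Properties.Ring ring using (-0#≈0#)
  open import Algebra.Properties.CommutativeMonoid.Sum +-commutativeMonoid
    using (sum; sum-cong-≋; sum-replicate-zero; sum-init-last; sum-permute)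

  K[t] : RawRing 0ℓ 0ℓ
  K[t] = polynomialRing rawRing

  open Polynomials (TensorUnit.rawLeftModule {R = rawRing}) public
    using (coefficient)
  open RawRing K[t] public using ()
    renaming ( Carrier to Polynomial; _≈_ to _≈ᵗ_; _+_ to _+ᵗ_; _*_ to _*ᵗ_
             ; -_ to -ᵗ_; 0# to 0ᵗ; 1# to 1ᵗ)
  open import Algebra.Definitions.RawSemiring (RawRing.rawSemiring K[t]) public
    using (_^_)

  t : Polynomial
  t = 0# ∷ 1# ∷ []

  -- A formal power series in x₁, x₂, … is given by its coefficient at each
  -- monomial x₁^α₁ ⋯ xₘ^αₘ; the field stable says that monomials which
  -- differ only by trailing zero exponents are the same.
  record SymmetricFunction : Set where
    field
      at        : ∀ {m} → Vec ℕ m → Carrier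
      stable    : ∀ {m} (α : Vec ℕ m) → at (α ∷ʳ 0) ≈ at α
      symmetric : ∀ {m} (π : Permutation′ m) (α : Vec ℕ m) →
                  at (permute π α) ≈ at α
      bounded-degree :
        ∃ λ d → ∀ {m} (α : Vec ℕ m) → d ℕ.< Vec.sum α → at α ≈ 0#

  open SymmetricFunction public

  private
    _+ˢ_ : SymmetricFunction → SymmetricFunction → SymmetricFunction
    (f +ˢ g) .at α          = at f α + at g α
    (f +ˢ g) .stable α      = +-cong (stable f α) (stable g α)
    (f +ˢ g) .symmetric π α = +-cong (symmetric f π α) (symmetric g π α)
    (f +ˢ g) .bounded-degree =
      let (c , p) = bounded-degree f
          (d , q) = bounded-degree g
      in c ⊔ d , λ α c⊔d<α → ≈-trans
           (+-cong (p α (ℕ.≤-<-trans (ℕ.m≤m⊔n c d) c⊔d<α))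
                   (q α (ℕ.≤-<-trans (ℕ.m≤n⊔m c d) c⊔d<α)))
           (+-identityˡ 0#)

    _*ˢ_ : Carrier → SymmetricFunction → SymmetricFunction
    (a *ˢ f) .at α          = a * at f α
    (a *ˢ f) .stable α      = *-congˡ (stable f α)
    (a *ˢ f) .symmetric π α = *-congˡ (symmetric f π α)
    (a *ˢ f) .bounded-degree =
      let (d , p) = bounded-degree f
      in d , λ α d<α → ≈-trans (*-congˡ (p α d<α)) (zeroʳ a)

    -ˢ_ : SymmetricFunction → SymmetricFunction
    (-ˢ f) .at α          = - at f α
    (-ˢ f) .stable α      = -‿cong (stable f α)
    (-ˢ f) .symmetric π α = -‿cong (symmetric f π α)
    (-ˢ f) .bounded-degree =
      let (d , p) = bounded-degree f
      in d , λ α d<α → ≈-trans (-‿cong (p α d<α)) -0#≈0#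

    0ˢ : SymmetricFunction
    0ˢ .at α          = 0#
    0ˢ .stable α      = ≈-refl
    0ˢ .symmetric π α = ≈-refl
    0ˢ .bounded-degree = 0 , λ α _ → ≈-refl

  -- Only the vector space structure of the algebra of symmetric functions
  -- is needed.
  Λ : RawLeftModule Carrier 0ℓ 0ℓ
  Λ = record
    { Carrierᴹ = SymmetricFunction
    ; _≈ᴹ_ = λ f g → ∀ {m} (α : Vec ℕ m) → at f α ≈ at g α
    ; _+ᴹ_ = _+ˢ_
    ; _*ₗ_ = _*ˢ_
    ; 0ᴹ = 0ˢ
    ; -ᴹ_ = -ˢ_
    }

  Λ[t] : RawLeftModule Polynomial 0ℓ 0ℓ
  Λ[t] = Polynomials.polynomialModule Λ

  ∑κ : ∀ {m} n → (Colouring m n → Carrier) → Carrier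
  ∑κ zero    F = F []
  ∑κ (suc n) F = sum λ i → ∑κ n λ κ → F (i ∷ κ)

  -- A colouring with a colour outside [m] does not contribute to a monomial in
  -- x₁, …, xₘ, so only those with colours in [m] are summed.  This is the
  -- coefficient of x^α t^k in (1 + t)^e(κ) ∏ x_κ(v).
  contribution : ∀ {m n} → Edges n → ℕ → Vec ℕ m → Colouring m n → Carrier
  contribution E k α κ =
    if does (hasMonomial? α κ) then coefficient ((1ᵗ +ᵗ t) ^ e κ E) k else 0#

  private
    open ColouringProperties

    ∑κ-cong : ∀ {m} n {F G : Colouring m n → Carrier} →
              (∀ κ → F κ ≈ G κ) → ∑κ n F ≈ ∑κ n G
    ∑κ-cong zero    F≈G = F≈G []
    ∑κ-cong (suc n) F≈G = sum-cong-≋ λ i → ∑κ-cong n λ κ → F≈G (i ∷ κ)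

    ∑κ-zero : ∀ {m} n {F : Colouring m n → Carrier} →
              (∀ κ → F κ ≈ 0#) → ∑κ n F ≈ 0#
    ∑κ-zero     zero    F≈0 = F≈0 []
    ∑κ-zero {m} (suc n) F≈0 = ≈-trans
      (sum-cong-≋ λ i → ∑κ-zero n λ κ → F≈0 (i ∷ κ))
      (sum-replicate-zero m)

    ∑κ-permute : ∀ {m} n (π : Permutation′ m) (F : Colouring m n → Carrier) →
                 ∑κ n F ≈ ∑κ n (λ κ → F (Vec.map (π ⟨$⟩ʳ_) κ))
    ∑κ-permute zero    π F = ≈-refl
    ∑κ-permute (suc n) π F = ≈-trans
      (sum-permute (λ i → ∑κ n λ κ → F (i ∷ κ)) π)
      (sum-cong-≋ λ i → ∑κ-permute n π λ κ → F ((π ⟨$⟩ʳ i) ∷ κ))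

    ∑κ-inject₁ : ∀ {m} n (F : Colouring (suc m) n → Carrier) →
      (∀ κ → occurrences κ (fromℕ m) ≢ 0 → F κ ≈ 0#) →
      ∑κ n F ≈ ∑κ n (λ κ → F (Vec.map inject₁ κ))
    ∑κ-inject₁     zero    F F≈0 = ≈-refl
    ∑κ-inject₁ {m} (suc n) F F≈0 = ≈-trans
      (sum-init-last (λ i → ∑κ n λ κ → F (i ∷ κ)))
      (≈-trans
        (+-cong
          (sum-cong-≋ λ i → ∑κ-inject₁ n (λ κ → F (inject₁ i ∷ κ))
            λ κ occurs → F≈0 (inject₁ i ∷ κ)
              (λ none → occurs (occurrences-tail κ (inject₁ i) none)))
          (∑κ-zero n λ κ → F≈0 (fromℕ m ∷ κ) (occurrences-head κ)))
        (+-identityʳ _))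
      where
      occurrences-head : ∀ κ → occurrences (fromℕ m ∷ κ) (fromℕ m) ≢ 0
      occurrences-head κ
        rewrite dec-true (fromℕ m Fin.≟ fromℕ m) refl = λ ()

      occurrences-tail : ∀ (κ : Colouring (suc m) n) j →
        occurrences (j ∷ κ) (fromℕ m) ≡ 0 → occurrences κ (fromℕ m) ≡ 0
      occurrences-tail κ j none with does (fromℕ m Fin.≟ j)
      ... | false = none

    contribution-cong : ∀ {m m′ n} (E : Edges n) k
      (α : Vec ℕ m) (β : Vec ℕ m′) (κ : Colouring m n) (μ : Colouring m′ n) →
      HasMonomial α κ ⇔ HasMonomial β μ → e κ E ≡ e μ E →
      contribution E k α κ ≈ contribution E k β μ
    contribution-cong E k α β κ μ h eq = ≈-reflexive (cong₂
      (λ b n → if b then coefficient ((1ᵗ +ᵗ t) ^ n) k else 0#)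
      (does-⇔ h (hasMonomial? α κ) (hasMonomial? β μ)) eq)

    contribution-zero : ∀ {m n} (E : Edges n) k (α : Vec ℕ m) κ →
                        ¬ HasMonomial α κ → contribution E k α κ ≈ 0#
    contribution-zero E k α κ ¬h rewrite dec-false (hasMonomial? α κ) ¬h = ≈-refl

  -- The coefficient of t^k in XB_G, for G = ([n] , E).
  XB-coefficient : ∀ {n} → Edges n → ℕ → SymmetricFunction
  XB-coefficient {n} E k .at α = ∑κ n (contribution E k α)
  XB-coefficient {n} E k .stable {m} α = ≈-trans
    (∑κ-inject₁ n (contribution E k (α ∷ʳ 0)) λ κ occurs →
      contribution-zero E k (α ∷ʳ 0) κ λ h → occurs (trans (h (fromℕ m)) (lookup-∷ʳ-fromℕ α 0)))
    (∑κ-cong n λ κ → contribution-cong E k (α ∷ʳ 0) α (Vec.map inject₁ κ) κ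
      (hasMonomial-∷ʳ α κ) (e-map inject₁ Fin.inject₁-injective κ E))
  XB-coefficient {n} E k .symmetric π α = ≈-trans
    (∑κ-cong n λ κ → contribution-cong E k (permute π α) α κ (Vec.map (π ⟨$⟩ʳ_) κ)
      (hasMonomial-permute π α κ)
      (sym (e-map (π ⟨$⟩ʳ_) (permutation-injective π) κ E)))
    (≈-sym (∑κ-permute n π (contribution E k α)))
  XB-coefficient {n} E k .bounded-degree = n , λ α n<α → ∑κ-zero n λ κ →
    contribution-zero E k α κ λ h → ℕ.<⇒≢ n<α (sym (degree α κ h))

  -- No power of t beyond the number of edges occurs, since e κ E is at most
  -- that number.
  XB-graph : Graph → RawLeftModule.Carrierᴹ Λ[t]
  XB-graph (n , E) = applyUpTo (XB-coefficient E) (suc (length E))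

  -- Formal linear combinations of graphs.  They are equal when every graph
  -- has the same total coefficient in both.
  FormalSum : Set
  FormalSum = List (Polynomial × Graph)

  coefficientOf : Graph → FormalSum → Polynomial
  coefficientOf G [] = 0ᵗ
  coefficientOf G ((c , H) ∷ L) =
    (if does (G ≋? H) then c else 0ᵗ) +ᵗ coefficientOf G L

  𝔾[t] : RawLeftModule Polynomial 0ℓ 0ℓ
  𝔾[t] = record
    { Carrierᴹ = FormalSum
    ; _≈ᴹ_ = λ L M → ∀ G → coefficientOf G L ≈ᵗ coefficientOf G M
    ; _+ᴹ_ = _++_
    ; _*ₗ_ = λ a → map (map₁ (a *ᵗ_))
    ; 0ᴹ = []
    ; -ᴹ_ = map (map₁ -ᵗ_)
    }

  open RawLeftModule 𝔾[t] using () renaming (_≈ᴹ_ to _≈ᴳ_)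
  open LinearCombinations 𝔾[t] public using (Span)

  XB : FormalSum → RawLeftModule.Carrierᴹ Λ[t]
  XB L = LinearCombinations.linearCombination Λ[t] (map (map₂ XB-graph) L)

  KerXB : Pred FormalSum 0ℓ
  KerXB L = RawLeftModule._≈ᴹ_ Λ[t] (XB L) (RawLeftModule.0ᴹ Λ[t])

  -- Linear combinations of graphs with vertex set [n].
  FormalSumOn : ℕ → Set
  FormalSumOn n = List (Polynomial × Edges n)

  Ext : ∀ {n N} → n ≤ N → FormalSumOn n → Edges N → FormalSum
  Ext {N = N} n≤N L E = map (map₂ λ F → N , E ++ map include F) L
    where
    include : Fin _ × Fin _ → Fin N × Fin N
    include (u , v) = Fin.inject≤ u n≤N , Fin.inject≤ v n≤N

  T : ∀ {n} → FormalSumOn n → Pred FormalSum 0ℓ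
  T {n} ℓ L = ∃ λ N → Σ (n ≤ N) λ n≤N → ∃ λ (E : Edges N) → L ≈ᴳ Ext n≤N ℓ E

  ℓ-loop : FormalSumOn 1
  ℓ-loop = (1ᵗ            , (0F , 0F) ∷ [])
         ∷ (-ᵗ (t +ᵗ 1ᵗ)  , [])
         ∷ []

  ℓ-multi : FormalSumOn 2
  ℓ-multi = (1ᵗ                   , (0F , 1F) ∷ (0F , 1F) ∷ [])
          ∷ (-ᵗ (t +ᵗ (1ᵗ +ᵗ 1ᵗ)) , (0F , 1F) ∷ [])
          ∷ (t +ᵗ 1ᵗ              , [])
          ∷ []

  ℓ-os+ : FormalSumOn 3
  ℓ-os+ = (1ᵗ    , (0F , 1F) ∷ (1F , 2F) ∷ [])
        ∷ (1ᵗ    , (0F , 2F) ∷ [])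
        ∷ (-ᵗ 1ᵗ , (0F , 1F) ∷ [])
        ∷ (-ᵗ 1ᵗ , (0F , 2F) ∷ (1F , 2F) ∷ [])
        ∷ []

  T-iso T-loop T-multi T-os+ : Pred FormalSum 0ℓ
  T-iso L = ∃ λ G → ∃ λ H → G ≅ H × L ≈ᴳ ((1ᵗ , G) ∷ (-ᵗ 1ᵗ , H) ∷ [])
  T-loop  = T ℓ-loop
  T-multi = T ℓ-multi
  T-os+   = T ℓ-os+

  I S₁ S₂ : Pred FormalSum 0ℓ
  I  = Span T-iso
  S₁ = Span (T-loop ∪ T-multi)
  S₂ = Span T-os+

open TutteSymmetricFunction ℂ-commutativeRing public

{-# OPTIONS --safe #-}
module Submission where

-- Write the adjacency of u and v as 1 + x_uv.  Modulo the relators the x are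
-- subject to x_vv = t, x_uv² = t x_uv and x_uv x_vw = x_uw x_vw, so a product of
-- x's depends, up to a power of t, only on the connected components of its edges;
-- expanding every edge, each graph becomes a combination of products x_F over
-- forests F of stars.  XB sends x_F to t^|F| p_λ, where λ lists the sizes of the
-- components.  Up to isomorphism F is determined by λ, and the coefficient of x^λ
-- in p_μ vanishes unless μ refines λ; so in an element of the kernel the
-- coefficients of the x_F vanish one after another, starting with the most
-- components, because t and nonzero integers can be cancelled.

-- No decision procedure for equality in ℂ is at hand, so no coefficient is ever tested for zero.
-- The elimination decides only whether a natural number, the count `admissible`, is zero; it groups
-- terms by that and proves that their total vanishes. The argument runs over any commutative ring
-- `K` in which positive integers cancel, and ℂ enters only at the end.
--
-- Graphs are never multiplied either: x_f becomes the difference operator `∂ f` on functions of the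
-- edge multiset, a product of x's an iterated difference, and a relation an equation that holds
-- whatever edges remain. The same operators act on graphs modulo the relators and on the values of
-- XB, so x_F can be evaluated by passing a linear map through them.
--
-- Partitions are replaced by the exponent vectors `starSizes`: the vertices of a forest serve as
-- colours, and non-roots get exponent 0. That μ refines λ then means that some colouring is
-- constant on the stars of one forest and has class sizes given by the other; `conjugate` turns
-- such a colouring into an isomorphism once the numbers of stars are compared.

open import Algebra.Bundles
import Algebra.Definitions.RawMonoid
import Algebra.Definitions.RawSemiring
open import Algebra.Module.Bundles using (LeftModule; RawLeftModule)
import Algebra.Module.Construct.TensorUnit as TensorUnit
import Algebra.Properties.AbelianGroup
import Algebra.Properties.CommutativeMonoid.Sum
import Algebra.Properties.CommutativeSemigroup
import Algebra.Properties.Ring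
import Algebra.Properties.Semiring.Exp
import Algebra.Properties.Semiring.Mult
open import Data.Bool.Base using (Bool; true; false; _∧_; not; if_then_else_)
import Data.Bool.Properties as Bool
open import Data.Fin.Base as Fin using (Fin; zero; suc; punchIn; punchOut; inject≤)
open import Data.Fin.Patterns
open import Data.Fin.Permutation as Perm using (Permutation; Permutation′; _⟨$⟩ʳ_; _⟨$⟩ˡ_)
import Data.Fin.Properties as Fin
open import Data.List.Base as List
  using (List; []; _∷_; _++_; map; foldr; filter; length; allFin; applyUpTo; cartesianProductWith)
open import Data.List.Membership.Propositional using (lose) renaming (_∈_ to _∈ˡ_)
open import Data.List.Membership.Propositional.Properties
  using (∈-allFin; ∈-map⁺; ∈-cartesianProductWith⁺)
open import Data.List.Membership.Propositional.Properties.WithK using (unique∧set⇒bag)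
open import Data.List.Properties
  using (map-++; map-∘; map-cong; filter-++; filter-some; filter-notAll; length-++; length-filter)
open import Data.List.Relation.Binary.BagAndSetEquality using (∼bag⇒↭)
open import Data.List.Relation.Binary.Permutation.Propositional as ↭ using (_↭_; prep; swap; ↭-refl)
open import Data.List.Relation.Binary.Permutation.Propositional.Properties
  using (filter-↭; ↭-length; ++-comm)
open import Data.List.Relation.Unary.All as All using (All; []; _∷_)
import Data.List.Relation.Unary.All.Properties as All
open import Data.List.Relation.Unary.AllPairs using ([]; _∷_)
open import Data.List.Relation.Unary.Any using (here; there)
open import Data.List.Relation.Unary.Unique.Propositional using (Unique)
import Data.List.Relation.Unary.Unique.Propositional.Properties as Unique
open import Data.Nat.Base as ℕ using (ℕ; zero; suc; _≤_; _<_; z≤n; s≤s)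
import Data.Nat.Properties as ℕ
open import Data.Product.Base as Product using (∃; _×_; _,_; map₁; map₂; proj₁; proj₂)
open import Data.Rational as ℚ using (ℚ; 0ℚ; 1ℚ)
import Data.Rational.Properties as ℚ
open import Data.Sum.Base using (inj₁; inj₂)
open import Data.Vec.Base using (Vec; []; _∷_; lookup; tabulate)
open import Data.Vec.Properties using (lookup∘tabulate; tabulate∘lookup; tabulate-cong; ∷-injective)
open import Function.Base using (id; _∘_)
open import Function.Bundles using (mk⇔; Injection)
open import Function.Properties.Inverse using (↔⇒↣)
open import Level using (0ℓ)
open import Relation.Binary.Bundles using (Setoid)
open import Relation.Binary.Definitions using (Decidable; DecidableEquality)
open import Relation.Binary.PropositionalEquality as ≡ using (_≡_; _≢_; cong; cong₂; subst)
import Relation.Binary.Reasoning.Setoid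
open import Relation.Binary.Structures using (IsEquivalence)
open import Relation.Nullary.Decidable
  using (Dec; does; yes; no; map′; _×-dec_; ¬?; dec-true; dec-false; does-⇔)
open import Relation.Nullary.Negation using (¬_; contradiction)
open import Relation.Unary using (Pred; _∈_; _∪_; _≐_)

open import Algebra.Properties.CommutativeMonoid.Sum ℕ.+-0-commutativeMonoid
  using (sum; sum-cong-≗; sum-remove; sum-permute; ∑-distrib-+; ∑-comm; sum-replicate-zero)
open import Defs using
  ( polynomialRing; module Polynomials; module LinearCombinations; module TutteSymmetricFunction
  ; Edges; SameEdge; sameEdge?; multiplicity; Graph; _≋_; _≋?_; _≅_
  ; Colouring; occurrences; HasMonomial; hasMonomial?; e )

-- Polynomials in t

-- Lets the number of admissible colourings be cancelled without dividing by it; `suc n` keeps the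
-- multiplier positive.
TorsionFree : CommutativeRing 0ℓ 0ℓ → Set
TorsionFree R = ∀ n x → suc n ×ᴿ x ≈ 0# → x ≈ 0#
  where
  open CommutativeRing R
  open Algebra.Definitions.RawMonoid +-rawMonoid using () renaming (_×_ to _×ᴿ_)

module PolynomialRing (K : CommutativeRing 0ℓ 0ℓ) where

  open CommutativeRing K
  open import Algebra.Properties.Ring ring using (-0#≈0#)
  open import Algebra.Definitions.RawMonoid +-rawMonoid using () renaming (_×_ to _×ᴷ_)
  open import Algebra.Properties.CommutativeSemigroup +-commutativeSemigroup
    using (interchange; x∙yz≈y∙xz)
  open RawRing (polynomialRing rawRing) public using ()
    renaming ( Carrier to Poly; _+_ to _⊕_; _*_ to _⊗_; -_ to ⊖_; 0# to 0ₚ; 1# to 1ₚ)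
  open Polynomials (TensorUnit.rawLeftModule {R = rawRing}) using (coefficient)

  -- A record, unlike the equality of polynomialRing, so that p and q can be
  -- inferred from p ≈ᴾ q.
  infix 4 _≈ᴾ_
  record _≈ᴾ_ (p q : Poly) : Set where
    constructor coefficientwise
    field at : ∀ k → coefficient p k ≈ coefficient q k

  open _≈ᴾ_ public

  private
    -- By definition `(a ∷ p) ⊗ q` is `scale a q ⊕ shift (p ⊗ q)`, so the laws of `⊗` reduce to the
    -- interplay of these two operations.
    scale : Carrier → Poly → Poly
    scale a = map (a *_)

    shift : Poly → Poly
    shift p = 0# ∷ p

  coefficient-⊕ : ∀ p q k → coefficient (p ⊕ q) k ≈ coefficient p k + coefficient q k
  coefficient-⊕ []      q       k       = sym (+-identityˡ _)
  coefficient-⊕ (a ∷ p) []      k       = sym (+-identityʳ _)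
  coefficient-⊕ (a ∷ p) (b ∷ q) zero    = refl
  coefficient-⊕ (a ∷ p) (b ∷ q) (suc k) = coefficient-⊕ p q k

  coefficient-⊖ : ∀ p k → coefficient (⊖ p) k ≈ - coefficient p k
  coefficient-⊖ []      k       = sym -0#≈0#
  coefficient-⊖ (a ∷ p) zero    = refl
  coefficient-⊖ (a ∷ p) (suc k) = coefficient-⊖ p k

  private
    coefficient-scale : ∀ a p k → coefficient (scale a p) k ≈ a * coefficient p k
    coefficient-scale a []      k       = sym (zeroʳ a)
    coefficient-scale a (b ∷ p) zero    = refl
    coefficient-scale a (b ∷ p) (suc k) = coefficient-scale a p k

    module ≈ᴾ where
      refl′ : ∀ {p} → p ≈ᴾ p
      refl′ .at k = refl

      sym′ : ∀ {p q} → p ≈ᴾ q → q ≈ᴾ p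
      sym′ e .at k = sym (at e k)

      trans′ : ∀ {p q r} → p ≈ᴾ q → q ≈ᴾ r → p ≈ᴾ r
      trans′ e f .at k = trans (at e k) (at f k)

    open ≈ᴾ

    infixl 6 _⟨+⟩_
    _⟨+⟩_ : ∀ {p q a b k} → coefficient p k ≈ a → coefficient q k ≈ b →
            coefficient (p ⊕ q) k ≈ a + b
    _⟨+⟩_ {p} {q} e f = trans (coefficient-⊕ p q _) (+-cong e f)

    ⊕-cong : ∀ {p p′ q q′} → p ≈ᴾ p′ → q ≈ᴾ q′ → p ⊕ q ≈ᴾ p′ ⊕ q′
    ⊕-cong {p} {p′} {q} {q′} e f .at k =
      trans (_⟨+⟩_ {p} {q} (at e k) (at f k)) (sym (coefficient-⊕ p′ q′ k))

    ⊕-assoc : ∀ p q r → (p ⊕ q) ⊕ r ≈ᴾ p ⊕ (q ⊕ r)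
    ⊕-assoc p q r .at k =
      trans (_⟨+⟩_ {p ⊕ q} {r} (coefficient-⊕ p q k) refl)
        (trans (+-assoc _ _ _)
          (sym (_⟨+⟩_ {p} {q ⊕ r} refl (coefficient-⊕ q r k))))

    ⊕-comm : ∀ p q → p ⊕ q ≈ᴾ q ⊕ p
    ⊕-comm p q .at k = trans (coefficient-⊕ p q k)
      (trans (+-comm _ _) (sym (coefficient-⊕ q p k)))

    ⊕-identityˡ : ∀ p → 0ₚ ⊕ p ≈ᴾ p
    ⊕-identityˡ p .at k = refl

    ⊕-identityʳ : ∀ p → p ⊕ 0ₚ ≈ᴾ p
    ⊕-identityʳ p .at k = trans (coefficient-⊕ p 0ₚ k) (+-identityʳ _)

    ⊖-inverseˡ : ∀ p → (⊖ p) ⊕ p ≈ᴾ 0ₚ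
    ⊖-inverseˡ p .at k = trans (_⟨+⟩_ {⊖ p} {p} (coefficient-⊖ p k) refl) (-‿inverseˡ _)

    ⊖-inverseʳ : ∀ p → p ⊕ (⊖ p) ≈ᴾ 0ₚ
    ⊖-inverseʳ p .at k = trans (_⟨+⟩_ {p} {⊖ p} refl (coefficient-⊖ p k)) (-‿inverseʳ _)

    ⊖-cong : ∀ {p q} → p ≈ᴾ q → ⊖ p ≈ᴾ ⊖ q
    ⊖-cong {p} {q} e .at k = trans (coefficient-⊖ p k)
      (trans (-‿cong (at e k)) (sym (coefficient-⊖ q k)))

    ⊕-interchange : ∀ p q r s → (p ⊕ q) ⊕ (r ⊕ s) ≈ᴾ (p ⊕ r) ⊕ (q ⊕ s)
    ⊕-interchange p q r s .at k =
      trans (_⟨+⟩_ {p ⊕ q} {r ⊕ s} (coefficient-⊕ p q k) (coefficient-⊕ r s k))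
        (trans (interchange _ _ _ _)
          (sym (_⟨+⟩_ {p ⊕ r} {q ⊕ s} (coefficient-⊕ p r k) (coefficient-⊕ q s k))))

    ⊕-swap : ∀ p q r → p ⊕ (q ⊕ r) ≈ᴾ q ⊕ (p ⊕ r)
    ⊕-swap p q r .at k =
      trans (_⟨+⟩_ {p} {q ⊕ r} refl (coefficient-⊕ q r k))
        (trans (x∙yz≈y∙xz _ _ _)
          (sym (_⟨+⟩_ {q} {p ⊕ r} refl (coefficient-⊕ p r k))))

    scale-cong : ∀ {a b p q} → a ≈ b → p ≈ᴾ q → scale a p ≈ᴾ scale b q
    scale-cong {a} {b} {p} {q} e f .at k = trans (coefficient-scale a p k)
      (trans (*-cong e (at f k)) (sym (coefficient-scale b q k)))

    scale-+ : ∀ a b p → scale (a + b) p ≈ᴾ scale a p ⊕ scale b p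
    scale-+ a b p .at k = trans (coefficient-scale (a + b) p k)
      (trans (distribʳ _ a b) (sym (_⟨+⟩_ {scale a p} {scale b p}
        (coefficient-scale a p k) (coefficient-scale b p k))))

    scale-⊕ : ∀ a p q → scale a (p ⊕ q) ≈ᴾ scale a p ⊕ scale a q
    scale-⊕ a p q .at k = trans (coefficient-scale a (p ⊕ q) k)
      (trans (*-congˡ (coefficient-⊕ p q k))
        (trans (distribˡ a _ _) (sym (_⟨+⟩_ {scale a p} {scale a q}
          (coefficient-scale a p k) (coefficient-scale a q k)))))

    scale-scale : ∀ a b p → scale (a * b) p ≈ᴾ scale a (scale b p)
    scale-scale a b p .at k = trans (coefficient-scale (a * b) p k)
      (trans (*-assoc a b _) (sym (trans (coefficient-scale a (scale b p) k)
        (*-congˡ (coefficient-scale b p k)))))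

    scale-0 : ∀ p → scale 0# p ≈ᴾ 0ₚ
    scale-0 p .at k = trans (coefficient-scale 0# p k) (zeroˡ _)

    scale-1 : ∀ p → scale 1# p ≈ᴾ p
    scale-1 p .at k = trans (coefficient-scale 1# p k) (*-identityˡ _)

    shift-cong : ∀ {a b p q} → a ≈ b → p ≈ᴾ q → (a ∷ p) ≈ᴾ (b ∷ q)
    shift-cong e f .at zero    = e
    shift-cong e f .at (suc k) = at f k

    shift-0 : shift 0ₚ ≈ᴾ 0ₚ
    shift-0 .at zero    = refl
    shift-0 .at (suc k) = refl

    shift-⊕ : ∀ p q → shift (p ⊕ q) ≈ᴾ shift p ⊕ shift q
    shift-⊕ p q = shift-cong (sym (+-identityˡ 0#)) refl′

    scale-shift : ∀ a p → scale a (shift p) ≈ᴾ shift (scale a p)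
    scale-shift a p = shift-cong (zeroʳ a) refl′

    tail-≈ : ∀ {a b p q} → (a ∷ p) ≈ᴾ (b ∷ q) → p ≈ᴾ q
    tail-≈ e .at k = at e (suc k)

    tail-≈0 : ∀ {a p} → (a ∷ p) ≈ᴾ 0ₚ → p ≈ᴾ 0ₚ
    tail-≈0 e .at k = at e (suc k)

    zeroʳ′ : ∀ p → p ⊗ 0ₚ ≈ᴾ 0ₚ
    zeroʳ′ []      = refl′
    zeroʳ′ (a ∷ p) = trans′ (shift-cong refl (zeroʳ′ p)) shift-0

    -- A polynomial equal to zero may still be a nonempty list of zeros; `⊗-congʳ` meets this when
    -- one of two equal lists ends first.
    ⊗-null : ∀ p q → p ≈ᴾ 0ₚ → p ⊗ q ≈ᴾ 0ₚ
    ⊗-null []      q e = refl′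
    ⊗-null (a ∷ p) q e = trans′
      (⊕-cong (trans′ (scale-cong (at e 0) refl′) (scale-0 q))
              (trans′ (shift-cong refl (⊗-null p q (tail-≈0 e))) shift-0))
      (⊕-identityˡ 0ₚ)

    ⊗-congˡ : ∀ p {q q′} → q ≈ᴾ q′ → p ⊗ q ≈ᴾ p ⊗ q′
    ⊗-congˡ []      e = refl′
    ⊗-congˡ (a ∷ p) e = ⊕-cong (scale-cong refl e) (shift-cong refl (⊗-congˡ p e))

    ⊗-congʳ : ∀ p p′ q → p ≈ᴾ p′ → p ⊗ q ≈ᴾ p′ ⊗ q
    ⊗-congʳ []      p′       q e = sym′ (⊗-null p′ q (sym′ e))
    ⊗-congʳ (a ∷ p) []       q e = ⊗-null (a ∷ p) q e
    ⊗-congʳ (a ∷ p) (b ∷ p′) q e =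
      ⊕-cong (scale-cong (at e 0) refl′) (shift-cong refl (⊗-congʳ p p′ q (tail-≈ e)))

    ⊗-cong : ∀ {p p′ q q′} → p ≈ᴾ p′ → q ≈ᴾ q′ → p ⊗ q ≈ᴾ p′ ⊗ q′
    ⊗-cong {p} {p′} {q} e f = trans′ (⊗-congʳ p p′ q e) (⊗-congˡ p′ f)

    -- Mirror image of the clause that defines `⊗` by recursion on its left factor; commutativity
    -- becomes an induction.
    ⊗-∷ : ∀ p b q → p ⊗ (b ∷ q) ≈ᴾ scale b p ⊕ shift (p ⊗ q)
    ⊗-∷ []      b q = sym′ shift-0
    ⊗-∷ (a ∷ p) b q = shift-cong (+-congʳ (*-comm a b))
      (trans′ (⊕-cong refl′ (⊗-∷ p b q))
        (⊕-swap (scale a q) (scale b p) (shift (p ⊗ q))))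

    ⊗-comm : ∀ p q → p ⊗ q ≈ᴾ q ⊗ p
    ⊗-comm []      q = sym′ (zeroʳ′ q)
    ⊗-comm (a ∷ p) q = trans′ (⊕-cong refl′ (shift-cong refl (⊗-comm p q)))
      (sym′ (⊗-∷ q a p))

    ⊗-distribʳ : ∀ q p p′ → (p ⊕ p′) ⊗ q ≈ᴾ (p ⊗ q) ⊕ (p′ ⊗ q)
    ⊗-distribʳ q []      p′       = refl′
    ⊗-distribʳ q (a ∷ p) []       = sym′ (⊕-identityʳ _)
    ⊗-distribʳ q (a ∷ p) (b ∷ p′) = trans′
      (⊕-cong (scale-+ a b q)
              (trans′ (shift-cong refl (⊗-distribʳ q p p′)) (shift-⊕ (p ⊗ q) (p′ ⊗ q))))
      (⊕-interchange (scale a q) (scale b q) (shift (p ⊗ q)) (shift (p′ ⊗ q)))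

    ⊗-distribˡ : ∀ p q q′ → p ⊗ (q ⊕ q′) ≈ᴾ (p ⊗ q) ⊕ (p ⊗ q′)
    ⊗-distribˡ p q q′ = trans′ (⊗-comm p (q ⊕ q′))
      (trans′ (⊗-distribʳ p q q′) (⊕-cong (⊗-comm q p) (⊗-comm q′ p)))

    scale-⊗ : ∀ a p q → scale a p ⊗ q ≈ᴾ scale a (p ⊗ q)
    scale-⊗ a []      q = refl′
    scale-⊗ a (b ∷ p) q = trans′
      (⊕-cong (scale-scale a b q)
              (trans′ (shift-cong refl (scale-⊗ a p q)) (sym′ (scale-shift a (p ⊗ q)))))
      (sym′ (scale-⊕ a (scale b q) (shift (p ⊗ q))))

    shift-⊗ : ∀ p q → shift p ⊗ q ≈ᴾ shift (p ⊗ q)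
    shift-⊗ p q = trans′ (⊕-cong (scale-0 q) refl′) (⊕-identityˡ _)

    ⊗-assoc : ∀ p q r → (p ⊗ q) ⊗ r ≈ᴾ p ⊗ (q ⊗ r)
    ⊗-assoc []      q r = refl′
    ⊗-assoc (a ∷ p) q r = trans′ (⊗-distribʳ r (scale a q) (shift (p ⊗ q)))
      (⊕-cong (scale-⊗ a q r)
              (trans′ (shift-⊗ (p ⊗ q) r) (shift-cong refl (⊗-assoc p q r))))

    ⊗-identityˡ : ∀ p → 1ₚ ⊗ p ≈ᴾ p
    ⊗-identityˡ p = trans′ (⊕-cong (scale-1 p) shift-0) (⊕-identityʳ p)

  P : CommutativeRing 0ℓ 0ℓ
  P = record
    { Carrier = Poly
    ; _≈_ = _≈ᴾ_
    ; _+_ = _⊕_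
    ; _*_ = _⊗_
    ; -_ = ⊖_
    ; 0# = 0ₚ
    ; 1# = 1ₚ
    ; isCommutativeRing = record
      { isRing = record
        { +-isAbelianGroup = record
          { isGroup = record
            { isMonoid = record
              { isSemigroup = record
                { isMagma = record
                  { isEquivalence = record { refl = refl′ ; sym = sym′ ; trans = trans′ }
                  ; ∙-cong = ⊕-cong
                  }
                ; assoc = ⊕-assoc
                }
              ; identity = ⊕-identityˡ , ⊕-identityʳ
              }
            ; inverse = ⊖-inverseˡ , ⊖-inverseʳ
            ; ⁻¹-cong = ⊖-cong
            }
          ; comm = ⊕-comm
          }
        ; *-cong = ⊗-cong
        ; *-assoc = ⊗-assoc
        ; *-identity = ⊗-identityˡ , λ p → trans′ (⊗-comm p 1ₚ) (⊗-identityˡ p)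
        ; distrib = ⊗-distribˡ , ⊗-distribʳ
        }
      ; *-comm = ⊗-comm
      }
    }

  private
    module P = CommutativeRing P
  open import Algebra.Definitions.RawMonoid P.+-rawMonoid using () renaming (_×_ to _×ᴾ_)

  X : Poly
  X = 0# ∷ 1# ∷ []

  X-⊗ : ∀ p → X ⊗ p ≈ᴾ (0# ∷ p)
  X-⊗ p = trans′ (shift-⊗ 1ₚ p) (shift-cong refl (⊗-identityˡ p))

  X-cancel : ∀ p → X ⊗ p ≈ᴾ 0ₚ → p ≈ᴾ 0ₚ
  X-cancel p e .at k = trans (sym (at (X-⊗ p) (suc k))) (at e (suc k))

  coefficient-× : ∀ n p k → coefficient (n ×ᴾ p) k ≈ n ×ᴷ coefficient p k
  coefficient-× zero    p k = refl
  coefficient-× (suc n) p k = trans (coefficient-⊕ p (n ×ᴾ p) k) (+-congˡ (coefficient-× n p k))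

  ×-cancel : TorsionFree K → ∀ n p → suc n ×ᴾ p ≈ᴾ 0ₚ → p ≈ᴾ 0ₚ
  ×-cancel torsion-free n p e .at k = torsion-free n _
    (trans (sym (coefficient-× (suc n) p k)) (at e k))

-- Spans and quotient modules

module Subtraction {R : Ring 0ℓ 0ℓ} (M : LeftModule R 0ℓ 0ℓ) where
  open Ring R using (1#; -_; _+_; _*_) renaming (Carrier to C)
  private
    module R = Ring R
    module RP = Algebra.Properties.Ring R
  open LeftModule M
  open Algebra.Properties.AbelianGroup +ᴹ-abelianGroup
  open Algebra.Properties.CommutativeSemigroup
    (CommutativeMonoid.commutativeSemigroup +ᴹ-commutativeMonoid) using (interchange; x∙yz≈y∙xz)
  open Relation.Binary.Reasoning.Setoid ≈ᴹ-setoid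

  infixl 6 _-ᴹ_
  _-ᴹ_ : Carrierᴹ → Carrierᴹ → Carrierᴹ
  x -ᴹ y = x +ᴹ -ᴹ y

  -ᴹ-cong₂ : ∀ {x x′ y y′} → x ≈ᴹ x′ → y ≈ᴹ y′ → x -ᴹ y ≈ᴹ x′ -ᴹ y′
  -ᴹ-cong₂ e f = +ᴹ-cong e (-ᴹ‿cong f)

  x-x≈0 : ∀ {x y} → x ≈ᴹ y → x -ᴹ y ≈ᴹ 0ᴹ
  x-x≈0 {x} {y} e = ≈ᴹ-trans (+ᴹ-congʳ e) (-ᴹ‿inverseʳ y)

  -ᴹ-interchange : ∀ a b c d → (a -ᴹ b) +ᴹ (c -ᴹ d) ≈ᴹ (a +ᴹ c) -ᴹ (b +ᴹ d)
  -ᴹ-interchange a b c d =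
    ≈ᴹ-trans (interchange a (-ᴹ b) c (-ᴹ d)) (+ᴹ-congˡ (⁻¹-∙-comm b d))

  neg-sub : ∀ x y → -ᴹ (x -ᴹ y) ≈ᴹ y -ᴹ x
  neg-sub x y = begin
    -ᴹ (x -ᴹ y)        ≈⟨ ⁻¹-∙-comm x (-ᴹ y) ⟨
    -ᴹ x +ᴹ -ᴹ -ᴹ y    ≈⟨ +ᴹ-congˡ (⁻¹-involutive y) ⟩
    -ᴹ x +ᴹ y          ≈⟨ +ᴹ-comm (-ᴹ x) y ⟩
    y -ᴹ x             ∎

  -ᴹ-swap : ∀ a b c d → (a -ᴹ b) -ᴹ (c -ᴹ d) ≈ᴹ (a -ᴹ c) -ᴹ (b -ᴹ d)
  -ᴹ-swap a b c d = begin
    (a -ᴹ b) -ᴹ (c -ᴹ d)   ≈⟨ +ᴹ-congˡ (neg-sub c d) ⟩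
    (a -ᴹ b) +ᴹ (d -ᴹ c)   ≈⟨ -ᴹ-interchange a b d c ⟩
    (a +ᴹ d) -ᴹ (b +ᴹ c)   ≈⟨ +ᴹ-congˡ (-ᴹ‿cong (+ᴹ-comm b c)) ⟩
    (a +ᴹ d) -ᴹ (c +ᴹ b)   ≈⟨ -ᴹ-interchange a c d b ⟨
    (a -ᴹ c) +ᴹ (d -ᴹ b)   ≈⟨ +ᴹ-congˡ (neg-sub b d) ⟨
    (a -ᴹ c) -ᴹ (b -ᴹ d)   ∎

  sub-add : ∀ x y → (x -ᴹ y) +ᴹ y ≈ᴹ x
  sub-add x y = ≈ᴹ-trans (+ᴹ-assoc x (-ᴹ y) y)
    (≈ᴹ-trans (+ᴹ-congˡ (-ᴹ‿inverseˡ y)) (+ᴹ-identityʳ x))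

  telescope : ∀ x y z → (x -ᴹ y) +ᴹ (y -ᴹ z) ≈ᴹ x -ᴹ z
  telescope x y z = begin
    (x -ᴹ y) +ᴹ (y -ᴹ z)     ≈⟨ +ᴹ-assoc (x -ᴹ y) y (-ᴹ z) ⟨
    ((x -ᴹ y) +ᴹ y) -ᴹ z     ≈⟨ +ᴹ-congʳ (sub-add x y) ⟩
    x -ᴹ z                   ∎

  sub-0 : ∀ x → x -ᴹ 0ᴹ ≈ᴹ x
  sub-0 x = ≈ᴹ-trans (+ᴹ-congˡ ε⁻¹≈ε) (+ᴹ-identityʳ x)

  sub-unique : ∀ {x y} → x -ᴹ y ≈ᴹ 0ᴹ → x ≈ᴹ y
  sub-unique {x} {y} e = ≈ᴹ-trans (≈ᴹ-sym (sub-add x y))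
    (≈ᴹ-trans (+ᴹ-congʳ e) (+ᴹ-identityˡ y))

  *ₗ-neg : ∀ a x → a *ₗ (-ᴹ x) ≈ᴹ -ᴹ (a *ₗ x)
  *ₗ-neg a x = inverseʳ-unique (a *ₗ x) (a *ₗ (-ᴹ x)) (begin
    a *ₗ x +ᴹ a *ₗ (-ᴹ x)  ≈⟨ *ₗ-distribˡ a x (-ᴹ x) ⟨
    a *ₗ (x -ᴹ x)          ≈⟨ *ₗ-congˡ (-ᴹ‿inverseʳ x) ⟩
    a *ₗ 0ᴹ                ≈⟨ *ₗ-zeroʳ a ⟩
    0ᴹ                     ∎)

  neg-*ₗ : ∀ a x → (- a) *ₗ x ≈ᴹ -ᴹ (a *ₗ x)
  neg-*ₗ a x = inverseʳ-unique (a *ₗ x) ((- a) *ₗ x) (begin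
    a *ₗ x +ᴹ (- a) *ₗ x  ≈⟨ *ₗ-distribʳ x a (- a) ⟨
    (a + - a) *ₗ x        ≈⟨ *ₗ-congʳ (R.-‿inverseʳ a) ⟩
    R.0# *ₗ x             ≈⟨ *ₗ-zeroˡ x ⟩
    0ᴹ                    ∎)

  -1*ₗ : ∀ x → (- 1#) *ₗ x ≈ᴹ -ᴹ x
  -1*ₗ x = ≈ᴹ-trans (neg-*ₗ 1# x) (-ᴹ‿cong (*ₗ-identityˡ x))

  *ₗ-sub : ∀ a x y → a *ₗ (x -ᴹ y) ≈ᴹ a *ₗ x -ᴹ a *ₗ y
  *ₗ-sub a x y = ≈ᴹ-trans (*ₗ-distribˡ a x (-ᴹ y)) (+ᴹ-congˡ (*ₗ-neg a y))

  -- Parametrised by `φ` so that the same lemmas serve the linear combinations in `Span` (where `φ`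
  -- is the identity), the expansions into forests and the evaluations by `W`.
  combination : ∀ {A : Set} → (A → Carrierᴹ) → List (C × A) → Carrierᴹ
  combination φ = foldr (λ (c , x) y → c *ₗ φ x +ᴹ y) 0ᴹ

  module _ {A : Set} where
    combination-++ : ∀ (φ : A → Carrierᴹ) L L′ →
      combination φ (L ++ L′) ≈ᴹ combination φ L +ᴹ combination φ L′
    combination-++ φ []            L′ = ≈ᴹ-sym (+ᴹ-identityˡ _)
    combination-++ φ ((c , x) ∷ L) L′ =
      ≈ᴹ-trans (+ᴹ-congˡ (combination-++ φ L L′)) (≈ᴹ-sym (+ᴹ-assoc _ _ _))

    combination-scale : ∀ (φ : A → Carrierᴹ) a L →
      combination φ (map (map₁ (a *_)) L) ≈ᴹ a *ₗ combination φ L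
    combination-scale φ a []            = ≈ᴹ-sym (*ₗ-zeroʳ a)
    combination-scale φ a ((c , x) ∷ L) = ≈ᴹ-trans
      (+ᴹ-cong (*ₗ-assoc a c (φ x)) (combination-scale φ a L))
      (≈ᴹ-sym (*ₗ-distribˡ a _ _))

    combination-neg : ∀ (φ : A → Carrierᴹ) L →
      combination φ (map (map₁ -_) L) ≈ᴹ -ᴹ combination φ L
    combination-neg φ []            = ≈ᴹ-sym ε⁻¹≈ε
    combination-neg φ ((c , x) ∷ L) = ≈ᴹ-trans
      (+ᴹ-cong (neg-*ₗ c (φ x)) (combination-neg φ L)) (⁻¹-∙-comm _ _)

    combination-map : ∀ {B : Set} (φ : A → Carrierᴹ) (f : B → A) L →
      combination φ (map (map₂ f) L) ≡ combination (λ x → φ (f x)) L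
    combination-map φ f []            = ≡.refl
    combination-map φ f ((c , x) ∷ L) = cong (c *ₗ φ (f x) +ᴹ_) (combination-map φ f L)

    combination-filter : ∀ (φ : A → Carrierᴹ) {Z : C × A → Set} (Z? : ∀ x → Dec (Z x)) L →
      combination φ L ≈ᴹ
      combination φ (filter (λ x → ¬? (Z? x)) L) +ᴹ combination φ (filter Z? L)
    combination-filter φ Z? [] = ≈ᴹ-sym (+ᴹ-identityˡ 0ᴹ)
    combination-filter φ Z? (x ∷ L) with does (Z? x)
    ... | false = ≈ᴹ-trans (+ᴹ-congˡ (combination-filter φ Z? L)) (≈ᴹ-sym (+ᴹ-assoc _ _ _))
    ... | true  = ≈ᴹ-trans (+ᴹ-congˡ (combination-filter φ Z? L)) (x∙yz≈y∙xz _ _ _)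

    combination-constant : ∀ (φ : A → Carrierᴹ) {y} L → All (λ (_ , x) → φ x ≈ᴹ y) L →
      combination φ L ≈ᴹ foldr (λ (c , _) s → c + s) R.0# L *ₗ y
    combination-constant φ {y} []            []        = ≈ᴹ-sym (*ₗ-zeroˡ y)
    combination-constant φ {y} ((c , x) ∷ L) (eq ∷ eqs) = ≈ᴹ-trans
      (+ᴹ-cong (*ₗ-congˡ eq) (combination-constant φ L eqs)) (≈ᴹ-sym (*ₗ-distribʳ y c _))

    combination-cong : ∀ {φ ψ : A → Carrierᴹ} L →
      (∀ x → φ x ≈ᴹ ψ x) → combination φ L ≈ᴹ combination ψ L
    combination-cong []            e = ≈ᴹ-refl
    combination-cong ((c , x) ∷ L) e = +ᴹ-cong (*ₗ-congˡ (e x)) (combination-cong L e)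

  combination-expand : ∀ {A B : Set} (φ : A → Carrierᴹ) (ψ : B → Carrierᴹ) →
    (∀ x → ∃ λ F → φ x ≈ᴹ combination ψ F) →
    ∀ L → ∃ λ L′ → combination φ L ≈ᴹ combination ψ L′
  combination-expand φ ψ expand []            = [] , ≈ᴹ-refl
  combination-expand φ ψ expand ((c , x) ∷ L)
    with expand x | combination-expand φ ψ expand L
  ... | F , e | L′ , e′ = map (map₁ (c *_)) F ++ L′ , (begin
    c *ₗ φ x +ᴹ combination φ L
      ≈⟨ +ᴹ-cong (*ₗ-congˡ e) e′ ⟩
    c *ₗ combination ψ F +ᴹ combination ψ L′
      ≈⟨ +ᴹ-congʳ (combination-scale ψ c F) ⟨
    combination ψ (map (map₁ (c *_)) F) +ᴹ combination ψ L′
      ≈⟨ combination-++ ψ (map (map₁ (c *_)) F) L′ ⟨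
    combination ψ (map (map₁ (c *_)) F ++ L′) ∎)

module Quotient {R : Ring 0ℓ 0ℓ} (M : LeftModule R 0ℓ 0ℓ)
                (S : Pred (LeftModule.Carrierᴹ M) 0ℓ) where
  open Ring R using (1#; -_; _*_) renaming (_≈_ to _≈ᴿ_)
  private module R = Ring R
  open LeftModule M
  open Subtraction M
  open Relation.Binary.Reasoning.Setoid ≈ᴹ-setoid

  ⟨S⟩ : Pred Carrierᴹ 0ℓ
  ⟨S⟩ = LinearCombinations.Span rawLeftModule S

  span-≈ : ∀ {x y} → x ≈ᴹ y → y ∈ ⟨S⟩ → x ∈ ⟨S⟩
  span-≈ x≈y (L , all , e) = L , all , ≈ᴹ-trans x≈y e

  span-0 : 0ᴹ ∈ ⟨S⟩
  span-0 = [] , [] , ≈ᴹ-refl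

  span-+ : ∀ {x y} → x ∈ ⟨S⟩ → y ∈ ⟨S⟩ → x +ᴹ y ∈ ⟨S⟩
  span-+ (L , all , e) (L′ , all′ , e′) = L ++ L′ , All.++⁺ all all′ ,
    ≈ᴹ-trans (+ᴹ-cong e e′) (≈ᴹ-sym (combination-++ (λ x → x) L L′))

  span-* : ∀ a {x} → x ∈ ⟨S⟩ → a *ₗ x ∈ ⟨S⟩
  span-* a (L , all , e) = map (map₁ (a *_)) L , All.map⁺ all ,
    ≈ᴹ-trans (*ₗ-congˡ e) (≈ᴹ-sym (combination-scale (λ x → x) a L))

  span-neg : ∀ {x} → x ∈ ⟨S⟩ → -ᴹ x ∈ ⟨S⟩
  span-neg {x} s = span-≈ (≈ᴹ-sym (-1*ₗ x)) (span-* (- 1#) s)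

  S⊆span : ∀ {x} → x ∈ S → x ∈ ⟨S⟩
  S⊆span {x} s = (1# , x) ∷ [] , s ∷ [] ,
    ≈ᴹ-sym (≈ᴹ-trans (+ᴹ-identityʳ _) (*ₗ-identityˡ x))

  infix 4 _~_
  -- The quotient keeps the carrier and coarsens its equality. The record lets `x` and `y` be
  -- inferred from a proof, which an equality that unfolds would not.
  record _~_ (x y : Carrierᴹ) : Set where
    constructor modulo
    field difference : x -ᴹ y ∈ ⟨S⟩

  open _~_ public

  ≈⇒~ : ∀ {x y} → x ≈ᴹ y → x ~ y
  ≈⇒~ e = modulo (span-≈ (x-x≈0 e) span-0)

  span⇒~0 : ∀ {x} → x ∈ ⟨S⟩ → x ~ 0ᴹ
  span⇒~0 {x} s = modulo (span-≈ (sub-0 x) s)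

  ~0⇒span : ∀ {x} → x ~ 0ᴹ → x ∈ ⟨S⟩
  ~0⇒span {x} (modulo s) = span-≈ (≈ᴹ-sym (sub-0 x)) s

  private
    ~-sym : ∀ {x y} → x ~ y → y ~ x
    ~-sym {x} {y} (modulo s) = modulo (span-≈ (≈ᴹ-sym (neg-sub x y)) (span-neg s))

    ~-trans : ∀ {x y z} → x ~ y → y ~ z → x ~ z
    ~-trans {x} {y} {z} (modulo s) (modulo s′) =
      modulo (span-≈ (≈ᴹ-sym (telescope x y z)) (span-+ s s′))

    ~-+ : ∀ {x x′ y y′} → x ~ x′ → y ~ y′ → x +ᴹ y ~ x′ +ᴹ y′
    ~-+ {x} {x′} {y} {y′} (modulo s) (modulo s′) =
      modulo (span-≈ (≈ᴹ-sym (-ᴹ-interchange x x′ y y′)) (span-+ s s′))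

    ~-neg : ∀ {x y} → x ~ y → -ᴹ x ~ -ᴹ y
    ~-neg {x} {y} (modulo s) = modulo (span-≈ eq (span-neg s))
      where
      eq : -ᴹ x -ᴹ -ᴹ y ≈ᴹ -ᴹ (x -ᴹ y)
      eq = Algebra.Properties.AbelianGroup.⁻¹-∙-comm +ᴹ-abelianGroup x (-ᴹ y)

    ~-* : ∀ {a b x y} → a ≈ᴿ b → x ~ y → a *ₗ x ~ b *ₗ y
    ~-* {a} {b} {x} {y} e (modulo s) = modulo (span-≈
      (≈ᴹ-trans (+ᴹ-congˡ (-ᴹ‿cong (*ₗ-congʳ (R.sym e)))) (≈ᴹ-sym (*ₗ-sub a x y)))
      (span-* a s))

  M/S : LeftModule R 0ℓ 0ℓ
  M/S = record
    { Carrierᴹ = Carrierᴹ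
    ; _≈ᴹ_ = _~_
    ; _+ᴹ_ = _+ᴹ_
    ; _*ₗ_ = _*ₗ_
    ; 0ᴹ = 0ᴹ
    ; -ᴹ_ = -ᴹ_
    ; isLeftModule = record
      { isLeftSemimodule = record
        { +ᴹ-isCommutativeMonoid = record
          { isMonoid = record
            { isSemigroup = record
              { isMagma = record
                { isEquivalence = record { refl = ≈⇒~ ≈ᴹ-refl ; sym = ~-sym ; trans = ~-trans }
                ; ∙-cong = ~-+
                }
              ; assoc = λ x y z → ≈⇒~ (+ᴹ-assoc x y z)
              }
            ; identity = (λ x → ≈⇒~ (+ᴹ-identityˡ x)) , (λ x → ≈⇒~ (+ᴹ-identityʳ x))
            }
          ; comm = λ x y → ≈⇒~ (+ᴹ-comm x y)
          }
        ; isPreleftSemimodule = record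
          { *ₗ-cong = ~-*
          ; *ₗ-zeroˡ = λ x → ≈⇒~ (*ₗ-zeroˡ x)
          ; *ₗ-distribʳ = λ x a b → ≈⇒~ (*ₗ-distribʳ x a b)
          ; *ₗ-identityˡ = λ x → ≈⇒~ (*ₗ-identityˡ x)
          ; *ₗ-assoc = λ a b x → ≈⇒~ (*ₗ-assoc a b x)
          ; *ₗ-zeroʳ = λ a → ≈⇒~ (*ₗ-zeroʳ a)
          ; *ₗ-distribˡ = λ a x y → ≈⇒~ (*ₗ-distribˡ a x y)
          }
        }
      ; -ᴹ‿cong = ~-neg
      ; -ᴹ‿inverse = (λ x → ≈⇒~ (-ᴹ‿inverseˡ x)) , (λ x → ≈⇒~ (-ᴹ‿inverseʳ x))
      }
    }

record LinearMap {R : Ring 0ℓ 0ℓ} (M N : LeftModule R 0ℓ 0ℓ) : Set where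
  private
    module M = LeftModule M
    module N = LeftModule N
  field
    ⟪_⟫    : M.Carrierᴹ → N.Carrierᴹ
    resp   : ∀ {x y} → x M.≈ᴹ y → ⟪ x ⟫ N.≈ᴹ ⟪ y ⟫
    +-homo : ∀ x y → ⟪ x M.+ᴹ y ⟫ N.≈ᴹ ⟪ x ⟫ N.+ᴹ ⟪ y ⟫
    *-homo : ∀ a x → ⟪ a M.*ₗ x ⟫ N.≈ᴹ a N.*ₗ ⟪ x ⟫

  0-homo : ⟪ M.0ᴹ ⟫ N.≈ᴹ N.0ᴹ
  0-homo = N.≈ᴹ-trans (resp (M.≈ᴹ-sym (M.*ₗ-zeroˡ M.0ᴹ)))
    (N.≈ᴹ-trans (*-homo (Ring.0# R) M.0ᴹ) (N.*ₗ-zeroˡ ⟪ M.0ᴹ ⟫))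

  sub-homo : ∀ x y → ⟪ Subtraction._-ᴹ_ M x y ⟫ N.≈ᴹ Subtraction._-ᴹ_ N ⟪ x ⟫ ⟪ y ⟫
  sub-homo x y = N.≈ᴹ-trans (+-homo x (M.-ᴹ y)) (N.+ᴹ-congˡ
    (N.≈ᴹ-trans (resp (M.≈ᴹ-sym (Subtraction.-1*ₗ M y)))
      (N.≈ᴹ-trans (*-homo (Ring.-_ R (Ring.1# R)) y) (Subtraction.-1*ₗ N ⟪ y ⟫))))

  combination-homo : ∀ {A : Set} (φ : A → M.Carrierᴹ) L →
    ⟪ Subtraction.combination M φ L ⟫ N.≈ᴹ Subtraction.combination N (λ x → ⟪ φ x ⟫) L
  combination-homo φ []            = 0-homo
  combination-homo φ ((c , x) ∷ L) =
    N.≈ᴹ-trans (+-homo _ _) (N.+ᴹ-cong (*-homo c (φ x)) (combination-homo φ L))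

  vanishes-on-span : ∀ {S : Pred M.Carrierᴹ 0ℓ} → (∀ {x} → x ∈ S → ⟪ x ⟫ N.≈ᴹ N.0ᴹ) →
    ∀ {x} → x ∈ LinearCombinations.Span M.rawLeftModule S → ⟪ x ⟫ N.≈ᴹ N.0ᴹ
  vanishes-on-span {S} vanishes (L , all , e) = N.≈ᴹ-trans (resp e) (go L all)
    where
    go : ∀ L → All (λ (_ , y) → y ∈ S) L →
         ⟪ Subtraction.combination M (λ x → x) L ⟫ N.≈ᴹ N.0ᴹ
    go []            []        = 0-homo
    go ((c , x) ∷ L) (s ∷ all) = N.≈ᴹ-trans (+-homo _ _) (N.≈ᴹ-trans
      (N.+ᴹ-cong
        (N.≈ᴹ-trans (*-homo c x) (N.≈ᴹ-trans (N.*ₗ-congˡ (vanishes s)) (N.*ₗ-zeroʳ c)))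
        (go L all))
      (N.+ᴹ-identityˡ N.0ᴹ))

-- Counting

⟦_⟧ : Bool → ℕ
⟦ b ⟧ = if b then 1 else 0

# : ∀ {n} → (Fin n → Bool) → ℕ
# p = sum (⟦_⟧ ∘ p)

#-cong : ∀ {n} {p q : Fin n → Bool} → (∀ i → p i ≡ q i) → # p ≡ # q
#-cong p≗q = sum-cong-≗ (cong ⟦_⟧ ∘ p≗q)

#-remove : ∀ {n} i (p : Fin (suc n) → Bool) → # p ≡ ⟦ p i ⟧ ℕ.+ # (p ∘ punchIn i)
#-remove i p = sum-remove {i = i} (⟦_⟧ ∘ p)

#-false : ∀ {n} {p : Fin n → Bool} → (∀ i → p i ≡ false) → # p ≡ 0
#-false {n} p≗false = ≡.trans (#-cong p≗false) (sum-replicate-zero n)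

#-singleton : ∀ {n} i (p : Fin n → Bool) → (∀ j → j ≢ i → p j ≡ false) → # p ≡ ⟦ p i ⟧
#-singleton {suc n} i p others = ≡.trans (#-remove i p)
  (≡.trans (cong (⟦ p i ⟧ ℕ.+_) (#-false λ j → others (punchIn i j) (Fin.punchInᵢ≢i i j)))
    (ℕ.+-identityʳ _))

#-witness : ∀ {n} (p : Fin n → Bool) → # p ≢ 0 → ∃ λ i → p i ≡ true
#-witness {zero}  p #≢0 = contradiction ≡.refl #≢0
#-witness {suc n} p #≢0 with p zero in eq
... | true  = zero , eq
... | false = let (i , pi) = #-witness (p ∘ suc) #≢0 in suc i , pi

#-positive : ∀ {n} (p : Fin n → Bool) i → p i ≡ true → 1 ≤ # p
#-positive {suc n} p i pi =
  subst (1 ≤_) (≡.sym (≡.trans (#-remove i p) (cong (λ b → ⟦ b ⟧ ℕ.+ # (p ∘ punchIn i)) pi))) (s≤s z≤n)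

#-split : ∀ {n} (p q : Fin n → Bool) →
          # (λ i → p i ∧ q i) ℕ.+ # (λ i → p i ∧ not (q i)) ≡ # p
#-split p q = ≡.trans (≡.sym (∑-distrib-+ (λ i → ⟦ p i ∧ q i ⟧) (λ i → ⟦ p i ∧ not (q i) ⟧)))
  (sum-cong-≗ λ i → split (p i) (q i))
  where
  split : ∀ a b → ⟦ a ∧ b ⟧ ℕ.+ ⟦ a ∧ not b ⟧ ≡ ⟦ a ⟧
  split true  true  = ≡.refl
  split true  false = ≡.refl
  split false _     = ≡.refl

#-fibres : ∀ {m n} (f : Fin m → Fin n) (p : Fin m → Bool) →
           sum (λ i → # (λ v → does (i Fin.≟ f v) ∧ p v)) ≡ # p
#-fibres {m} {n} f p = ≡.trans (∑-comm λ i v → ⟦ does (i Fin.≟ f v) ∧ p v ⟧)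
  (sum-cong-≗ λ v → ≡.trans
    (#-singleton (f v) (λ i → does (i Fin.≟ f v) ∧ p v)
      λ i i≢fv → cong (_∧ p v) (dec-false (i Fin.≟ f v) i≢fv))
    (cong (λ b → ⟦ b ∧ p v ⟧) (dec-true (f v Fin.≟ f v) ≡.refl)))

sum-mono : ∀ {n} {f g : Fin n → ℕ} → (∀ i → f i ≤ g i) → sum f ≤ sum g
sum-mono {zero}  f≤g = z≤n
sum-mono {suc n} f≤g = ℕ.+-mono-≤ (f≤g zero) (sum-mono (f≤g ∘ suc))

-- Turns one inequality between the ranks of two forests into an equality of root counts in every
-- colour class.
sum-squeeze : ∀ {n} {f g : Fin n → ℕ} → (∀ i → f i ≤ g i) → sum g ≤ sum f → ∀ i → f i ≡ g i
sum-squeeze {suc n} {f} {g} f≤g Σg≤Σf zero = ℕ.≤-antisym (f≤g zero)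
  (ℕ.+-cancelʳ-≤ (sum (g ∘ suc)) _ _
    (ℕ.≤-trans Σg≤Σf (ℕ.+-monoʳ-≤ (f zero) (sum-mono (f≤g ∘ suc)))))
sum-squeeze {suc n} {f} {g} f≤g Σg≤Σf (suc i) = sum-squeeze (f≤g ∘ suc)
  (ℕ.+-cancelˡ-≤ (g zero) _ _
    (ℕ.≤-trans Σg≤Σf (ℕ.+-monoˡ-≤ (sum (f ∘ suc)) (f≤g zero)))) i

module _ {A : Set} (_≟_ : DecidableEquality A) where

  -- Match the first element with any element of the same label, delete both and recurse: the counts
  -- of the remaining labels still agree.
  equal-counts⇒permutation : ∀ {m n} (f : Fin m → A) (g : Fin n → A) →
    (∀ a → # (λ v → does (a ≟ f v)) ≡ # (λ v → does (a ≟ g v))) →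
    ∃ λ (π : Permutation m n) → ∀ v → g (π ⟨$⟩ʳ v) ≡ f v
  equal-counts⇒permutation {zero}  {zero}  f g same = Perm.id , λ ()
  equal-counts⇒permutation {zero}  {suc n} f g same = contradiction
    (subst (1 ≤_) (≡.sym (same (g zero)))
      (#-positive (λ v → does (g zero ≟ g v)) zero (dec-true (g zero ≟ g zero) ≡.refl)))
    λ ()
  equal-counts⇒permutation {suc m} {n} f g same
    with #-witness (λ v → does (f zero ≟ g v)) (λ eq → contradiction
      (subst (1 ≤_) (≡.trans (same (f zero)) eq)
        (#-positive (λ v → does (f zero ≟ f v)) zero (dec-true (f zero ≟ f zero) ≡.refl)))
      λ ())
  equal-counts⇒permutation {suc m} {suc n} f g same | j , dfg =
    Perm.insert zero j π , λ { zero → ≡.sym f0≡gj ; (suc v) → π-labels v }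
    where
    true⇒≡ : ∀ {a b} → does (a ≟ b) ≡ true → a ≡ b
    true⇒≡ {a} {b} d with a ≟ b
    ... | yes eq = eq

    f0≡gj : f zero ≡ g j
    f0≡gj = true⇒≡ dfg

    rest : ∀ a → # (λ v → does (a ≟ f (suc v))) ≡ # (λ v → does (a ≟ g (punchIn j v)))
    rest a = ℕ.+-cancelˡ-≡ ⟦ does (a ≟ f zero) ⟧ _ _ (≡.trans (same a)
      (≡.trans (#-remove j (λ v → does (a ≟ g v)))
        (cong (λ b → ⟦ does (a ≟ b) ⟧ ℕ.+ # (λ v → does (a ≟ g (punchIn j v)))) (≡.sym f0≡gj))))

    smaller = equal-counts⇒permutation (f ∘ suc) (g ∘ punchIn j) rest
    π = proj₁ smaller
    π-labels = proj₂ smaller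

Idempotent : ∀ {n} → (Fin n → Fin n) → Set
Idempotent r = ∀ v → r (r v) ≡ r v

-- An idempotent r stands for the forest of stars with an edge from each v to
-- its root r v.
Roots : ℕ → Set
Roots n = ∃ λ (r : Fin n → Fin n) → Idempotent r

isRoot : ∀ {n} → (Fin n → Fin n) → Fin n → Bool
isRoot r v = does (v Fin.≟ r v)

-- The number of components of the star forest, isolated vertices included, since each star has
-- exactly one root.
rank : ∀ {n} → (Fin n → Fin n) → ℕ
rank r = # (isRoot r)

private
  LabelEq : ∀ {n} → DecidableEquality (Fin n × Bool)
  LabelEq (i , b) (j , c) = map′ (λ (p , q) → cong₂ _,_ p q) (λ eq → cong proj₁ eq , cong proj₂ eq)
    ((i Fin.≟ j) ×-dec (b Bool.≟ c))

-- A colouring κ constant on the stars of r′, whose colour classes have the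
-- sizes of the stars of r, sends the roots of r′ onto the roots of r.  If r′ has
-- no more roots than r, this is a bijection, and then so many vertices remain in
-- each class that the two forests are isomorphic.
conjugate : ∀ {m n} {r′ : Fin m → Fin m} {r : Fin n → Fin n} →
  Idempotent r′ → Idempotent r → (κ : Fin m → Fin n) → (∀ v → κ (r′ v) ≡ κ v) →
  (∀ i → # (λ v → does (i Fin.≟ κ v)) ≡ # (λ v → does (i Fin.≟ r v))) →
  rank r′ ≤ rank r → ∃ λ (π : Permutation m n) → ∀ v → π ⟨$⟩ʳ (r′ v) ≡ r (π ⟨$⟩ʳ v)
conjugate {m} {n} {r′} {r} idem′ idem κ closed sizes rank≤ = π , commutes
  where
  roots-at roots′-at : Fin n → ℕ
  roots-at  i = # (λ v → does (i Fin.≟ r v) ∧ isRoot r v)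
  roots′-at i = # (λ v → does (i Fin.≟ κ v) ∧ isRoot r′ v)

  roots-at-≡ : ∀ i → roots-at i ≡ ⟦ does (i Fin.≟ r i) ∧ isRoot r i ⟧
  roots-at-≡ i = #-singleton i _ others
    where
    others : ∀ j → j ≢ i → does (i Fin.≟ r j) ∧ isRoot r j ≡ false
    others j j≢i with i Fin.≟ r j | j Fin.≟ r j
    ... | yes i≡rj | yes j≡rj = contradiction (≡.trans j≡rj (≡.sym i≡rj)) j≢i
    ... | yes _    | no  _    = ≡.refl
    ... | no  _    | _        = ≡.refl

  -- `κ` is constant on stars, so a colour used at `v` is also used at the root `r′ v`.
  occupied : ∀ i v → κ v ≡ i → 1 ≤ roots′-at i
  occupied i v κv≡i = #-positive _ (r′ v) (cong₂ _∧_
    (dec-true (i Fin.≟ κ (r′ v)) (≡.sym (≡.trans (closed v) κv≡i)))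
    (dec-true (r′ v Fin.≟ r′ (r′ v)) (≡.sym (idem′ v))))

  -- A root `i` of `r` lies in its own star, so by `sizes` the colour `i` is used by `κ`, hence by
  -- some root of `r′`.
  roots-≤ : ∀ i → roots-at i ≤ roots′-at i
  roots-≤ i rewrite roots-at-≡ i with i Fin.≟ r i
  ... | no  _    = z≤n
  ... | yes i≡ri with #-witness (λ v → does (i Fin.≟ κ v)) (λ eq → contradiction
    (subst (1 ≤_) (≡.trans (≡.sym (sizes i)) eq)
      (#-positive (λ v → does (i Fin.≟ r v)) i (dec-true (i Fin.≟ r i) i≡ri))) λ ())
  ... | v , d with i Fin.≟ κ v
  ... | yes i≡κv = occupied i v (≡.sym i≡κv)

  roots-≡ : ∀ i → roots-at i ≡ roots′-at i
  -- Summed over all `i`, the two counts are `rank r` and `rank r′`, and `rank≤` bounds them the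
  -- other way.
  roots-≡ = sum-squeeze roots-≤ (ℕ.≤-trans (ℕ.≤-reflexive (#-fibres κ (isRoot r′)))
    (ℕ.≤-trans rank≤ (ℕ.≤-reflexive (≡.sym (#-fibres r (isRoot r))))))

  label′ : Fin m → Fin n × Bool
  label′ v = κ v , isRoot r′ v

  label : Fin n → Fin n × Bool
  label v = r v , isRoot r v

  does-true : ∀ a b → a ∧ does (true Bool.≟ b) ≡ a ∧ b
  does-true a true  = ≡.refl
  does-true a false = ≡.refl

  does-false : ∀ a b → a ∧ does (false Bool.≟ b) ≡ a ∧ not b
  does-false a true  = ≡.refl
  does-false a false = ≡.refl

  -- Roots are matched by `roots-≡`; the other vertices of a class are what is left of the equal
  -- class sizes after the roots are taken away.
  same : ∀ a → # (λ v → does (LabelEq a (label′ v))) ≡ # (λ v → does (LabelEq a (label v)))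
  same (i , true)  = ≡.trans (#-cong λ v → does-true _ (isRoot r′ v))
    (≡.trans (≡.sym (roots-≡ i)) (≡.sym (#-cong λ v → does-true _ (isRoot r v))))
  same (i , false) = ≡.trans (#-cong λ v → does-false _ (isRoot r′ v))
    (≡.trans
      (ℕ.+-cancelˡ-≡ (roots-at i) _ _ (≡.trans
        (cong (ℕ._+ # (λ v → does (i Fin.≟ κ v) ∧ not (isRoot r′ v))) (roots-≡ i))
        (≡.trans (#-split (λ v → does (i Fin.≟ κ v)) (isRoot r′))
          (≡.trans (sizes i) (≡.sym (#-split (λ v → does (i Fin.≟ r v)) (isRoot r)))))))
      (≡.sym (#-cong λ v → does-false _ (isRoot r v))))

  found = equal-counts⇒permutation LabelEq label′ label same
  π = proj₁ found

  r∘π : ∀ v → r (π ⟨$⟩ʳ v) ≡ κ v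
  r∘π v = cong proj₁ (proj₂ found v)

  root-π : ∀ v → r (π ⟨$⟩ʳ r′ v) ≡ π ⟨$⟩ʳ r′ v
  root-π v with (π ⟨$⟩ʳ r′ v) Fin.≟ r (π ⟨$⟩ʳ r′ v) | cong proj₂ (proj₂ found (r′ v))
  ... | yes eq | _ = ≡.sym eq
  ... | no  _  | eq rewrite dec-true (r′ v Fin.≟ r′ (r′ v)) (≡.sym (idem′ v)) = contradiction eq λ ()

  -- The labels send roots to roots, so `r` fixes the image of `r′ v`; by the labels again, both
  -- sides equal `κ v`.
  commutes : ∀ v → π ⟨$⟩ʳ r′ v ≡ r (π ⟨$⟩ʳ v)
  commutes v = ≡.trans (≡.sym (root-π v))
    (≡.trans (r∘π (r′ v)) (≡.trans (closed v) (≡.sym (r∘π v))))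

-- Permutations and multisets of edges

π-injective : ∀ {m n} (π : Permutation m n) {i j} → π ⟨$⟩ʳ i ≡ π ⟨$⟩ʳ j → i ≡ j
π-injective π = Injection.injective (↔⇒↣ π)

-- For reindexing along a bijection: the image of `allFin` or of `colourings` is once more a
-- complete enumeration without repetition.
complete-unique⇒↭ : ∀ {A : Set} {xs ys : List A} → Unique xs → Unique ys →
  (∀ x → x ∈ˡ xs) → (∀ x → x ∈ˡ ys) → xs ↭ ys
complete-unique⇒↭ ux uy cx cy =
  ∼bag⇒↭ (unique∧set⇒bag ux uy (mk⇔ (λ _ → cy _) (λ _ → cx _)))

map-allFin-↭ : ∀ {m n} (π : Permutation m n) → map (π ⟨$⟩ʳ_) (allFin m) ↭ allFin n
map-allFin-↭ {m} {n} π = complete-unique⇒↭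
  (Unique.map⁺ (π-injective π) (Unique.allFin⁺ m)) (Unique.allFin⁺ n)
  (λ v → subst (_∈ˡ map (π ⟨$⟩ʳ_) (allFin m)) (Perm.inverseʳ π) (∈-map⁺ (π ⟨$⟩ʳ_) (∈-allFin _)))
  ∈-allFin

-- `Ext` puts a relator on the first `k` vertices; relabelling by this `π` moves it to any `k`
-- distinct vertices.
extend : ∀ {k n} (f : Fin k → Fin n) → (∀ {i j} → f i ≡ f j → i ≡ j) → (k≤n : k ≤ n) →
         ∃ λ (π : Permutation′ n) → ∀ i → π ⟨$⟩ʳ inject≤ i k≤n ≡ f i
extend {zero}  {n}     f inj k≤n = Perm.id , λ ()
extend {suc k} {suc n} f inj k≤n = Perm.insert zero (f zero) π ,
  λ { zero → ≡.refl
    ; (suc i) → ≡.trans (cong (punchIn (f zero)) (proj₂ smaller i)) (Fin.punchIn-punchOut (f0≢ i)) }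
  where
  f0≢ : ∀ i → f zero ≢ f (suc i)
  f0≢ i eq = contradiction (inj eq) λ ()

  smaller = extend (λ i → punchOut (f0≢ i))
    (λ {i} {j} eq → Fin.suc-injective (inj (Fin.punchOut-injective (f0≢ i) (f0≢ j) eq)))
    (ℕ.s≤s⁻¹ k≤n)
  π = proj₁ smaller

relabel : ∀ {m n} → (Fin m → Fin n) → Edges m → Edges n
relabel f = map λ (u , v) → f u , f v

relabel-inverse : ∀ {n} (π : Permutation′ n) E → relabel (π ⟨$⟩ʳ_) (relabel (π ⟨$⟩ˡ_) E) ≡ E
relabel-inverse π []            = ≡.refl
relabel-inverse π ((u , v) ∷ E) =
  cong₂ _∷_ (cong₂ _,_ (Perm.inverseʳ π) (Perm.inverseʳ π)) (relabel-inverse π E)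

length-filter-∷ : ∀ {A : Set} {P : A → Set} (P? : ∀ x → Dec (P x)) x xs →
  length (filter P? (x ∷ xs)) ≡ ⟦ does (P? x) ⟧ ℕ.+ length (filter P? xs)
length-filter-∷ P? x xs with does (P? x)
... | true  = ≡.refl
... | false = ≡.refl

length-filter-map : ∀ {A B : Set} {P : A → Set} {Q : B → Set}
  (P? : ∀ x → Dec (P x)) (Q? : ∀ x → Dec (Q x)) (f : A → B) →
  (∀ x → does (P? x) ≡ does (Q? (f x))) →
  ∀ xs → length (filter P? xs) ≡ length (filter Q? (map f xs))
length-filter-map P? Q? f eq []       = ≡.refl
length-filter-map P? Q? f eq (x ∷ xs)
  rewrite length-filter-∷ P? x xs | length-filter-∷ Q? (f x) (map f xs) | eq x =
  cong (⟦ does (Q? (f x)) ⟧ ℕ.+_) (length-filter-map P? Q? f eq xs)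

multiplicity-relabel : ∀ {m n} (f : Fin m → Fin n) → (∀ {i j} → f i ≡ f j → i ≡ j) →
  ∀ E u v → multiplicity E u v ≡ multiplicity (relabel f E) (f u) (f v)
multiplicity-relabel f inj E u v = length-filter-map (sameEdge? (u , v)) (sameEdge? (f u , f v)) _
  (λ (a , b) → does-⇔ (mk⇔
    (λ { (inj₁ (p , q)) → inj₁ (cong f p , cong f q) ; (inj₂ (p , q)) → inj₂ (cong f p , cong f q) })
    (λ { (inj₁ (p , q)) → inj₁ (inj p , inj q) ; (inj₂ (p , q)) → inj₂ (inj p , inj q) }))
    (sameEdge? (u , v) (a , b)) (sameEdge? (f u , f v) (f a , f b)))
  E

relabel-≅ : ∀ {m n} (π : Permutation m n) E → (m , E) ≅ (n , relabel (π ⟨$⟩ʳ_) E)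
relabel-≅ π E = π , multiplicity-relabel (π ⟨$⟩ʳ_) (π-injective π) E

↭⇒≅ : ∀ {n} {E F : Edges n} → E ↭ F → (n , E) ≅ (n , F)
↭⇒≅ p = Perm.id , λ u v → ↭-length (filter-↭ (sameEdge? (u , v)) p)

flip-≅ : ∀ {n} (u v : Fin n) E → (n , (u , v) ∷ E) ≅ (n , (v , u) ∷ E)
flip-≅ u v E = Perm.id , λ a b → ≡.trans (length-filter-∷ (sameEdge? (a , b)) (u , v) E)
  (≡.trans (cong (λ c → ⟦ c ⟧ ℕ.+ multiplicity E a b) (does-⇔ (mk⇔ turn turn)
      (sameEdge? (a , b) (u , v)) (sameEdge? (a , b) (v , u))))
    (≡.sym (length-filter-∷ (sameEdge? (a , b)) (v , u) E)))
  where
  turn : ∀ {a b u v} → SameEdge (a , b) (u , v) → SameEdge (a , b) (v , u)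
  turn (inj₁ (p , q)) = inj₂ (p , q)
  turn (inj₂ (p , q)) = inj₁ (p , q)

≋⇒≅ : ∀ {G H} → G ≋ H → G ≅ H
≋⇒≅ {m , E} {n , F} (≡.refl , same) = Perm.id , λ u v → ≡.trans (same u v)
  (cong₂ (multiplicity F) (Fin.cast-is-id ≡.refl u) (Fin.cast-is-id ≡.refl v))

same-refl : ∀ {n} (f : Fin n × Fin n) → SameEdge f f
same-refl f = inj₁ (≡.refl , ≡.refl)

same-compatible : ∀ {n} {f g x : Fin n × Fin n} → SameEdge f g → SameEdge x f → SameEdge x g
same-compatible (inj₁ (≡.refl , ≡.refl)) s = s
same-compatible (inj₂ (≡.refl , ≡.refl)) (inj₁ (p , q)) = inj₂ (p , q)
same-compatible (inj₂ (≡.refl , ≡.refl)) (inj₂ (p , q)) = inj₁ (p , q)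

same-sym : ∀ {n} {f g : Fin n × Fin n} → SameEdge f g → SameEdge g f
same-sym (inj₁ (p , q)) = inj₁ (≡.sym p , ≡.sym q)
same-sym (inj₂ (p , q)) = inj₂ (≡.sym q , ≡.sym p)

-- Used twice: to find the partner of an edge in another multiset, and to obtain an admissible
-- colouring from a nonzero count.
extract : ∀ {A : Set} {P : A → Set} (P? : ∀ x → Dec (P x)) xs →
  length (filter P? xs) ≢ 0 → ∃ λ x → P x × ∃ λ ys → xs ↭ x ∷ ys
extract P? []       ≢0 = contradiction ≡.refl ≢0
extract P? (x ∷ xs) ≢0 with P? x
... | yes px = x , px , xs , ↭-refl
... | no  _  = let (y , py , ys , p) = extract P? xs ≢0
               in y , py , x ∷ ys , ↭.trans (prep x p) (swap x y ↭-refl)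

-- Lists with equal multiplicities need not be permutations of each other, as an edge may be listed
-- in either orientation. So each edge of `E` is matched with an edge of `F` up to orientation,
-- which `resp` makes invisible to `P?`.
same-multiplicities : ∀ {n} {P : Fin n × Fin n → Set} (P? : ∀ f → Dec (P f)) →
  (∀ {f g} → SameEdge f g → does (P? f) ≡ does (P? g)) → ∀ E F →
  (∀ u v → multiplicity E u v ≡ multiplicity F u v) →
  length (filter P? E) ≡ length (filter P? F)
same-multiplicities P? resp []            []            same = ≡.refl
same-multiplicities P? resp []            (f@(u , v) ∷ F) same = contradiction
  (≡.trans (same u v) (≡.trans (length-filter-∷ (sameEdge? f) f F)
    (cong (λ b → ⟦ b ⟧ ℕ.+ multiplicity F u v) (dec-true (sameEdge? f f) (same-refl f)))))
  λ ()
same-multiplicities P? resp (f@(u , v) ∷ E) F same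
  with extract (sameEdge? f) F (λ eq → contradiction
    (≡.trans (≡.sym eq) (≡.trans (≡.sym (same u v)) (≡.trans (length-filter-∷ (sameEdge? f) f E)
      (cong (λ b → ⟦ b ⟧ ℕ.+ multiplicity E u v) (dec-true (sameEdge? f f) (same-refl f))))))
    λ ())
... | g , f~g , F′ , p = begin
  length (filter P? (f ∷ E))                 ≡⟨ length-filter-∷ P? f E ⟩
  ⟦ does (P? f) ⟧ ℕ.+ length (filter P? E)     ≡⟨ cong₂ (λ b n → ⟦ b ⟧ ℕ.+ n) (resp f~g)
                                                  (same-multiplicities P? resp E F′ rest) ⟩
  ⟦ does (P? g) ⟧ ℕ.+ length (filter P? F′)    ≡⟨ length-filter-∷ P? g F′ ⟨
  length (filter P? (g ∷ F′))                ≡⟨ ↭-length (filter-↭ P? p) ⟨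
  length (filter P? F)                       ∎
  where
  open ≡.≡-Reasoning
  rest : ∀ a b → multiplicity E a b ≡ multiplicity F′ a b
  rest a b = ℕ.+-cancelˡ-≡ ⟦ does (sameEdge? x f) ⟧ _ _ (begin
    ⟦ does (sameEdge? x f) ⟧ ℕ.+ multiplicity E a b    ≡⟨ length-filter-∷ (sameEdge? x) f E ⟨
    multiplicity (f ∷ E) a b                         ≡⟨ same a b ⟩
    multiplicity F a b                               ≡⟨ ↭-length (filter-↭ (sameEdge? x) p) ⟩
    multiplicity (g ∷ F′) a b                        ≡⟨ length-filter-∷ (sameEdge? x) g F′ ⟩
    ⟦ does (sameEdge? x g) ⟧ ℕ.+ multiplicity F′ a b
      ≡⟨ cong (λ c → ⟦ c ⟧ ℕ.+ multiplicity F′ a b) (does-⇔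
           (mk⇔ (same-compatible (same-sym f~g)) (same-compatible f~g))
           (sameEdge? x g) (sameEdge? x f)) ⟩
    ⟦ does (sameEdge? x f) ⟧ ℕ.+ multiplicity F′ a b   ∎)
    where x = a , b

-- Colourings

-- The pullback of a colouring along a map of vertices; the colours themselves are untouched.
recolour : ∀ {m n k} → (Fin m → Fin n) → Colouring k n → Colouring k m
recolour f κ = tabulate (lookup κ ∘ f)

monochromatic? : ∀ {k n} (κ : Colouring k n) ((u , v) : Fin n × Fin n) → Dec (lookup κ u ≡ lookup κ v)
monochromatic? κ (u , v) = lookup κ u Fin.≟ lookup κ v

e-relabel : ∀ {m n k} (f : Fin m → Fin n) (κ : Colouring k n) E →
            e (recolour f κ) E ≡ e κ (relabel f E)
e-relabel f κ = length-filter-map (monochromatic? (recolour f κ)) (monochromatic? κ) _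
  λ (u , v) → cong₂ (λ i j → does (i Fin.≟ j)) (lookup∘tabulate _ u) (lookup∘tabulate _ v)

e-≅ : ∀ {m n k} {E : Edges m} {F : Edges n} (G≅H : (m , E) ≅ (n , F)) (κ : Colouring k n) →
      e (recolour (proj₁ G≅H ⟨$⟩ʳ_) κ) E ≡ e κ F
e-≅ {m} {n} {k} {E} {F} (π , same) κ = ≡.trans (e-relabel (π ⟨$⟩ʳ_) κ E)
  (same-multiplicities (monochromatic? κ) symmetric (relabel (π ⟨$⟩ʳ_) E) F λ u v → begin
    multiplicity (relabel (π ⟨$⟩ʳ_) E) u v
      ≡⟨ cong₂ (multiplicity (relabel (π ⟨$⟩ʳ_) E)) (Perm.inverseʳ π) (Perm.inverseʳ π) ⟨
    multiplicity (relabel (π ⟨$⟩ʳ_) E) (π ⟨$⟩ʳ (π ⟨$⟩ˡ u)) (π ⟨$⟩ʳ (π ⟨$⟩ˡ v))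
      ≡⟨ multiplicity-relabel (π ⟨$⟩ʳ_) (π-injective π) E (π ⟨$⟩ˡ u) (π ⟨$⟩ˡ v) ⟨
    multiplicity E (π ⟨$⟩ˡ u) (π ⟨$⟩ˡ v)
      ≡⟨ same (π ⟨$⟩ˡ u) (π ⟨$⟩ˡ v) ⟩
    multiplicity F (π ⟨$⟩ʳ (π ⟨$⟩ˡ u)) (π ⟨$⟩ʳ (π ⟨$⟩ˡ v))
      ≡⟨ cong₂ (multiplicity F) (Perm.inverseʳ π) (Perm.inverseʳ π) ⟩
    multiplicity F u v ∎)
  where
  open ≡.≡-Reasoning
  symmetric : ∀ {f g} → SameEdge f g → does (monochromatic? κ f) ≡ does (monochromatic? κ g)
  symmetric (inj₁ (≡.refl , ≡.refl)) = ≡.refl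
  symmetric {u , v} (inj₂ (≡.refl , ≡.refl)) =
    does-⇔ (mk⇔ ≡.sym ≡.sym) (monochromatic? κ (u , v)) (monochromatic? κ (v , u))

occurrences-# : ∀ {k n} (κ : Colouring k n) i → occurrences κ i ≡ # (λ v → does (i Fin.≟ lookup κ v))
occurrences-# []      i = ≡.refl
occurrences-# (j ∷ κ) i with does (i Fin.≟ j)
... | true  = cong suc (occurrences-# κ i)
... | false = occurrences-# κ i

occurrences-recolour : ∀ {m n k} (π : Permutation m n) (κ : Colouring k n) i →
  occurrences (recolour (π ⟨$⟩ʳ_) κ) i ≡ occurrences κ i
occurrences-recolour π κ i = begin
  occurrences (recolour (π ⟨$⟩ʳ_) κ) i
    ≡⟨ occurrences-# (recolour (π ⟨$⟩ʳ_) κ) i ⟩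
  # (λ v → does (i Fin.≟ lookup (recolour (π ⟨$⟩ʳ_) κ) v))
    ≡⟨ #-cong (λ v → cong (λ j → does (i Fin.≟ j)) (lookup∘tabulate (lookup κ ∘ (π ⟨$⟩ʳ_)) v)) ⟩
  # (λ v → does (i Fin.≟ lookup κ (π ⟨$⟩ʳ v)))
    ≡⟨ sum-permute (λ v → ⟦ does (i Fin.≟ lookup κ v) ⟧) π ⟨
  # (λ v → does (i Fin.≟ lookup κ v))
    ≡⟨ occurrences-# κ i ⟨
  occurrences κ i ∎
  where open ≡.≡-Reasoning

colourings : ∀ k n → List (Colouring k n)
colourings k zero    = [] ∷ []
colourings k (suc n) = cartesianProductWith _∷_ (allFin k) (colourings k n)

∈-colourings : ∀ {k n} (κ : Colouring k n) → κ ∈ˡ colourings k n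
∈-colourings []      = here ≡.refl
∈-colourings (i ∷ κ) = ∈-cartesianProductWith⁺ _∷_ (∈-allFin i) (∈-colourings κ)

colourings-unique : ∀ k n → Unique (colourings k n)
colourings-unique k zero    = [] ∷ []
colourings-unique k (suc n) =
  Unique.cartesianProductWith⁺ _∷_ ∷-injective (Unique.allFin⁺ k) (colourings-unique k n)

recolour-inverse : ∀ {m n k} (π : Permutation m n) (κ : Colouring k n) →
  recolour (π ⟨$⟩ˡ_) (recolour (π ⟨$⟩ʳ_) κ) ≡ κ
recolour-inverse π κ = ≡.trans
  (tabulate-cong λ v → ≡.trans (lookup∘tabulate _ (π ⟨$⟩ˡ v)) (cong (lookup κ) (Perm.inverseʳ π)))
  (tabulate∘lookup κ)

recolour-↭ : ∀ {m n} k (π : Permutation m n) →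
  map (recolour (π ⟨$⟩ʳ_)) (colourings k n) ↭ colourings k m
recolour-↭ {m} {n} k π = complete-unique⇒↭
  (Unique.map⁺ injective (colourings-unique k n)) (colourings-unique k m)
  (λ κ → subst (_∈ˡ map (recolour (π ⟨$⟩ʳ_)) (colourings k n)) (recolour-inverse (Perm.flip π) κ)
    (∈-map⁺ (recolour (π ⟨$⟩ʳ_)) (∈-colourings (recolour (π ⟨$⟩ˡ_) κ))))
  ∈-colourings
  where
  injective : ∀ {κ μ : Colouring k n} → recolour (π ⟨$⟩ʳ_) κ ≡ recolour (π ⟨$⟩ʳ_) μ → κ ≡ μ
  injective {κ} {μ} eq = ≡.trans (≡.sym (recolour-inverse π κ))
    (≡.trans (cong (recolour (π ⟨$⟩ˡ_)) eq) (recolour-inverse π μ))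

-- Edge differences and star forests

-- Merges the star of the root `a` into the star of `b`: all that pointed to `a`, including `a`
-- itself, points to `b`.
redirect : ∀ {n} → (Fin n → Fin n) → Fin n → Fin n → Fin n → Fin n
redirect r a b v = if does (r v Fin.≟ a) then b else r v

module _ {n} (r : Fin n → Fin n) {a b : Fin n} where
  redirect-≡ : ∀ v → r v ≡ a → redirect r a b v ≡ b
  redirect-≡ v eq rewrite dec-true (r v Fin.≟ a) eq = ≡.refl

  redirect-≢ : ∀ v → r v ≢ a → redirect r a b v ≡ r v
  redirect-≢ v neq rewrite dec-false (r v Fin.≟ a) neq = ≡.refl

  redirect-idempotent : Idempotent r → b ≢ a → r b ≡ b → Idempotent (redirect r a b)
  redirect-idempotent idem b≢a rb≡b v with r v Fin.≟ a
  ... | yes _   = ≡.trans (redirect-≢ b λ rb≡a → b≢a (≡.trans (≡.sym rb≡b) rb≡a)) rb≡b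
  ... | no  r≢a = ≡.trans (redirect-≢ (r v) λ e → r≢a (≡.trans (≡.sym (idem v)) e)) (idem v)

-- Used with two modules `Q`: graphs modulo the relators, where the relations hold by construction,
-- and polynomials, where the values of forests are computed.
module EdgeDifferences
  (R : CommutativeRing 0ℓ 0ℓ) (t : CommutativeRing.Carrier R)
  (Q : LeftModule (CommutativeRing.ring R) 0ℓ 0ℓ) where

  open CommutativeRing R using (1#; -_; _+_; _*_) renaming (Carrier to C)
  open LeftModule Q
  open Algebra.Properties.AbelianGroup +ᴹ-abelianGroup using (⁻¹-∙-comm)
  open Subtraction Q

  private variable
    n : ℕ

  functions : ℕ → Setoid 0ℓ 0ℓ
  functions n = record
    { Carrier = Edges n → Carrierᴹ
    ; _≈_ = λ φ ψ → ∀ E → φ E ≈ᴹ ψ E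
    ; isEquivalence = record
      { refl = λ E → ≈ᴹ-refl
      ; sym = λ e E → ≈ᴹ-sym (e E)
      ; trans = λ e f E → ≈ᴹ-trans (e E) (f E)
      }
    }

  infix 4 _≈ᶠ_
  _≈ᶠ_ : (φ ψ : Edges n → Carrierᴹ) → Set
  φ ≈ᶠ ψ = ∀ E → φ E ≈ᴹ ψ E

  -- Multiplication by `x_f`, read as "add the edge `f`, minus leave it out". It acts on functions
  -- of all further edges `E`, so a relation stated for `∂` already includes every graph that
  -- contains it.
  ∂ : Fin n × Fin n → (Edges n → Carrierᴹ) → (Edges n → Carrierᴹ)
  ∂ f φ E = φ (f ∷ E) -ᴹ φ E

  ∂-cong : ∀ (f : Fin n × Fin n) {φ ψ} → φ ≈ᶠ ψ → ∂ f φ ≈ᶠ ∂ f ψ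
  ∂-cong f e E = -ᴹ-cong₂ (e (f ∷ E)) (e E)

  ∂-scale : ∀ (f : Fin n × Fin n) a φ → ∂ f (λ E → a *ₗ φ E) ≈ᶠ (λ E → a *ₗ ∂ f φ E)
  ∂-scale f a φ E = ≈ᴹ-sym (*ₗ-sub a (φ (f ∷ E)) (φ E))

  -- With x = e - 1, the relations e = 1 + t for a loop, e² = (t + 2) e - (t + 1)
  -- and e₁₂ e₂₃ + e₁₃ = e₁₂ + e₁₃ e₂₃ become x = t, x² = t x and
  -- x₁₂ x₂₃ = x₁₃ x₂₃.
  record TutteInvariant (φ : Edges n → Carrierᴹ) : Set where
    field
      permute   : ∀ {E E′} → E ↭ E′ → φ E ≈ᴹ φ E′
      unordered : ∀ u v E → φ ((u , v) ∷ E) ≈ᴹ φ ((v , u) ∷ E)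
      loop      : ∀ v → ∂ (v , v) φ ≈ᶠ λ E → t *ₗ φ E
      double    : ∀ f → ∂ f (∂ f φ) ≈ᶠ λ E → t *ₗ ∂ f φ E
      slide     : ∀ u v w → ∂ (u , v) (∂ (v , w) φ) ≈ᶠ ∂ (u , w) (∂ (v , w) φ)

    ∂-comm : ∀ f g → ∂ f (∂ g φ) ≈ᶠ ∂ g (∂ f φ)
    ∂-comm f g E = ≈ᴹ-trans
      (-ᴹ-swap (φ (g ∷ f ∷ E)) (φ (f ∷ E)) (φ (g ∷ E)) (φ E))
      (-ᴹ-cong₂ (-ᴹ-cong₂ (permute (swap g f ↭-refl)) ≈ᴹ-refl) ≈ᴹ-refl)

    ∂-unordered : ∀ u v → ∂ (u , v) φ ≈ᶠ ∂ (v , u) φ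
    ∂-unordered u v E = -ᴹ-cong₂ (unordered u v E) ≈ᴹ-refl

  open TutteInvariant

  module _ {φ : Edges n → Carrierᴹ} (inv : TutteInvariant φ) where
    open Relation.Binary.Reasoning.Setoid (functions n)

    ∂-permute : ∀ f {E E′} → E ↭ E′ → ∂ f φ E ≈ᴹ ∂ f φ E′
    ∂-permute f p = -ᴹ-cong₂ (permute inv (prep f p)) (permute inv p)

    ∂-comm² : ∀ f g h → ∂ f (∂ g (∂ h φ)) ≈ᶠ ∂ h (∂ f (∂ g φ))
    ∂-comm² f g h E = ≈ᴹ-trans
      (∂-cong f (∂-comm inv g h) E)
      (≈ᴹ-trans (-ᴹ-swap _ _ _ _)
        (-ᴹ-cong₂
          (-ᴹ-cong₂ (∂-permute g (swap h f ↭-refl)) ≈ᴹ-refl)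
          ≈ᴹ-refl))

    -- Differences commute and are linear, so applying `∂ g` to both sides of a relation for `φ`
    -- gives that relation for `∂ g φ`. Products of x's can therefore be treated one factor at a
    -- time.
    ∂-invariant : ∀ g → TutteInvariant (∂ g φ)
    ∂-invariant g .permute = ∂-permute g
    ∂-invariant g .unordered u v E = -ᴹ-cong₂
      (≈ᴹ-trans (permute inv (swap g (u , v) ↭-refl))
        (≈ᴹ-trans (unordered inv u v (g ∷ E)) (permute inv (swap (v , u) g ↭-refl))))
      (unordered inv u v E)
    ∂-invariant g .loop v = begin
      ∂ (v , v) (∂ g φ)       ≈⟨ ∂-comm inv (v , v) g ⟩
      ∂ g (∂ (v , v) φ)       ≈⟨ ∂-cong g (loop inv v) ⟩
      ∂ g (λ E → t *ₗ φ E)    ≈⟨ ∂-scale g t φ ⟩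
      (λ E → t *ₗ ∂ g φ E)    ∎
    ∂-invariant g .double f = begin
      ∂ f (∂ f (∂ g φ))            ≈⟨ ∂-comm² f f g ⟩
      ∂ g (∂ f (∂ f φ))            ≈⟨ ∂-cong g (double inv f) ⟩
      ∂ g (λ E → t *ₗ ∂ f φ E)     ≈⟨ ∂-scale g t (∂ f φ) ⟩
      (λ E → t *ₗ ∂ g (∂ f φ) E)   ≈⟨ (λ E → *ₗ-congˡ (∂-comm inv g f E)) ⟩
      (λ E → t *ₗ ∂ f (∂ g φ) E)   ∎
    ∂-invariant g .slide u v w = begin
      ∂ (u , v) (∂ (v , w) (∂ g φ))   ≈⟨ ∂-comm² (u , v) (v , w) g ⟩
      ∂ g (∂ (u , v) (∂ (v , w) φ))   ≈⟨ ∂-cong g (slide inv u v w) ⟩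
      ∂ g (∂ (u , w) (∂ (v , w) φ))   ≈⟨ ∂-comm² (u , w) (v , w) g ⟨
      ∂ (u , w) (∂ (v , w) (∂ g φ))   ∎

  -- The effect of `v` and `w` being connected by factors already present in `φ`: either may serve
  -- as the endpoint of a further factor.
  Linked : (Edges n → Carrierᴹ) → Fin n → Fin n → Set
  Linked φ v w = ∀ z → ∂ (v , z) φ ≈ᶠ ∂ (w , z) φ

  ∂-linked : ∀ {φ : Edges n → Carrierᴹ} → TutteInvariant φ → ∀ v w → Linked (∂ (v , w) φ) v w
  ∂-linked {n} {φ} inv v w z = begin
    ∂ (v , z) (∂ (v , w) φ)   ≈⟨ ∂-unordered inv′ v z ⟩
    ∂ (z , v) (∂ (v , w) φ)   ≈⟨ slide inv z v w ⟩
    ∂ (z , w) (∂ (v , w) φ)   ≈⟨ ∂-unordered inv′ z w ⟩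
    ∂ (w , z) (∂ (v , w) φ)   ∎
    where
    inv′ = ∂-invariant inv (v , w)
    open Relation.Binary.Reasoning.Setoid (functions n)

  linked-∂ : ∀ {φ : Edges n → Carrierᴹ} {v w} → TutteInvariant φ → ∀ f →
             Linked φ v w → Linked (∂ f φ) v w
  linked-∂ {n} {φ} {v} {w} inv f linked z = begin
    ∂ (v , z) (∂ f φ)   ≈⟨ ∂-comm inv (v , z) f ⟩
    ∂ f (∂ (v , z) φ)   ≈⟨ ∂-cong f (linked z) ⟩
    ∂ f (∂ (w , z) φ)   ≈⟨ ∂-comm inv f (w , z) ⟩
    ∂ (w , z) (∂ f φ)   ∎
    where open Relation.Binary.Reasoning.Setoid (functions n)

  -- A root contributes no factor; the difference along the loop `(v , v)` would instead multiply by
  -- `t`.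
  attach : Fin n → Fin n → (Edges n → Carrierᴹ) → (Edges n → Carrierᴹ)
  attach v w φ = if does (v Fin.≟ w) then φ else ∂ (v , w) φ

  stars : (Fin n → Fin n) → List (Fin n) → (Edges n → Carrierᴹ) → (Edges n → Carrierᴹ)
  stars r vs φ = foldr (λ v → attach v (r v)) φ vs

  attach-≡ : ∀ {v w : Fin n} φ → v ≡ w → attach v w φ ≡ φ
  attach-≡ {v = v} {w} φ eq rewrite dec-true (v Fin.≟ w) eq = ≡.refl

  attach-≢ : ∀ {v w : Fin n} φ → v ≢ w → attach v w φ ≡ ∂ (v , w) φ
  attach-≢ {v = v} {w} φ neq rewrite dec-false (v Fin.≟ w) neq = ≡.refl

  attach-cong : ∀ (v w : Fin n) {φ ψ} → φ ≈ᶠ ψ → attach v w φ ≈ᶠ attach v w ψ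
  attach-cong v w e with v Fin.≟ w
  ... | yes _ = e
  ... | no  _ = ∂-cong (v , w) e

  attach-invariant : ∀ (v w : Fin n) {φ} → TutteInvariant φ → TutteInvariant (attach v w φ)
  attach-invariant v w inv with v Fin.≟ w
  ... | yes _ = inv
  ... | no  _ = ∂-invariant inv (v , w)

  stars-invariant : ∀ (r : Fin n → Fin n) vs {φ} → TutteInvariant φ → TutteInvariant (stars r vs φ)
  stars-invariant r []       inv = inv
  stars-invariant r (v ∷ vs) inv = attach-invariant v (r v) (stars-invariant r vs inv)

  attach-comm : ∀ {φ} → TutteInvariant φ → ∀ (v w v′ w′ : Fin n) →
                attach v w (attach v′ w′ φ) ≈ᶠ attach v′ w′ (attach v w φ)
  attach-comm inv v w v′ w′ with v Fin.≟ w | v′ Fin.≟ w′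
  ... | yes _ | yes _ = λ E → ≈ᴹ-refl
  ... | yes _ | no  _ = λ E → ≈ᴹ-refl
  ... | no  _ | yes _ = λ E → ≈ᴹ-refl
  ... | no  _ | no  _ = ∂-comm inv (v , w) (v′ , w′)

  stars-↭ : ∀ (r : Fin n → Fin n) {vs vs′ φ} → TutteInvariant φ → vs ↭ vs′ →
            stars r vs φ ≈ᶠ stars r vs′ φ
  stars-↭ r inv ↭.refl         E = ≈ᴹ-refl
  stars-↭ r inv (prep v p)       = attach-cong v (r v) (stars-↭ r inv p)
  stars-↭ r inv (swap {xs = vs} v v′ p) E = ≈ᴹ-trans
    (attach-comm (stars-invariant r vs inv) v (r v) v′ (r v′) E)
    (attach-cong v′ (r v′) (attach-cong v (r v) (stars-↭ r inv p)) E)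
  stars-↭ r inv (↭.trans p p′) E = ≈ᴹ-trans (stars-↭ r inv p E) (stars-↭ r inv p′ E)

  root-linked : ∀ (r : Fin n → Fin n) {v vs φ} → TutteInvariant φ → v ∈ˡ vs →
                Linked (stars r vs φ) v (r v)
  root-linked r {v} {vs = _ ∷ vs} {φ} inv (here ≡.refl) with v Fin.≟ r v
  ... | yes v≡rv = λ z → subst (λ w → ∂ (v , z) (stars r vs φ) ≈ᶠ ∂ (w , z) (stars r vs φ)) v≡rv
                     λ E → ≈ᴹ-refl
  ... | no  _    = ∂-linked (stars-invariant r vs inv) v (r v)
  root-linked r {v} {vs = v′ ∷ vs} inv (there v∈) with v′ Fin.≟ r v′
  ... | yes _ = root-linked r inv v∈
  ... | no  _ = linked-∂ (stars-invariant r vs inv) (v′ , r v′) (root-linked r inv v∈)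

  -- Once the root a hangs from another root b, the leaves of a slide along the new edge to b.
  module _ (r : Fin n → Fin n) {a b : Fin n} (b≢a : b ≢ a) (ra≡a : r a ≡ a) (rb≡b : r b ≡ b)
           {φ : Edges n → Carrierᴹ} (inv : TutteInvariant φ) where
    private
      r′ = redirect r a b
      open Relation.Binary.Reasoning.Setoid (functions n)

      data Leaf (v : Fin n) : Set where
        root       : v ≡ r v → v ≡ r′ v → Leaf v
        unaffected : r′ v ≡ r v → v ≢ r v → Leaf v
        moved      : v ≢ r v → r v ≡ a → v ≢ r′ v → r′ v ≡ b → Leaf v

      leaf : ∀ v → a ≢ v → Leaf v
      leaf v a≢v with v Fin.≟ r v
      ... | yes v≡rv = root v≡rv (≡.trans v≡rv (≡.sym (redirect-≢ r v λ rv≡a →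
                         a≢v (≡.sym (≡.trans v≡rv rv≡a)))))
      ... | no  v≢rv with r v Fin.≟ a
      ... | no  rv≢a = unaffected (redirect-≢ r v rv≢a) v≢rv
      ... | yes rv≡a = moved v≢rv rv≡a
        (λ v≡r′v → v≢rv (≡.sym (subst (λ v → r v ≡ v)
          (≡.sym (≡.trans v≡r′v (redirect-≡ r v rv≡a))) rb≡b)))
        (redirect-≡ r v rv≡a)

      redirect-others : ∀ {vs} → All (a ≢_) vs →
        ∂ (a , b) (stars r vs φ) ≈ᶠ ∂ (a , b) (stars r′ vs φ)
      redirect-others {[]}     []              E = ≈ᴹ-refl
      redirect-others {v ∷ vs} (a≢v ∷ a∉vs) with leaf v a≢v
      ... | root v≡rv v≡r′v
        rewrite attach-≡ (stars r vs φ) v≡rv | attach-≡ (stars r′ vs φ) v≡r′v =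
        redirect-others a∉vs
      ... | unaffected eq v≢rv
        rewrite eq | attach-≢ (stars r vs φ) v≢rv | attach-≢ (stars r′ vs φ) v≢rv = begin
        ∂ (a , b) (∂ (v , r v) (stars r vs φ))
          ≈⟨ ∂-comm (stars-invariant r vs inv) (a , b) (v , r v) ⟩
        ∂ (v , r v) (∂ (a , b) (stars r vs φ))
          ≈⟨ ∂-cong (v , r v) (redirect-others a∉vs) ⟩
        ∂ (v , r v) (∂ (a , b) (stars r′ vs φ))
          ≈⟨ ∂-comm (stars-invariant r′ vs inv) (v , r v) (a , b) ⟩
        ∂ (a , b) (∂ (v , r v) (stars r′ vs φ)) ∎
      ... | moved v≢rv rv≡a v≢r′v r′v≡b
        rewrite attach-≢ (stars r vs φ) v≢rv | attach-≢ (stars r′ vs φ) v≢r′v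
              | rv≡a | r′v≡b = begin
        ∂ (a , b) (∂ (v , a) (stars r vs φ))
          ≈⟨ ∂-comm (stars-invariant r vs inv) (a , b) (v , a) ⟩
        ∂ (v , a) (∂ (a , b) (stars r vs φ))
          ≈⟨ ∂-cong (v , a) (redirect-others a∉vs) ⟩
        ∂ (v , a) (∂ (a , b) (stars r′ vs φ))
          ≈⟨ slide (stars-invariant r′ vs inv) v a b ⟩
        ∂ (v , b) (∂ (a , b) (stars r′ vs φ))
          ≈⟨ ∂-comm (stars-invariant r′ vs inv) (v , b) (a , b) ⟩
        ∂ (a , b) (∂ (v , b) (stars r′ vs φ)) ∎

    -- The extra edge is absorbed at the entry for `a`: under `r` the vertex `a` is a root and gives
    -- no factor, while under `r′` it gives exactly the difference along `(a , b)`.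
    redirect-root : ∀ {vs} → Unique vs → a ∈ˡ vs →
      ∂ (a , b) (stars r vs φ) ≈ᶠ stars r′ vs φ
    redirect-root {_ ∷ vs} (a∉vs ∷ _) (here ≡.refl)
      rewrite attach-≡ (stars r vs φ) (≡.sym ra≡a)
            | redirect-≡ r {b = b} a ra≡a
            | attach-≢ (stars r′ vs φ) (λ a≡b → b≢a (≡.sym a≡b)) =
      redirect-others a∉vs
    redirect-root {v ∷ vs} (v∉vs ∷ uniq) (there a∈vs)
      with leaf v (λ a≡v → All.lookup v∉vs a∈vs (≡.sym a≡v))
    ... | root v≡rv v≡r′v
      rewrite attach-≡ (stars r vs φ) v≡rv | attach-≡ (stars r′ vs φ) v≡r′v =
      redirect-root uniq a∈vs
    ... | unaffected eq v≢rv
      rewrite eq | attach-≢ (stars r vs φ) v≢rv | attach-≢ (stars r′ vs φ) v≢rv = begin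
      ∂ (a , b) (∂ (v , r v) (stars r vs φ))
        ≈⟨ ∂-comm (stars-invariant r vs inv) (a , b) (v , r v) ⟩
      ∂ (v , r v) (∂ (a , b) (stars r vs φ))
        ≈⟨ ∂-cong (v , r v) (redirect-root uniq a∈vs) ⟩
      ∂ (v , r v) (stars r′ vs φ) ∎
    ... | moved v≢rv rv≡a v≢r′v r′v≡b
      rewrite attach-≢ (stars r vs φ) v≢rv | attach-≢ (stars r′ vs φ) v≢r′v
            | rv≡a | r′v≡b = begin
      ∂ (a , b) (∂ (v , a) (stars r vs φ))
        ≈⟨ ∂-comm (stars-invariant r vs inv) (a , b) (v , a) ⟩
      ∂ (v , a) (∂ (a , b) (stars r vs φ))
        ≈⟨ ∂-cong (v , a) (redirect-root uniq a∈vs) ⟩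
      ∂ (v , a) (stars r′ vs φ)
        ≈⟨ ∂-unordered inv′ v a ⟩
      ∂ (a , v) (stars r′ vs φ)
        -- The edge `(a , b)` is already absorbed, so no slide along it is at hand; instead `a` is
        -- linked to its new root `b`, because `a` occurs in `vs`.
        ≈⟨ subst (Linked (stars r′ vs φ) a) (redirect-≡ r a ra≡a) (root-linked r′ inv a∈vs) v ⟩
      ∂ (b , v) (stars r′ vs φ)
        ≈⟨ ∂-unordered inv′ b v ⟩
      ∂ (v , b) (stars r′ vs φ) ∎
      where inv′ = stars-invariant r′ vs inv

  forest : Roots n → (Edges n → Carrierᴹ) → (Edges n → Carrierᴹ)
  forest {n} (r , _) = stars r (allFin n)

  ∂* : Edges n → (Edges n → Carrierᴹ) → (Edges n → Carrierᴹ)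
  ∂* F φ = foldr ∂ φ F

  module _ {φ : Edges n → Carrierᴹ} (inv : TutteInvariant φ) where
    open Relation.Binary.Reasoning.Setoid (functions n)

    -- Both endpoints are first moved to their roots. If the roots agree, the edge becomes a loop
    -- and gives a factor `t`; otherwise it merges two stars.
    ∂-forest : ∀ f ρ → ∃ λ a → ∃ λ ρ′ → ∂ f (forest ρ φ) ≈ᶠ λ E → a *ₗ forest ρ′ φ E
    ∂-forest (u , w) ρ@(r , idem) with r w Fin.≟ r u
    ... | yes rw≡ru = t , ρ , (begin
        ∂ (u , w) (forest ρ φ)       ≈⟨ to-roots ⟩
        ∂ (r u , r w) (forest ρ φ)   ≡⟨ cong (λ v → ∂ (r u , v) (forest ρ φ)) rw≡ru ⟩
        ∂ (r u , r u) (forest ρ φ)   ≈⟨ loop inv′ (r u) ⟩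
        (λ E → t *ₗ forest ρ φ E)    ∎)
      where
      inv′ = stars-invariant r (allFin n) inv
      to-roots : ∂ (u , w) (forest ρ φ) ≈ᶠ ∂ (r u , r w) (forest ρ φ)
      to-roots = begin
        ∂ (u , w) (forest ρ φ)       ≈⟨ root-linked r inv (∈-allFin u) w ⟩
        ∂ (r u , w) (forest ρ φ)     ≈⟨ ∂-unordered inv′ (r u) w ⟩
        ∂ (w , r u) (forest ρ φ)     ≈⟨ root-linked r inv (∈-allFin w) (r u) ⟩
        ∂ (r w , r u) (forest ρ φ)   ≈⟨ ∂-unordered inv′ (r w) (r u) ⟩
        ∂ (r u , r w) (forest ρ φ)   ∎
    ... | no  rw≢ru = 1# , ρ′ , (begin
        ∂ (u , w) (forest ρ φ)       ≈⟨ root-linked r inv (∈-allFin u) w ⟩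
        ∂ (r u , w) (forest ρ φ)     ≈⟨ ∂-unordered inv′ (r u) w ⟩
        ∂ (w , r u) (forest ρ φ)     ≈⟨ root-linked r inv (∈-allFin w) (r u) ⟩
        ∂ (r w , r u) (forest ρ φ)   ≈⟨ ∂-unordered inv′ (r w) (r u) ⟩
        ∂ (r u , r w) (forest ρ φ)   ≈⟨ redirect-root r rw≢ru (idem u) (idem w) inv
                                          (Unique.allFin⁺ n) (∈-allFin (r u)) ⟩
        forest ρ′ φ                  ≈⟨ (λ E → ≈ᴹ-sym (*ₗ-identityˡ (forest ρ′ φ E))) ⟩
        (λ E → 1# *ₗ forest ρ′ φ E)  ∎)
      where
      inv′ = stars-invariant r (allFin n) inv
      ρ′ = redirect r (r u) (r w) , redirect-idempotent r idem rw≢ru (idem w)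

    private
      stars-id : ∀ vs → stars id vs φ ≡ φ
      stars-id []       = ≡.refl
      stars-id (v ∷ vs) = ≡.trans (attach-≡ {v = v} _ ≡.refl) (stars-id vs)

    ∂*-forest : ∀ F → ∃ λ a → ∃ λ ρ → ∂* F φ ≈ᶠ λ E → a *ₗ forest ρ φ E
    ∂*-forest []      = 1# , (id , λ _ → ≡.refl) , λ E →
      ≈ᴹ-trans (≈ᴹ-reflexive (cong (λ ψ → ψ E) (≡.sym (stars-id (allFin n)))))
        (≈ᴹ-sym (*ₗ-identityˡ _))
    ∂*-forest (f ∷ F) with ∂*-forest F
    ... | a , ρ , e with ∂-forest f ρ
    ... | b , ρ′ , e′ = a * b , ρ′ , (begin
      ∂ f (∂* F φ)                          ≈⟨ ∂-cong f e ⟩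
      ∂ f (λ E → a *ₗ forest ρ φ E)         ≈⟨ ∂-scale f a (forest ρ φ) ⟩
      (λ E → a *ₗ ∂ f (forest ρ φ) E)       ≈⟨ (λ E → *ₗ-congˡ (e′ E)) ⟩
      (λ E → a *ₗ (b *ₗ forest ρ′ φ E))     ≈⟨ (λ E → ≈ᴹ-sym (*ₗ-assoc a b _)) ⟩
      (λ E → (a * b) *ₗ forest ρ′ φ E)      ∎)

    -- Every remaining edge `f` is split as `x_f + 1`; `F` accumulates the edges for which `x_f` was
    -- taken.
    ∂*-expansion : ∀ F E → ∃ λ L → ∂* F φ E ≈ᴹ combination (λ ρ → forest ρ φ []) L
    ∂*-expansion F [] with ∂*-forest F
    ... | a , ρ , e = (a , ρ) ∷ [] , ≈ᴹ-trans (e []) (≈ᴹ-sym (+ᴹ-identityʳ _))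
    ∂*-expansion F (f ∷ E) with ∂*-expansion (f ∷ F) E | ∂*-expansion F E
    ... | L , e | L′ , e′ = L ++ L′ , ≈ᴹ-trans
      (≈ᴹ-sym (sub-add (∂* F φ (f ∷ E)) (∂* F φ E)))
      (≈ᴹ-trans (+ᴹ-cong e e′) (≈ᴹ-sym (combination-++ _ L L′)))

    expansion : ∀ E → ∃ λ L → φ E ≈ᴹ combination (λ ρ → forest ρ φ []) L
    expansion = ∂*-expansion []

  stars-relabel : ∀ {m n} (f : Fin m → Fin n) → (∀ {i j} → f i ≡ f j → i ≡ j) →
    ∀ {r′ r} → (∀ v → f (r′ v) ≡ r (f v)) →
    ∀ {φ : Edges m → Carrierᴹ} {ψ : Edges n → Carrierᴹ} → (∀ E → φ E ≈ᴹ ψ (relabel f E)) →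
    ∀ vs E → stars r′ vs φ E ≈ᴹ stars r (map f vs) ψ (relabel f E)
  stars-relabel f inj               eq φ≈ψ []       E = φ≈ψ E
  stars-relabel f inj {r′} {r} eq φ≈ψ (v ∷ vs) E
    rewrite ≡.sym (eq v)
          | does-⇔ (mk⇔ inj (cong f)) (f v Fin.≟ f (r′ v)) (v Fin.≟ r′ v)
    with does (v Fin.≟ r′ v)
  ... | true  = stars-relabel f inj eq φ≈ψ vs E
  ... | false = -ᴹ-cong₂ (stars-relabel f inj eq φ≈ψ vs ((v , r′ v) ∷ E))
                         (stars-relabel f inj eq φ≈ψ vs E)

  module _ {φ : Edges n → Carrierᴹ}
    (permute   : ∀ {E E′} → E ↭ E′ → φ E ≈ᴹ φ E′)
    (unordered : ∀ u v E → φ ((u , v) ∷ E) ≈ᴹ φ ((v , u) ∷ E))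
    (loop      : ∀ v E → combination (λ F → φ (F ++ E))
                   ((1# , (v , v) ∷ []) ∷ (- (t + 1#) , []) ∷ []) ≈ᴹ 0ᴹ)
    (multi     : ∀ u v → u ≢ v → ∀ E → combination (λ F → φ (F ++ E))
                   ((1# , (u , v) ∷ (u , v) ∷ []) ∷ (- (t + (1# + 1#)) , (u , v) ∷ [])
                     ∷ (t + 1# , []) ∷ []) ≈ᴹ 0ᴹ)
    (os+       : ∀ u v w → u ≢ v → v ≢ w → u ≢ w → ∀ E → combination (λ F → φ (F ++ E))
                   ((1# , (u , v) ∷ (v , w) ∷ []) ∷ (1# , (u , w) ∷ []) ∷ (- 1# , (u , v) ∷ [])
                     ∷ (- 1# , (u , w) ∷ (v , w) ∷ []) ∷ []) ≈ᴹ 0ᴹ)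
    where
    private
      module ≈-Reasoning = Relation.Binary.Reasoning.Setoid ≈ᴹ-setoid
      module ≈ᶠ-Reasoning = Relation.Binary.Reasoning.Setoid (functions n)

      loop′ : ∀ v → ∂ (v , v) φ ≈ᶠ λ E → t *ₗ φ E
      loop′ v E = sub-unique (begin
        (A -ᴹ B) -ᴹ t *ₗ B                           ≈⟨ +ᴹ-assoc A (-ᴹ B) (-ᴹ (t *ₗ B)) ⟩
        A +ᴹ (-ᴹ B -ᴹ t *ₗ B)                        ≈⟨ +ᴹ-congˡ (+ᴹ-comm (-ᴹ B) (-ᴹ (t *ₗ B))) ⟩
        A +ᴹ (-ᴹ (t *ₗ B) -ᴹ B)                      ≈⟨ +ᴹ-congˡ (⁻¹-∙-comm (t *ₗ B) B) ⟩
        A -ᴹ (t *ₗ B +ᴹ B)                           ≈⟨ +ᴹ-congˡ (-ᴹ‿cong (+ᴹ-congˡ (*ₗ-identityˡ B))) ⟨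
        A -ᴹ (t *ₗ B +ᴹ 1# *ₗ B)                     ≈⟨ +ᴹ-congˡ (-ᴹ‿cong (*ₗ-distribʳ B t 1#)) ⟨
        A -ᴹ (t + 1#) *ₗ B                           ≈⟨ +ᴹ-cong (*ₗ-identityˡ A) (neg-*ₗ (t + 1#) B) ⟨
        1# *ₗ A +ᴹ (- (t + 1#)) *ₗ B                 ≈⟨ +ᴹ-congˡ (+ᴹ-identityʳ _) ⟨
        1# *ₗ A +ᴹ ((- (t + 1#)) *ₗ B +ᴹ 0ᴹ)         ≈⟨ loop v E ⟩
        0ᴹ                                           ∎)
        where
        open ≈-Reasoning
        A = φ ((v , v) ∷ E)
        B = φ E

      -- Proved ahead of the general invariance because the degenerate cases of `double` and
      -- `slide`, on which invariance rests, use it.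
      ∂-loop : ∀ v g → ∂ (v , v) (∂ g φ) ≈ᶠ λ E → t *ₗ ∂ g φ E
      ∂-loop v g = begin
        ∂ (v , v) (∂ g φ)       ≈⟨ (λ E → ≈ᴹ-trans (-ᴹ-swap _ _ _ _)
                                      (-ᴹ-cong₂ (-ᴹ-cong₂ (permute (swap g (v , v) ↭-refl)) ≈ᴹ-refl) ≈ᴹ-refl)) ⟩
        ∂ g (∂ (v , v) φ)       ≈⟨ ∂-cong g (loop′ v) ⟩
        ∂ g (λ E → t *ₗ φ E)    ≈⟨ ∂-scale g t φ ⟩
        (λ E → t *ₗ ∂ g φ E)    ∎
        where open ≈ᶠ-Reasoning

      ∂-flip : ∀ u v → ∂ (u , v) φ ≈ᶠ ∂ (v , u) φ
      ∂-flip u v E = -ᴹ-cong₂ (unordered u v E) ≈ᴹ-refl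

      double′ : ∀ f → ∂ f (∂ f φ) ≈ᶠ λ E → t *ₗ ∂ f φ E
      double′ (u , v) with u Fin.≟ v
      ... | yes ≡.refl = ∂-loop u (u , u)
      ... | no  u≢v    = λ E → let
          A = φ ((u , v) ∷ (u , v) ∷ E)
          B = φ ((u , v) ∷ E)
          C = φ E
          X = t *ₗ B
          Y = t *ₗ C
        in sub-unique (begin
        ((A -ᴹ B) -ᴹ (B -ᴹ C)) -ᴹ t *ₗ (B -ᴹ C)
          ≈⟨ -ᴹ-cong₂ (+ᴹ-congˡ (neg-sub B C)) (*ₗ-sub t B C) ⟩
        ((A -ᴹ B) +ᴹ (C -ᴹ B)) -ᴹ (X -ᴹ Y)
          ≈⟨ +ᴹ-cong (-ᴹ-interchange A B C B) (neg-sub X Y) ⟩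
        ((A +ᴹ C) -ᴹ (B +ᴹ B)) +ᴹ (Y -ᴹ X)
          ≈⟨ -ᴹ-interchange (A +ᴹ C) (B +ᴹ B) Y X ⟩
        ((A +ᴹ C) +ᴹ Y) -ᴹ ((B +ᴹ B) +ᴹ X)
          ≈⟨ -ᴹ-cong₂ (≈ᴹ-trans (+ᴹ-assoc A C Y) (+ᴹ-congˡ (+ᴹ-comm C Y))) (+ᴹ-comm (B +ᴹ B) X) ⟩
        (A +ᴹ (Y +ᴹ C)) -ᴹ (X +ᴹ (B +ᴹ B))
          ≈⟨ ≈ᴹ-trans (+ᴹ-assoc A (Y +ᴹ C) _) (+ᴹ-congˡ (+ᴹ-comm (Y +ᴹ C) _)) ⟩
        A +ᴹ (-ᴹ (X +ᴹ (B +ᴹ B)) +ᴹ (Y +ᴹ C))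
          ≈⟨ +ᴹ-cong (*ₗ-identityˡ A) (+ᴹ-cong
               (≈ᴹ-trans (neg-*ₗ _ B) (-ᴹ‿cong (≈ᴹ-trans (*ₗ-distribʳ B t (1# + 1#))
                 (+ᴹ-congˡ (≈ᴹ-trans (*ₗ-distribʳ B 1# 1#) (+ᴹ-cong (*ₗ-identityˡ B) (*ₗ-identityˡ B)))))))
               (≈ᴹ-trans (+ᴹ-identityʳ _) (≈ᴹ-trans (*ₗ-distribʳ C t 1#) (+ᴹ-congˡ (*ₗ-identityˡ C))))) ⟨
        1# *ₗ A +ᴹ ((- (t + (1# + 1#))) *ₗ B +ᴹ ((t + 1#) *ₗ C +ᴹ 0ᴹ))
          ≈⟨ multi u v u≢v E ⟩
        0ᴹ ∎)
        where open ≈-Reasoning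

      -- The relator covers three distinct vertices. If `u` is `v` or `w`, one of the two products
      -- contains a loop and the other a double edge, and each contributes the same factor `t`; if
      -- `v` is `w`, the two sides coincide.
      slide′ : ∀ u v w → ∂ (u , v) (∂ (v , w) φ) ≈ᶠ ∂ (u , w) (∂ (v , w) φ)
      slide′ u v w with u Fin.≟ v | v Fin.≟ w | u Fin.≟ w
      ... | yes ≡.refl | _          | _          = begin
        ∂ (u , u) (∂ (u , w) φ)     ≈⟨ ∂-loop u (u , w) ⟩
        (λ E → t *ₗ ∂ (u , w) φ E)  ≈⟨ double′ (u , w) ⟨
        ∂ (u , w) (∂ (u , w) φ)     ∎
        where open ≈ᶠ-Reasoning
      ... | no _       | yes ≡.refl | _          = λ E → ≈ᴹ-refl
      ... | no _       | no _       | yes ≡.refl = begin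
        ∂ (u , v) (∂ (v , u) φ)     ≈⟨ ∂-cong (u , v) (∂-flip v u) ⟩
        ∂ (u , v) (∂ (u , v) φ)     ≈⟨ double′ (u , v) ⟩
        (λ E → t *ₗ ∂ (u , v) φ E)  ≈⟨ (λ E → *ₗ-congˡ (∂-flip u v E)) ⟩
        (λ E → t *ₗ ∂ (v , u) φ E)  ≈⟨ ∂-loop u (v , u) ⟨
        ∂ (u , u) (∂ (v , u) φ)     ∎
        where open ≈ᶠ-Reasoning
      -- Both sides subtract the same `∂ (v , w) φ E`, so it remains to rearrange the relator into A
      -- - C = D - B.
      ... | no u≢v     | no v≢w     | no u≢w     = λ E → let
          A = φ ((u , v) ∷ (v , w) ∷ E)
          B = φ ((u , w) ∷ E)
          C = φ ((u , v) ∷ E)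
          D = φ ((u , w) ∷ (v , w) ∷ E)
        in -ᴹ-cong₂ (begin
        φ ((v , w) ∷ (u , v) ∷ E) -ᴹ C
          ≈⟨ -ᴹ-cong₂ (permute (swap (v , w) (u , v) ↭-refl)) ≈ᴹ-refl ⟩
        A -ᴹ C
          ≈⟨ sub-unique (begin
               (A -ᴹ C) -ᴹ (D -ᴹ B)      ≈⟨ +ᴹ-congˡ (neg-sub D B) ⟩
               (A -ᴹ C) +ᴹ (B -ᴹ D)      ≈⟨ -ᴹ-interchange A C B D ⟩
               (A +ᴹ B) -ᴹ (C +ᴹ D)      ≈⟨ +ᴹ-assoc A B _ ⟩
               A +ᴹ (B -ᴹ (C +ᴹ D))      ≈⟨ +ᴹ-congˡ (+ᴹ-congˡ (⁻¹-∙-comm C D)) ⟨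
               A +ᴹ (B +ᴹ (-ᴹ C -ᴹ D))
                 ≈⟨ +ᴹ-cong (*ₗ-identityˡ A) (+ᴹ-cong (*ₗ-identityˡ B)
                      (+ᴹ-cong (-1*ₗ C) (≈ᴹ-trans (+ᴹ-identityʳ _) (-1*ₗ D)))) ⟨
               1# *ₗ A +ᴹ (1# *ₗ B +ᴹ ((- 1#) *ₗ C +ᴹ ((- 1#) *ₗ D +ᴹ 0ᴹ)))
                 ≈⟨ os+ u v w u≢v v≢w u≢w E ⟩
               0ᴹ ∎) ⟩
        D -ᴹ B
          ≈⟨ -ᴹ-cong₂ (permute (swap (u , w) (v , w) ↭-refl)) ≈ᴹ-refl ⟩
        φ ((v , w) ∷ (u , w) ∷ E) -ᴹ B ∎) ≈ᴹ-refl
        where open ≈-Reasoning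

    tutteInvariant : TutteInvariant φ
    tutteInvariant = record
      { permute   = permute
      ; unordered = unordered
      ; loop      = loop′
      ; double    = double′
      ; slide     = slide′
      }

-- The module of graphs

module GraphModule (K : CommutativeRing 0ℓ 0ℓ) where
  open PolynomialRing K
  open TutteSymmetricFunction K using
    (FormalSum; FormalSumOn; coefficientOf; 𝔾[t]; t; Ext; T; T-iso; T-loop; T-multi; T-os+;
     ℓ-loop; ℓ-multi; ℓ-os+; I; S₁; S₂)
  module P = CommutativeRing P
  private
    module Raw = RawLeftModule 𝔾[t]

  if-cong : ∀ b {c d} → c ≈ᴾ d → (if b then c else 0ₚ) ≈ᴾ (if b then d else 0ₚ)
  if-cong true  e = e
  if-cong false e = P.refl

  coefficientOf-++ : ∀ G L M → coefficientOf G (L ++ M) ≈ᴾ coefficientOf G L ⊕ coefficientOf G M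
  coefficientOf-++ G []            M = P.refl
  coefficientOf-++ G ((c , H) ∷ L) M = P.trans (P.+-congˡ (coefficientOf-++ G L M))
    (P.sym (P.+-assoc (if does (G ≋? H) then c else 0ₚ) (coefficientOf G L) (coefficientOf G M)))

  coefficientOf-* : ∀ G a L → coefficientOf G (a Raw.*ₗ L) ≈ᴾ a ⊗ coefficientOf G L
  coefficientOf-* G a []            = P.sym (P.zeroʳ a)
  coefficientOf-* G a ((c , H) ∷ L) = P.trans
    (P.+-cong (factor (does (G ≋? H))) (coefficientOf-* G a L))
    (P.sym (P.distribˡ a (if does (G ≋? H) then c else 0ₚ) (coefficientOf G L)))
    where
    factor : ∀ b → (if b then a ⊗ c else 0ₚ) ≈ᴾ a ⊗ (if b then c else 0ₚ)
    factor true  = P.refl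
    factor false = P.sym (P.zeroʳ a)

  coefficientOf-neg : ∀ G L → coefficientOf G (Raw.-ᴹ L) ≈ᴾ ⊖ coefficientOf G L
  coefficientOf-neg G []            = P.refl
  coefficientOf-neg G ((c , H) ∷ L) = P.trans
    (P.+-cong (factor (does (G ≋? H))) (coefficientOf-neg G L))
    (Algebra.Properties.AbelianGroup.⁻¹-∙-comm P.+-abelianGroup
      (if does (G ≋? H) then c else 0ₚ) (coefficientOf G L))
    where
    factor : ∀ b → (if b then ⊖ c else 0ₚ) ≈ᴾ ⊖ (if b then c else 0ₚ)
    factor true  = P.refl
    factor false = P.refl

  private
    graphwise : ∀ {L M} → (∀ G → coefficientOf G L ≈ᴾ coefficientOf G M) → L Raw.≈ᴹ M
    graphwise e G = at (e G)

    coef : ∀ {L M} → L Raw.≈ᴹ M → ∀ G → coefficientOf G L ≈ᴾ coefficientOf G M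
    coef e G = coefficientwise (e G)

    sum-coef : ∀ G {L M x y} → coefficientOf G L ≈ᴾ x → coefficientOf G M ≈ᴾ y →
               coefficientOf G (L ++ M) ≈ᴾ x ⊕ y
    sum-coef G {L} {M} e f = P.trans (coefficientOf-++ G L M) (P.+-cong e f)

    scale-coef : ∀ G a {L x} → coefficientOf G L ≈ᴾ x → coefficientOf G (a Raw.*ₗ L) ≈ᴾ a ⊗ x
    scale-coef G a {L} e = P.trans (coefficientOf-* G a L) (P.*-congˡ {a} e)

    neg-coef : ∀ G {L x} → coefficientOf G L ≈ᴾ x → coefficientOf G (Raw.-ᴹ L) ≈ᴾ ⊖ x
    neg-coef G {L} e = P.trans (coefficientOf-neg G L) (P.-‿cong e)

    -- Reduces a module law for formal sums to the same law for the coefficients `x G` and `y G` at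
    -- each graph.
    by : ∀ {L M} (x y : Graph → Poly) → (∀ G → coefficientOf G L ≈ᴾ x G) →
         (∀ G → coefficientOf G M ≈ᴾ y G) → (∀ G → x G ≈ᴾ y G) → L Raw.≈ᴹ M
    by x y e f x≈y G = at (P.trans (e G) (P.trans (x≈y G) (P.sym (f G))))

  𝔾 : LeftModule P.ring 0ℓ 0ℓ
  𝔾 = record
    { Carrierᴹ = Raw.Carrierᴹ
    ; _≈ᴹ_ = Raw._≈ᴹ_
    ; _+ᴹ_ = Raw._+ᴹ_
    ; _*ₗ_ = Raw._*ₗ_
    ; 0ᴹ = Raw.0ᴹ
    ; -ᴹ_ = Raw.-ᴹ_
    ; isLeftModule = record
      { isLeftSemimodule = record
        { +ᴹ-isCommutativeMonoid = record
          { isMonoid = record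
            { isSemigroup = record
              { isMagma = record
                { isEquivalence = record
                  { refl  = λ {L} → graphwise {L} {L} λ G → P.refl
                  ; sym   = λ {L} {M} e → graphwise {M} {L} λ G → P.sym (coef {L} {M} e G)
                  ; trans = λ {L} {M} {N} e f →
                      graphwise {L} {N} λ G → P.trans (coef {L} {M} e G) (coef {M} {N} f G)
                  }
                ; ∙-cong = λ {L} {L′} {M} {M′} e f → graphwise {L ++ M} {L′ ++ M′} λ G → P.trans
                    (sum-coef G {L} {M} (coef {L} {L′} e G) (coef {M} {M′} f G))
                    (P.sym (coefficientOf-++ G L′ M′))
                }
              ; assoc = λ L M N → by {(L ++ M) ++ N} {L ++ (M ++ N)} _ _
                  (λ G → sum-coef G {L ++ M} {N} (coefficientOf-++ G L M) P.refl)
                  (λ G → sum-coef G {L} {M ++ N} P.refl (coefficientOf-++ G M N))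
                  (λ G → P.+-assoc (coefficientOf G L) (coefficientOf G M) (coefficientOf G N))
              }
            ; identity = (λ L → graphwise {L} {L} λ G → P.refl)
                       , (λ L → by {L ++ []} {L} _ _
                           (λ G → coefficientOf-++ G L []) (λ G → P.refl) (λ G → P.+-identityʳ (coefficientOf G L)))
            }
          ; comm = λ L M → by {L ++ M} {M ++ L} _ _
              (λ G → coefficientOf-++ G L M) (λ G → coefficientOf-++ G M L) (λ G → P.+-comm (coefficientOf G L) (coefficientOf G M))
          }
        ; isPreleftSemimodule = record
          { *ₗ-cong = λ {a} {b} {L} {M} e f → by {a Raw.*ₗ L} {b Raw.*ₗ M} _ _
              (λ G → scale-coef G a {L} (coef {L} {M} f G)) (λ G → coefficientOf-* G b M)
              (λ G → P.*-congʳ {coefficientOf G M} e)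
          ; *ₗ-zeroˡ = λ L → by {0ₚ Raw.*ₗ L} {[]} _ _
              (λ G → coefficientOf-* G 0ₚ L) (λ G → P.refl) (λ G → P.zeroˡ (coefficientOf G L))
          ; *ₗ-distribʳ = λ L a b → by {(a ⊕ b) Raw.*ₗ L} {a Raw.*ₗ L ++ b Raw.*ₗ L} _ _
              (λ G → coefficientOf-* G (a ⊕ b) L)
              (λ G → sum-coef G {a Raw.*ₗ L} {b Raw.*ₗ L}
                       (coefficientOf-* G a L) (coefficientOf-* G b L))
              (λ G → P.distribʳ (coefficientOf G L) a b)
          ; *ₗ-identityˡ = λ L → by {1ₚ Raw.*ₗ L} {L} _ _
              (λ G → coefficientOf-* G 1ₚ L) (λ G → P.refl) (λ G → P.*-identityˡ (coefficientOf G L))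
          ; *ₗ-assoc = λ a b L → by {(a ⊗ b) Raw.*ₗ L} {a Raw.*ₗ (b Raw.*ₗ L)} _ _
              (λ G → coefficientOf-* G (a ⊗ b) L)
              (λ G → scale-coef G a {b Raw.*ₗ L} (coefficientOf-* G b L))
              (λ G → P.*-assoc a b (coefficientOf G L))
          ; *ₗ-zeroʳ = λ a → graphwise {[]} {[]} λ G → P.refl
          ; *ₗ-distribˡ = λ a L M → by {a Raw.*ₗ (L ++ M)} {a Raw.*ₗ L ++ a Raw.*ₗ M} _ _
              (λ G → scale-coef G a {L ++ M} (coefficientOf-++ G L M))
              (λ G → sum-coef G {a Raw.*ₗ L} {a Raw.*ₗ M}
                       (coefficientOf-* G a L) (coefficientOf-* G a M))
              (λ G → P.distribˡ a (coefficientOf G L) (coefficientOf G M))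
          }
        }
      ; -ᴹ‿cong = λ {L} {M} e → by {Raw.-ᴹ L} {Raw.-ᴹ M} _ _
          (λ G → neg-coef G {L} (coef {L} {M} e G)) (λ G → coefficientOf-neg G M) (λ G → P.refl)
      ; -ᴹ‿inverse =
          (λ L → by {Raw.-ᴹ L ++ L} {[]} _ _
            (λ G → sum-coef G {Raw.-ᴹ L} {L} (coefficientOf-neg G L) P.refl)
            (λ G → P.refl) (λ G → P.-‿inverseˡ (coefficientOf G L)))
        , (λ L → by {L ++ Raw.-ᴹ L} {[]} _ _
            (λ G → sum-coef G {L} {Raw.-ᴹ L} P.refl (coefficientOf-neg G L))
            (λ G → P.refl) (λ G → P.-‿inverseʳ (coefficientOf G L)))
      }
    }

  module 𝔾 = LeftModule 𝔾

  graph : Graph → FormalSum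
  graph G = (1ₚ , G) ∷ []

  ≈-combination : ∀ L → L 𝔾.≈ᴹ Subtraction.combination 𝔾 graph L
  ≈-combination [] G k = CommutativeRing.refl K
  ≈-combination ((c , H) ∷ L) = graphwise {(c , H) ∷ L} {(c ⊗ 1ₚ , H) ∷ M} λ G → P.+-cong
    (if-cong (does (G ≋? H)) (P.sym (P.*-identityʳ c))) (coef {L} {M} (≈-combination L) G)
    where M = Subtraction.combination 𝔾 graph L

  -- `I`, `S₁` and `S₂` are spans already, so a generator enters through the span it generates and
  -- only then through the outer one.
  relators : Pred FormalSum 0ℓ
  relators = I ∪ S₁ ∪ S₂

  open Quotient 𝔾 relators public using (_~_; ≈⇒~; span⇒~0; ~0⇒span; difference; ⟨S⟩)

  Q : LeftModule P.ring 0ℓ 0ℓ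
  Q = Quotient.M/S 𝔾 relators
  module Q = LeftModule Q

  private
    from-relator : (S : Pred FormalSum 0ℓ) → (∀ L → S L → relators L) → ∀ L → S L → L ~ []
    from-relator S S⊆ L s = span⇒~0 {L} (Quotient.S⊆span 𝔾 relators {L} (S⊆ L s))

  iso~0 : ∀ L → T-iso L → L ~ []
  iso~0 = from-relator T-iso λ L s → inj₁ (Quotient.S⊆span 𝔾 T-iso {L} s)

  loop~0 : ∀ L → T-loop L → L ~ []
  loop~0 = from-relator T-loop λ L s → inj₂ (inj₁ (Quotient.S⊆span 𝔾 (T-loop ∪ T-multi) {L} (inj₁ s)))

  multi~0 : ∀ L → T-multi L → L ~ []
  multi~0 = from-relator T-multi λ L s → inj₂ (inj₁ (Quotient.S⊆span 𝔾 (T-loop ∪ T-multi) {L} (inj₂ s)))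

  os+~0 : ∀ L → T-os+ L → L ~ []
  os+~0 = from-relator T-os+ λ L s → inj₂ (inj₂ (Quotient.S⊆span 𝔾 T-os+ {L} s))

  graph-≅ : ∀ {G H} → G ≅ H → graph G ~ graph H
  graph-≅ {G} {H} G≅H = Subtraction.sub-unique Q {graph G} {graph H}
    (iso~0 L (G , H , G≅H , 𝔾.≈ᴹ-refl {L}))
    where L = graph G ++ Raw.-ᴹ graph H

  -- The copies of the graphs of ℓ that T uses lie on the first vertices; by T-iso any
  -- other distinct vertices do as well.
  Ext-anywhere : ∀ {k n} (ℓ : FormalSumOn k) → (∀ L → T ℓ L → L ~ []) →
    (f : Fin k → Fin n) → (∀ {i j} → f i ≡ f j → i ≡ j) → ∀ E →
    Subtraction.combination Q (λ F → graph (n , relabel f F ++ E)) ℓ ~ []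
  Ext-anywhere {k} {n} ℓ T~0 f inj E = begin
    combination (λ F → graph (n , relabel f F ++ E)) ℓ
      ≈⟨ combination-cong ℓ moved ⟨
    combination (λ F → graph (n , E₀ ++ relabel include F)) ℓ
      ≡⟨ combination-map graph (λ F → n , E₀ ++ relabel include F) ℓ ⟨
    combination graph (Ext k≤n ℓ E₀)
      ≈⟨ ≈⇒~ (≈-combination (Ext k≤n ℓ E₀)) ⟨
    Ext k≤n ℓ E₀
      ≈⟨ T~0 (Ext k≤n ℓ E₀) (n , k≤n , E₀ , 𝔾.≈ᴹ-refl {Ext k≤n ℓ E₀}) ⟩
    [] ∎
    where
    open Subtraction Q
    open Relation.Binary.Reasoning.Setoid Q.≈ᴹ-setoid
    k≤n : k ≤ n
    k≤n = Fin.injective⇒≤ inj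
    include : Fin k → Fin n
    include i = inject≤ i k≤n
    π = proj₁ (extend f inj k≤n)
    E₀ = relabel (π ⟨$⟩ˡ_) E

    relabelled : ∀ F → relabel (π ⟨$⟩ʳ_) (E₀ ++ relabel include F) ≡ E ++ relabel f F
    relabelled F = ≡.trans (map-++ _ E₀ (relabel include F)) (cong₂ _++_
      (relabel-inverse π E)
      (≡.trans (≡.sym (map-∘ F)) (map-cong (λ (u , v) → cong₂ _,_
        (proj₂ (extend f inj k≤n) u) (proj₂ (extend f inj k≤n) v)) F)))

    moved : ∀ F → graph (n , E₀ ++ relabel include F) ~ graph (n , relabel f F ++ E)
    moved F = begin
      graph (n , E₀ ++ relabel include F)
        ≈⟨ graph-≅ (relabel-≅ π (E₀ ++ relabel include F)) ⟩
      graph (n , relabel (π ⟨$⟩ʳ_) (E₀ ++ relabel include F))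
        ≡⟨ cong (λ F → graph (n , F)) (relabelled F) ⟩
      graph (n , E ++ relabel f F)
        ≈⟨ graph-≅ (↭⇒≅ (++-comm E (relabel f F))) ⟩
      graph (n , relabel f F ++ E) ∎

  open EdgeDifferences P t Q

  graph-invariant : ∀ {n} → TutteInvariant {n} (λ E → graph (n , E))
  graph-invariant {n} = tutteInvariant
    (λ p → graph-≅ (↭⇒≅ p))
    (λ u v E → graph-≅ (flip-≅ u v E))
    (λ v → Ext-anywhere ℓ-loop loop~0 (λ _ → v) λ { {0F} {0F} _ → ≡.refl })
    (λ u v u≢v → Ext-anywhere ℓ-multi multi~0 (lookup (u ∷ v ∷ [])) λ
      { {0F} {0F} _ → ≡.refl ; {1F} {1F} _ → ≡.refl
      ; {0F} {1F} e → contradiction e u≢v ; {1F} {0F} e → contradiction (≡.sym e) u≢v })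
    (λ u v w u≢v v≢w u≢w → Ext-anywhere ℓ-os+ os+~0 (lookup (u ∷ v ∷ w ∷ [])) λ
      { {0F} {0F} _ → ≡.refl ; {1F} {1F} _ → ≡.refl ; {2F} {2F} _ → ≡.refl
      ; {0F} {1F} e → contradiction e u≢v ; {1F} {0F} e → contradiction (≡.sym e) u≢v
      ; {1F} {2F} e → contradiction e v≢w ; {2F} {1F} e → contradiction (≡.sym e) v≢w
      ; {0F} {2F} e → contradiction e u≢w ; {2F} {0F} e → contradiction (≡.sym e) u≢w })

  -- The product `x_F` over all edges of the forest. Evaluated at the empty edge list, it is the
  -- alternating sum of the spanning subgraphs of `F`.
  starForest : ∃ Roots → FormalSum
  starForest (n , ρ) = forest ρ (λ E → graph (n , E)) []

  starForest-conjugate : ∀ {m n} {r′ : Fin m → Fin m} {r : Fin n → Fin n} {idem′ idem} →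
    (∃ λ (π : Perm.Permutation m n) → ∀ v → π ⟨$⟩ʳ (r′ v) ≡ r (π ⟨$⟩ʳ v)) →
    starForest (m , r′ , idem′) ~ starForest (n , r , idem)
  starForest-conjugate {m} {n} {r′} {r} (π , commutes) = begin
    stars r′ (allFin m) (λ E → graph (m , E)) []
      ≈⟨ stars-relabel (π ⟨$⟩ʳ_) (π-injective π) commutes
           {φ = λ E → graph (m , E)} {ψ = λ E → graph (n , E)}
           (λ E → graph-≅ (relabel-≅ π E)) (allFin m) [] ⟩
    stars r (map (π ⟨$⟩ʳ_) (allFin m)) (λ E → graph (n , E)) []
      ≈⟨ stars-↭ r graph-invariant (map-allFin-↭ π) [] ⟩
    stars r (allFin n) (λ E → graph (n , E)) [] ∎
    where open Relation.Binary.Reasoning.Setoid Q.≈ᴹ-setoid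

  starForest-expansion : ∀ L → ∃ λ M → L ~ Subtraction.combination Q starForest M
  starForest-expansion L = M ,
    Q.≈ᴹ-trans {L} {Subtraction.combination Q graph L} {Subtraction.combination Q starForest M}
      (≈⇒~ {L} {Subtraction.combination Q graph L} (≈-combination L)) (proj₂ found)
    where
    expand : ∀ G → ∃ λ F → graph G ~ Subtraction.combination Q starForest F
    expand (n , E) = map (map₂ (n ,_)) (proj₁ (expansion (graph-invariant {n}) E)) ,
      subst (graph (n , E) ~_)
        (≡.sym (Subtraction.combination-map Q starForest (n ,_) (proj₁ (expansion (graph-invariant {n}) E))))
        (proj₂ (expansion (graph-invariant {n}) E))
    found = Subtraction.combination-expand Q graph starForest expand L
    M = proj₁ found

-- Sums over colourings

module ListSums (R : CommutativeRing 0ℓ 0ℓ) where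
  open CommutativeRing R
  open Algebra.Properties.CommutativeSemigroup +-commutativeSemigroup using (interchange; x∙yz≈y∙xz)
  open Algebra.Definitions.RawMonoid +-rawMonoid using () renaming (_×_ to _×ᴿ_)
  private module R = Subtraction {ring} TensorUnit.leftModule

  ∑ : ∀ {A : Set} → List A → (A → Carrier) → Carrier
  ∑ xs f = foldr (λ x s → f x + s) 0# xs

  module _ {A : Set} where
    ∑-cong : ∀ xs {f g : A → Carrier} → (∀ x → f x ≈ g x) → ∑ xs f ≈ ∑ xs g
    ∑-cong []       f≈g = refl
    ∑-cong (x ∷ xs) f≈g = +-cong (f≈g x) (∑-cong xs f≈g)

    ∑-zero : ∀ xs {f : A → Carrier} → (∀ x → f x ≈ 0#) → ∑ xs f ≈ 0#
    ∑-zero []       f≈0 = refl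
    ∑-zero (x ∷ xs) f≈0 = trans (+-cong (f≈0 x) (∑-zero xs f≈0)) (+-identityˡ 0#)

    ∑-↭ : ∀ {xs ys} (f : A → Carrier) → xs ↭ ys → ∑ xs f ≈ ∑ ys f
    ∑-↭ f ↭.refl        = refl
    ∑-↭ f (prep x p)    = +-congˡ (∑-↭ f p)
    ∑-↭ f (swap x y p)  = trans (x∙yz≈y∙xz (f x) (f y) _) (+-congˡ (+-congˡ (∑-↭ f p)))
    ∑-↭ f (↭.trans p q) = trans (∑-↭ f p) (∑-↭ f q)

    ∑-map : ∀ {B : Set} (g : B → A) xs (f : A → Carrier) → ∑ (map g xs) f ≈ ∑ xs λ x → f (g x)
    ∑-map g []       f = refl
    ∑-map g (x ∷ xs) f = +-congˡ (∑-map g xs f)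

    ∑-++ : ∀ xs ys (f : A → Carrier) → ∑ (xs ++ ys) f ≈ ∑ xs f + ∑ ys f
    ∑-++ []       ys f = sym (+-identityˡ _)
    ∑-++ (x ∷ xs) ys f = trans (+-congˡ (∑-++ xs ys f)) (sym (+-assoc _ _ _))

    ∑-+ : ∀ xs (f g : A → Carrier) → ∑ xs f + ∑ xs g ≈ ∑ xs λ x → f x + g x
    ∑-+ []       f g = +-identityˡ 0#
    ∑-+ (x ∷ xs) f g = trans (interchange _ _ _ _) (+-congˡ (∑-+ xs f g))

    ∑-sub : ∀ xs (f g : A → Carrier) → ∑ xs f - ∑ xs g ≈ ∑ xs λ x → f x - g x
    ∑-sub []       f g = -‿inverseʳ 0#
    ∑-sub (x ∷ xs) f g = trans (sym (R.-ᴹ-interchange (f x) (g x) _ _)) (+-congˡ (∑-sub xs f g))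

    ∑-* : ∀ a xs (f : A → Carrier) → a * ∑ xs f ≈ ∑ xs λ x → a * f x
    ∑-* a []       f = zeroʳ a
    ∑-* a (x ∷ xs) f = trans (distribˡ a _ _) (+-congˡ (∑-* a xs f))

    ∑-combination : ∀ {B : Set} xs (f : B → A → Carrier) L →
      R.combination (λ b → ∑ xs (f b)) L ≈ ∑ xs λ x → R.combination (λ b → f b x) L
    ∑-combination xs f []            = sym (∑-zero xs λ x → refl)
    ∑-combination xs f ((c , b) ∷ L) = trans
      (+-cong (∑-* c xs (f b)) (∑-combination xs f L))
      (∑-+ xs (λ x → c * f b x) (λ x → R.combination (λ b → f b x) L))

    ∑-indicator : ∀ {Z : A → Set} (Z? : ∀ x → Dec (Z x)) xs {f : A → Carrier} c →
      (∀ x → Z x → f x ≈ c) → (∀ x → ¬ Z x → f x ≈ 0#) →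
      ∑ xs f ≈ length (filter Z? xs) ×ᴿ c
    ∑-indicator Z? []       c f≈c f≈0 = refl
    ∑-indicator Z? (x ∷ xs) c f≈c f≈0 with Z? x
    ... | yes z = +-cong (f≈c x z) (∑-indicator Z? xs c f≈c f≈0)
    ... | no ¬z = trans (+-cong (f≈0 x ¬z) (∑-indicator Z? xs c f≈c f≈0)) (+-identityˡ _)

module FormalSums (R : CommutativeRing 0ℓ 0ℓ) {A : Set} {_≋_ : A → A → Set}
  (≋-isEquivalence : IsEquivalence _≋_) (_≋?_ : Decidable _≋_) where
  open CommutativeRing R
  open Subtraction {ring} TensorUnit.leftModule using (combination)
  open Algebra.Properties.CommutativeSemigroup +-commutativeSemigroup using (x∙yz≈y∙xz)
  private module ≋ = IsEquivalence ≋-isEquivalence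

  coefficientAt : A → List (Carrier × A) → Carrier
  coefficientAt a []            = 0#
  coefficientAt a ((c , b) ∷ L) = (if does (a ≋? b) then c else 0#) + coefficientAt a L

  private
    remove : A → List (Carrier × A) → List (Carrier × A)
    remove a []            = []
    remove a ((c , b) ∷ L) = if does (a ≋? b) then remove a L else (c , b) ∷ remove a L

    length-remove : ∀ a L → length (remove a L) ≤ length L
    length-remove a []            = z≤n
    length-remove a ((c , b) ∷ L) with does (a ≋? b)
    ... | true  = ℕ.m≤n⇒m≤1+n (length-remove a L)
    ... | false = s≤s (length-remove a L)

    coefficientAt-removed : ∀ {a b} → a ≋ b → ∀ L → coefficientAt b (remove a L) ≈ 0#
    coefficientAt-removed a≋b [] = refl
    coefficientAt-removed {a} {b} a≋b ((c , x) ∷ L) with a ≋? x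
    ... | yes _   = coefficientAt-removed a≋b L
    ... | no  a≭x rewrite dec-false (b ≋? x) (λ b≋x → a≭x (≋.trans a≋b b≋x)) =
      trans (+-identityˡ _) (coefficientAt-removed a≋b L)

    coefficientAt-kept : ∀ {a b} → ¬ a ≋ b → ∀ L → coefficientAt b (remove a L) ≈ coefficientAt b L
    coefficientAt-kept a≭b [] = refl
    coefficientAt-kept {a} {b} a≭b ((c , x) ∷ L) with a ≋? x
    ... | no  _   = +-congˡ (coefficientAt-kept a≭b L)
    ... | yes a≋x rewrite dec-false (b ≋? x) (λ b≋x → a≭b (≋.trans a≋x (≋.sym b≋x))) =
      trans (coefficientAt-kept a≭b L) (sym (+-identityˡ _))

    module _ {φ : A → Carrier} (φ-resp : ∀ {a b} → a ≋ b → φ a ≈ φ b) where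
      combination-remove : ∀ a L →
        combination φ L ≈ coefficientAt a L * φ a + combination φ (remove a L)
      combination-remove a [] = sym (trans (+-identityʳ _) (zeroˡ (φ a)))
      combination-remove a ((c , x) ∷ L) with a ≋? x
      ... | yes a≋x = trans (+-cong (*-congˡ (sym (φ-resp a≋x))) (combination-remove a L))
        (trans (sym (+-assoc _ _ _)) (+-congʳ (sym (distribʳ (φ a) c _))))
      ... | no  _   = trans (+-congˡ (combination-remove a L))
        (trans (x∙yz≈y∙xz _ _ _) (+-congʳ (*-congʳ (sym (+-identityˡ _)))))

      -- Split off the class of the first term: its total coefficient is zero, and the rest is
      -- shorter with all total coefficients still zero. Only `≋` is decided, never equality of
      -- coefficients.
      vanishes : ∀ m L → length L ≤ m → (∀ a → coefficientAt a L ≈ 0#) → combination φ L ≈ 0#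
      vanishes m       []                _         null = refl
      vanishes (suc m) L@((c , a) ∷ L′) (s≤s len) null =
        trans (combination-remove a L)
          (trans (+-cong (trans (*-congʳ (null a)) (zeroˡ (φ a)))
                         (vanishes m (remove a L) shorter null′))
            (+-identityˡ 0#))
        where
        shorter : length (remove a L) ≤ m
        shorter rewrite dec-true (a ≋? a) ≋.refl = ℕ.≤-trans (length-remove a L′) len

        null′ : ∀ b → coefficientAt b (remove a L) ≈ 0#
        null′ b with a ≋? b
        ... | yes a≋b = coefficientAt-removed a≋b L
        ... | no  a≭b = trans (coefficientAt-kept a≭b L) (null b)

  -- Makes linear extension well defined: formal sums are compared by total coefficients, whereas
  -- `combination` adds up their terms as listed.
  combination-null : ∀ {φ : A → Carrier} → (∀ {a b} → a ≋ b → φ a ≈ φ b) →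
    ∀ L → (∀ a → coefficientAt a L ≈ 0#) → combination φ L ≈ 0#
  combination-null φ-resp L = vanishes φ-resp (length L) L ℕ.≤-refl

module ColouringSums (R : CommutativeRing 0ℓ 0ℓ) (t : CommutativeRing.Carrier R) where
  open CommutativeRing R
  open ListSums R
  open Algebra.Properties.Ring ring using (-‿distribˡ-*; -1*x≈-x)
  open Algebra.Properties.AbelianGroup +-abelianGroup using (⁻¹-∙-comm)
  open Algebra.Properties.CommutativeSemigroup +-commutativeSemigroup using (x∙yz≈y∙xz)
  open Algebra.Definitions.RawSemiring (Semiring.rawSemiring semiring) using (_^_)
  open Algebra.Definitions.RawMonoid +-rawMonoid using () renaming (_×_ to _×ᴿ_)
  open Algebra.Properties.Semiring.Exp semiring using (^-homo-*)
  private module R = Subtraction {ring} TensorUnit.leftModule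
  open EdgeDifferences R t TensorUnit.leftModule

  weight : ∀ {k n} → Vec ℕ k → Edges n → Colouring k n → Carrier
  weight α E κ = if does (hasMonomial? α κ) then (1# + t) ^ e κ E else 0#

  -- With `R` the polynomials and `t` the variable, this is the coefficient of the monomial with
  -- exponents `α` in XB of the graph, as a single polynomial in `t`. The sum runs over a list so
  -- that it can be permuted.
  W : ∀ {k} → Vec ℕ k → Graph → Carrier
  W {k} α (n , E) = ∑ (colourings k n) (weight α E)

  W-≅ : ∀ {k} (α : Vec ℕ k) {G H} → G ≅ H → W α G ≈ W α H
  W-≅ {k} α {m , E} {n , F} G≅H@(π , _) = begin
    ∑ (colourings k m) (weight α E)
      ≈⟨ ∑-↭ (weight α E) (recolour-↭ k π) ⟨
    ∑ (map (recolour (π ⟨$⟩ʳ_)) (colourings k n)) (weight α E)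
      ≈⟨ ∑-map (recolour (π ⟨$⟩ʳ_)) (colourings k n) (weight α E) ⟩
    ∑ (colourings k n) (λ κ → weight α E (recolour (π ⟨$⟩ʳ_) κ))
      ≈⟨ ∑-cong (colourings k n) same ⟩
    ∑ (colourings k n) (weight α F) ∎
    where
    open Relation.Binary.Reasoning.Setoid setoid
    same : ∀ κ → weight α E (recolour (π ⟨$⟩ʳ_) κ) ≈ weight α F κ
    same κ = reflexive (cong₂ (λ b n → if b then (1# + t) ^ n else 0#)
      (does-⇔ (mk⇔ (λ h i → ≡.trans (≡.sym (occurrences-recolour π κ i)) (h i))
                   (λ h i → ≡.trans (occurrences-recolour π κ i) (h i)))
        (hasMonomial? α (recolour (π ⟨$⟩ʳ_) κ)) (hasMonomial? α κ))
      (e-≅ {E = E} {F} G≅H κ))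

  e-++ : ∀ {k n} (κ : Colouring k n) E F → e κ (E ++ F) ≡ e κ E ℕ.+ e κ F
  e-++ κ E F = ≡.trans (cong length (filter-++ (monochromatic? κ) E F))
    (length-++ (filter (monochromatic? κ) E))

  -- `e` is additive over edges, so the power of 1 + t coming from `E` factors out of every term,
  -- and a relator need only be checked on the colourings of its own few vertices.
  W-Ext : ∀ {k m n} (α : Vec ℕ k) (ℓ : List (Carrier × Edges m)) →
    (∀ (κ : Colouring k m) → R.combination (λ F → (1# + t) ^ e κ F) ℓ ≈ 0#) →
    ∀ (f : Fin m → Fin n) E → R.combination (λ F → W α (n , E ++ relabel f F)) ℓ ≈ 0#
  W-Ext {k} {m} {n} α ℓ relation f E = trans
    (∑-combination (colourings k n) (λ F → weight α (E ++ relabel f F)) ℓ)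
    (∑-zero (colourings k n) vanish)
    where
    pull : ∀ κ ℓ → R.combination (λ F → (1# + t) ^ e κ (E ++ relabel f F)) ℓ ≈
                   (1# + t) ^ e κ E * R.combination (λ F → (1# + t) ^ e (recolour f κ) F) ℓ
    pull κ []            = sym (zeroʳ _)
    pull κ ((c , F) ∷ ℓ) = begin
      c * (1# + t) ^ e κ (E ++ relabel f F) + rest
        ≈⟨ +-cong (*-congˡ (reflexive (cong ((1# + t) ^_)
             (≡.trans (e-++ κ E (relabel f F)) (cong (e κ E ℕ.+_) (≡.sym (e-relabel f κ F)))))))
             (pull κ ℓ) ⟩
      c * (1# + t) ^ (e κ E ℕ.+ e (recolour f κ) F) + x * rest′
        ≈⟨ +-congʳ (*-congˡ (^-homo-* (1# + t) (e κ E) (e (recolour f κ) F))) ⟩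
      c * (x * y) + x * rest′
        ≈⟨ +-congʳ (trans (sym (*-assoc c x y)) (trans (*-congʳ (*-comm c x)) (*-assoc x c y))) ⟩
      x * (c * y) + x * rest′
        ≈⟨ distribˡ x (c * y) rest′ ⟨
      x * (c * y + rest′) ∎
      where
      open Relation.Binary.Reasoning.Setoid setoid
      rest = R.combination (λ F → (1# + t) ^ e κ (E ++ relabel f F)) ℓ
      rest′ = R.combination (λ F → (1# + t) ^ e (recolour f κ) F) ℓ
      x = (1# + t) ^ e κ E
      y = (1# + t) ^ e (recolour f κ) F

    zeros : ∀ ℓ → R.combination (λ (_ : Edges m) → 0#) ℓ ≈ 0#
    zeros []            = refl
    zeros ((c , F) ∷ ℓ) = trans (+-cong (zeroʳ c) (zeros ℓ)) (+-identityˡ 0#)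

    vanish : ∀ κ → R.combination (λ F → weight α (E ++ relabel f F) κ) ℓ ≈ 0#
    vanish κ with does (hasMonomial? α κ)
    ... | true  = trans (pull κ ℓ) (trans (*-congˡ (relation (recolour f κ))) (zeroʳ _))
    ... | false = zeros ℓ

  private
    cancel₂ : ∀ {A B c} → A ≈ c * B → 1# * A + (- c * B + 0#) ≈ 0#
    cancel₂ {A} {B} {c} eq = trans
      (+-cong (trans (*-identityˡ A) eq) (trans (+-identityʳ _) (sym (-‿distribˡ-* c B))))
      (-‿inverseʳ (c * B))

    cancel₃ : ∀ {A B C c d} → A + d * C ≈ c * B → 1# * A + (- c * B + (d * C + 0#)) ≈ 0#
    cancel₃ {A} {B} {C} {c} {d} eq = begin
      1# * A + (- c * B + (d * C + 0#))
        ≈⟨ +-cong (*-identityˡ A) (+-cong (sym (-‿distribˡ-* c B)) (+-identityʳ _)) ⟩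
      A + (- (c * B) + d * C)   ≈⟨ +-congˡ (+-comm _ _) ⟩
      A + (d * C - c * B)       ≈⟨ +-assoc _ _ _ ⟨
      (A + d * C) - c * B       ≈⟨ +-congʳ eq ⟩
      c * B - c * B             ≈⟨ -‿inverseʳ (c * B) ⟩
      0#                        ∎
      where open Relation.Binary.Reasoning.Setoid setoid

    cancel₄ : ∀ {A B C D} → A + B ≈ C + D →
              1# * A + (1# * B + (- 1# * C + (- 1# * D + 0#))) ≈ 0#
    cancel₄ {A} {B} {C} {D} eq = begin
      1# * A + (1# * B + (- 1# * C + (- 1# * D + 0#)))
        ≈⟨ +-cong (*-identityˡ A) (+-cong (*-identityˡ B) (+-cong (-1*x≈-x C)
             (trans (+-identityʳ _) (-1*x≈-x D)))) ⟩
      A + (B + (- C - D))   ≈⟨ +-congˡ (+-congˡ (⁻¹-∙-comm C D)) ⟩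
      A + (B - (C + D))     ≈⟨ +-assoc _ _ _ ⟨
      (A + B) - (C + D)     ≈⟨ +-congʳ eq ⟩
      (C + D) - (C + D)     ≈⟨ -‿inverseʳ (C + D) ⟩
      0#                    ∎
      where open Relation.Binary.Reasoning.Setoid setoid

    a = 1# + t

    -- A sum of indicators, which computes as soon as it is known which endpoints share a colour;
    -- the relations below are checked by those cases.
    monochromatic : ∀ {k n} → Colouring k n → Edges n → ℕ
    monochromatic κ = foldr (λ f m → ⟦ does (monochromatic? κ f) ⟧ ℕ.+ m) 0

    e-monochromatic : ∀ {k n} (κ : Colouring k n) E → e κ E ≡ monochromatic κ E
    e-monochromatic κ []      = ≡.refl
    e-monochromatic κ (f ∷ E) = ≡.trans (length-filter-∷ (monochromatic? κ) f E)
      (cong (⟦ does (monochromatic? κ f) ⟧ ℕ.+_) (e-monochromatic κ E))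

    by-monochromatic : ∀ {k n} (κ : Colouring k n) ℓ →
      R.combination (λ F → a ^ monochromatic κ F) ℓ ≈ 0# → R.combination (λ F → a ^ e κ F) ℓ ≈ 0#
    by-monochromatic κ ℓ =
      trans (R.combination-cong ℓ λ F → reflexive (cong (a ^_) (e-monochromatic κ F)))

  W-iso : ∀ {k} (α : Vec ℕ k) {G H} → G ≅ H →
    R.combination (W α) ((1# , G) ∷ (- 1# , H) ∷ []) ≈ 0#
  W-iso α {G} {H} G≅H = cancel₂ (trans (W-≅ α {G} {H} G≅H) (sym (*-identityˡ _)))

  -- The elements `ℓ-loop`, `ℓ-multi` and `ℓ-os+` over an arbitrary ring; at `P` and `X` these forms
  -- unfold to them.
  loopForm : List (Carrier × Edges 1)
  loopForm = (1# , (0F , 0F) ∷ []) ∷ (- (t + 1#) , []) ∷ []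

  multiForm : List (Carrier × Edges 2)
  multiForm = (1# , (0F , 1F) ∷ (0F , 1F) ∷ []) ∷ (- (t + (1# + 1#)) , (0F , 1F) ∷ []) ∷ (t + 1# , []) ∷ []

  osForm : List (Carrier × Edges 3)
  osForm = (1# , (0F , 1F) ∷ (1F , 2F) ∷ []) ∷ (1# , (0F , 2F) ∷ []) ∷ (- 1# , (0F , 1F) ∷ [])
        ∷ (- 1# , (0F , 2F) ∷ (1F , 2F) ∷ []) ∷ []

  loop-relation : ∀ {k} (κ : Colouring k 1) →
    R.combination (λ F → a ^ e κ F) loopForm ≈ 0#
  loop-relation κ@(i ∷ []) = by-monochromatic κ loopForm go
    where
    go : R.combination (λ F → a ^ monochromatic κ F) loopForm ≈ 0#
    go with i Fin.≟ i
    ... | yes _   = cancel₂ (*-congʳ (+-comm 1# t))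
    ... | no  i≢i = contradiction ≡.refl i≢i

  -- Under a colouring an edge counts as 1 + t or as 1, and these are the two roots of y² - (t + 2)
  -- y + (t + 1).
  multi-relation : ∀ {k} (κ : Colouring k 2) →
    R.combination (λ F → a ^ e κ F) multiForm ≈ 0#
  multi-relation κ@(i ∷ j ∷ []) = by-monochromatic κ multiForm go
    where
    go : R.combination (λ F → a ^ monochromatic κ F) multiForm ≈ 0#
    go with does (i Fin.≟ j)
    ... | true  = cancel₃ (begin
      a * b + (t + 1#) * 1#   ≈⟨ +-congˡ (*-congʳ (+-comm t 1#)) ⟩
      a * b + b               ≈⟨ +-congˡ (*-identityˡ b) ⟨
      a * b + 1# * b          ≈⟨ distribʳ b a 1# ⟨
      (a + 1#) * b            ≈⟨ *-congʳ (trans (+-congʳ (+-comm 1# t)) (+-assoc t 1# 1#)) ⟩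
      (t + (1# + 1#)) * b     ∎)
      where
      open Relation.Binary.Reasoning.Setoid setoid
      b = a * 1#
    ... | false = cancel₃ (trans (+-congˡ (*-identityʳ _))
      (trans (x∙yz≈y∙xz 1# t 1#) (sym (*-identityʳ _))))

  -- In each of the five consistent patterns of equal colours, the two positive terms equal the two
  -- negative ones in some order; the other three patterns contradict transitivity.
  os+-relation : ∀ {k} (κ : Colouring k 3) →
    R.combination (λ F → a ^ e κ F) osForm ≈ 0#
  os+-relation κ@(i ∷ j ∷ l ∷ []) = by-monochromatic κ osForm go
    where
    go : R.combination (λ F → a ^ monochromatic κ F) osForm ≈ 0#
    go with i Fin.≟ j | j Fin.≟ l | i Fin.≟ l
    ... | yes _   | yes _   | yes _   = cancel₄ (+-comm _ _)
    ... | yes _   | no  _   | no  _   = cancel₄ refl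
    ... | no  _   | yes _   | no  _   = cancel₄ (+-comm _ _)
    ... | no  _   | no  _   | yes _   = cancel₄ refl
    ... | no  _   | no  _   | no  _   = cancel₄ refl
    ... | yes i≡j | yes j≡l | no  i≢l = contradiction (≡.trans i≡j j≡l) i≢l
    ... | yes i≡j | no  j≢l | yes i≡l = contradiction (≡.trans (≡.sym i≡j) i≡l) j≢l
    ... | no  i≢j | yes j≡l | yes i≡l = contradiction (≡.trans i≡l (≡.sym j≡l)) i≢j

  module _ {n} (r : Fin n → Fin n) where
    private
      -- The value of `x_uv` under a colouring: (1 + t) - 1 on a monochromatic edge and 1 - 1 on any
      -- other.
      edgeFactor : ∀ {k} → Colouring k n → Fin n × Fin n → Carrier
      edgeFactor κ (u , v) = if does (lookup κ u Fin.≟ lookup κ v) then t else 0#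

      factor : ∀ {k} → Colouring k n → Fin n → Carrier
      factor κ v = if does (v Fin.≟ r v) then 1# else edgeFactor κ (v , r v)

      factors : ∀ {k} → List (Fin n) → Colouring k n → Carrier
      factors vs κ = foldr (λ v x → factor κ v * x) 1# vs

      ∂-weight : ∀ {k} (α : Vec ℕ k) f E κ →
        weight α (f ∷ E) κ - weight α E κ ≈ edgeFactor κ f * weight α E κ
      ∂-weight α (u , v) E κ with does (hasMonomial? α κ) | does (lookup κ u Fin.≟ lookup κ v)
      ... | false | _     = trans (-‿inverseʳ 0#) (sym (zeroʳ _))
      ... | true  | false = trans (-‿inverseʳ _) (sym (zeroˡ _))
      ... | true  | true  = begin
        (1# + t) * x - x      ≈⟨ +-congʳ (distribʳ x 1# t) ⟩
        (1# * x + t * x) - x  ≈⟨ +-congʳ (+-congʳ (*-identityˡ x)) ⟩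
        (x + t * x) - x       ≈⟨ +-congʳ (+-comm x (t * x)) ⟩
        (t * x + x) - x       ≈⟨ +-assoc (t * x) x (- x) ⟩
        t * x + (x - x)       ≈⟨ +-congˡ (-‿inverseʳ x) ⟩
        t * x + 0#            ≈⟨ +-identityʳ (t * x) ⟩
        t * x                 ∎
        where
        open Relation.Binary.Reasoning.Setoid setoid
        x = (1# + t) ^ e κ E

      W-stars : ∀ {k} (α : Vec ℕ k) vs E → stars r vs (λ E → W α (n , E)) E ≈
        ∑ (colourings k n) (λ κ → factors vs κ * weight α E κ)
      W-stars {k} α [] E = ∑-cong (colourings k n) λ κ → sym (*-identityˡ _)
      W-stars {k} α (v ∷ vs) E with does (v Fin.≟ r v)
      ... | true  = trans (W-stars α vs E)
        (∑-cong (colourings k n) λ κ → *-congʳ (sym (*-identityˡ _)))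
      ... | false = begin
        stars r vs (λ E → W α (n , E)) (f ∷ E) - stars r vs (λ E → W α (n , E)) E
          ≈⟨ +-cong (W-stars α vs (f ∷ E)) (-‿cong (W-stars α vs E)) ⟩
        ∑ κs (λ κ → factors vs κ * weight α (f ∷ E) κ) - ∑ κs (λ κ → factors vs κ * weight α E κ)
          ≈⟨ ∑-sub κs _ _ ⟩
        ∑ κs (λ κ → factors vs κ * weight α (f ∷ E) κ - factors vs κ * weight α E κ)
          ≈⟨ ∑-cong κs (λ κ → trans (sym (R.*ₗ-sub (factors vs κ) (weight α (f ∷ E) κ) (weight α E κ)))
               (trans (*-congˡ (∂-weight α f E κ))
                 (trans (sym (*-assoc _ _ _)) (*-congʳ (*-comm _ _))))) ⟩
        ∑ κs (λ κ → (edgeFactor κ f * factors vs κ) * weight α E κ) ∎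
        where
        open Relation.Binary.Reasoning.Setoid setoid
        f = v , r v
        κs = colourings k n

    -- The number of edges of the forest when applied to all vertices; it becomes the exponent of
    -- `t`.
    leaves : List (Fin n) → ℕ
    leaves = foldr (λ v d → if does (v Fin.≟ r v) then d else suc d) 0

    Admissible : ∀ {k} → Vec ℕ k → Colouring k n → Set
    Admissible α κ = HasMonomial α κ × (∀ v → lookup κ v ≡ lookup κ (r v))

    admissible? : ∀ {k} (α : Vec ℕ k) κ → Dec (Admissible α κ)
    admissible? α κ = hasMonomial? α κ ×-dec Fin.all? (λ v → lookup κ v Fin.≟ lookup κ (r v))

    -- The coefficient of the monomial with exponents `α` in the power sum p_λ, where λ lists the
    -- star sizes of `r`.
    admissible : ∀ {k} → Vec ℕ k → ℕ
    admissible {k} α = length (filter (admissible? α) (colourings k n))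

    private
      factors-closed : ∀ {k} (κ : Colouring k n) → (∀ v → lookup κ v ≡ lookup κ (r v)) →
                       ∀ vs → factors vs κ ≈ t ^ leaves vs
      factors-closed κ closed []       = refl
      factors-closed κ closed (v ∷ vs) with does (v Fin.≟ r v)
      ... | true  = trans (*-identityˡ _) (factors-closed κ closed vs)
      ... | false rewrite dec-true (lookup κ v Fin.≟ lookup κ (r v)) (closed v) =
        *-congˡ (factors-closed κ closed vs)

      factors-open : ∀ {k} (κ : Colouring k n) {v} → lookup κ v ≢ lookup κ (r v) →
                     ∀ {vs} → v ∈ˡ vs → factors vs κ ≈ 0#
      factors-open κ {v} open-v (here ≡.refl)
        rewrite dec-false (v Fin.≟ r v) (λ v≡rv → open-v (cong (lookup κ) v≡rv))
              | dec-false (lookup κ v Fin.≟ lookup κ (r v)) open-v = zeroˡ _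
      factors-open κ open-v (there v∈) = trans (*-congˡ (factors-open κ open-v v∈)) (zeroʳ _)

    -- A colouring constant on every star collects `t` from each edge; any other meets an edge with
    -- factor 0.
    W-forest : ∀ {k} (α : Vec ℕ k) → stars r (allFin n) (λ E → W α (n , E)) [] ≈
               admissible α ×ᴿ (t ^ leaves (allFin n))
    W-forest {k} α = trans (W-stars α (allFin n) [])
      (∑-indicator (admissible? α) (colourings k n) (t ^ leaves (allFin n)) good bad)
      where
      good : ∀ κ → Admissible α κ → factors (allFin n) κ * weight α [] κ ≈ t ^ leaves (allFin n)
      good κ (h , closed) rewrite dec-true (hasMonomial? α κ) h =
        trans (*-identityʳ _) (factors-closed κ closed (allFin n))

      bad : ∀ κ → ¬ Admissible α κ → factors (allFin n) κ * weight α [] κ ≈ 0#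
      bad κ ¬good = go (hasMonomial? α κ)
        where
        go : Dec (HasMonomial α κ) → factors (allFin n) κ * weight α [] κ ≈ 0#
        go (no ¬h) rewrite dec-false (hasMonomial? α κ) ¬h = zeroʳ _
        go (yes h) with Fin.¬∀⟶∃¬ n _ (λ v → lookup κ v Fin.≟ lookup κ (r v)) (λ c → ¬good (h , c))
        ... | v , open-v = trans (*-congʳ (factors-open κ open-v (∈-allFin v))) (zeroˡ _)

module _ (R : CommutativeRing 0ℓ 0ℓ) (t : CommutativeRing.Carrier R)
         {M N : LeftModule (CommutativeRing.ring R) 0ℓ 0ℓ} (h : LinearMap M N) where
  private
    module N = LeftModule N
    module EM = EdgeDifferences R t M
    module EN = EdgeDifferences R t N
  open LinearMap h

  -- A linear map passes through differences, so the value of a star forest can be computed from the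
  -- values of graphs alone.
  stars-homo : ∀ {n} (r : Fin n → Fin n) vs φ {ψ} → (∀ E → ⟪ φ E ⟫ N.≈ᴹ ψ E) →
    ∀ E → ⟪ EM.stars r vs φ E ⟫ N.≈ᴹ EN.stars r vs ψ E
  stars-homo r []       φ e E = e E
  stars-homo r (v ∷ vs) φ e E with does (v Fin.≟ r v)
  ... | true  = stars-homo r vs φ e E
  ... | false = N.≈ᴹ-trans (sub-homo _ _) (Subtraction.-ᴹ-cong₂ N
    (stars-homo r vs φ e ((v , r v) ∷ E)) (stars-homo r vs φ e E))

-- The functional w b detects b among the elements of rank at most that of b, up
-- to elements which X identifies with b; so the coefficients are eliminated from
-- the highest rank downwards.
module Elimination {R : Ring 0ℓ 0ℓ} (Q : LeftModule R 0ℓ 0ℓ) {B : Set}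
  (X : B → LeftModule.Carrierᴹ Q) (rank : B → ℕ)
  (w : B → LinearMap Q (TensorUnit.leftModule {R = R}))
  {Null : B → B → Set} (null? : ∀ b b′ → Dec (Null b b′))
  (null : ∀ {b b′} → Null b b′ → Ring._≈_ R (LinearMap.⟪_⟫ (w b) (X b′)) (Ring.0# R))
  (non-null : ∀ {b b′} → ¬ Null b b′ → rank b′ ≤ rank b → LeftModule._≈ᴹ_ Q (X b′) (X b))
  (¬null-self : ∀ b → ¬ Null b b)
  (cancel : ∀ b c → Ring._≈_ R (Ring._*_ R c (LinearMap.⟪_⟫ (w b) (X b))) (Ring.0# R) → Ring._≈_ R c (Ring.0# R))
  where
  private
    module R = Ring R
    module w b = LinearMap (w b)
  open LeftModule Q
  open Subtraction Q
  private module RM = Subtraction (TensorUnit.leftModule {R = R})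

  private
    highest : ∀ x (L : List (R.Carrier × B)) → ∃ λ y → y ∈ˡ (x ∷ L) ×
              All (λ (_ , b) → rank b ≤ rank (proj₂ y)) (x ∷ L)
    highest x []      = x , here ≡.refl , ℕ.≤-refl ∷ []

    highest x (y ∷ L) with highest y L
    ... | z , z∈ , all with ℕ.≤-total (rank (proj₂ x)) (rank (proj₂ z))
    ... | inj₁ x≤z = z , there z∈ , x≤z ∷ all
    ... | inj₂ z≤x = x , here ≡.refl , ℕ.≤-refl ∷ All.map (λ b≤z → ℕ.≤-trans b≤z z≤x) all


    eliminate : ∀ m L → length L ≤ m →
      (∀ b → w.⟪_⟫ b (combination X L) R.≈ R.0#) → combination X L ≈ᴹ 0ᴹ
    eliminate m       []       _         _     = ≈ᴹ-refl
    eliminate (suc m) L@(x ∷ L′) len vanish with highest x L′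
    ... | y@(_ , b) , y∈ , all = ≈ᴹ-trans split
      (≈ᴹ-trans (+ᴹ-cong M≈0 (eliminate m Z shorter vanish-Z)) (+ᴹ-identityˡ 0ᴹ))
      where
      Z? : ∀ (z : R.Carrier × B) → Dec (Null b (proj₂ z))
      Z? (_ , b′) = null? b b′

      -- `b` has the highest rank, so by `non-null` every term kept in `M` equals `X b` in the
      -- quotient and `M` collapses to one multiple of it.
      M = filter (λ z → ¬? (Z? z)) L
      Z = filter Z? L

      split : combination X L ≈ᴹ combination X M +ᴹ combination X Z
      split = combination-filter X Z? L

      total = foldr (λ (c , _) s → c R.+ s) R.0# M

      M≈b : combination X M ≈ᴹ total *ₗ X b
      M≈b = combination-constant X M (All.zipWith (λ (¬n , b′≤b) → non-null ¬n b′≤b)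
        (All.all-filter (λ z → ¬? (Z? z)) L , All.filter⁺ (λ z → ¬? (Z? z)) all))

      Z-null : w.⟪_⟫ b (combination X Z) R.≈ R.0#
      Z-null = R.trans (w.combination-homo b X Z)
        (R.trans (RM.combination-constant (λ b′ → w.⟪_⟫ b (X b′)) Z
            (All.map null (All.all-filter Z? L)))
          (R.zeroʳ _))

      -- `w b` annihilates `Z`, so its value on the whole list, which is zero, is `total` times its
      -- value on `X b`.
      total≈0 : total R.≈ R.0#
      total≈0 = cancel b total
        (R.trans (R.sym (R.trans (w.resp b M≈b) (w.*-homo b total (X b))))
        (R.trans (R.sym (R.trans (R.+-congˡ Z-null) (R.+-identityʳ _)))
        (R.trans (R.sym (R.trans (w.resp b split) (w.+-homo b _ _)))
        (vanish b))))

      M≈0 : combination X M ≈ᴹ 0ᴹ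
      M≈0 = ≈ᴹ-trans M≈b (≈ᴹ-trans (*ₗ-congʳ total≈0) (*ₗ-zeroˡ (X b)))

      vanish-Z : ∀ b′ → w.⟪_⟫ b′ (combination X Z) R.≈ R.0#
      vanish-Z b′ = R.trans (w.resp b′ (≈ᴹ-sym (≈ᴹ-trans split
        (≈ᴹ-trans (+ᴹ-congʳ M≈0) (+ᴹ-identityˡ _))))) (vanish b′)

      -- `b` occurs in the list but, by `¬null-self`, not in `Z`.
      shorter : length Z ≤ m
      shorter = ℕ.s≤s⁻¹ (ℕ.≤-trans (filter-notAll Z? L (lose y∈ (¬null-self b))) len)

  independent : ∀ L → (∀ b → w.⟪_⟫ b (combination X L) R.≈ R.0#) → combination X L ≈ᴹ 0ᴹ
  independent L = eliminate (length L) L ℕ.≤-refl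

-- Evaluation of graphs and the kernel

≋-isEquivalence : IsEquivalence _≋_
≋-isEquivalence = record
  { refl  = λ {(n , E)} → ≡.refl , λ u v →
      ≡.sym (cong₂ (multiplicity E) (Fin.cast-is-id ≡.refl u) (Fin.cast-is-id ≡.refl v))
  ; sym   = λ { {n , E} {_ , F} (≡.refl , same) → ≡.refl , λ u v → ≡.trans
      (≡.sym (cong₂ (multiplicity F) (Fin.cast-is-id ≡.refl u) (Fin.cast-is-id ≡.refl v)))
      (≡.trans (≡.sym (same u v))
        (≡.sym (cong₂ (multiplicity E) (Fin.cast-is-id ≡.refl u) (Fin.cast-is-id ≡.refl v)))) }
  ; trans = λ { {n , E} {_ , F} (≡.refl , same) (≡.refl , same′) → ≡.refl , λ u v → ≡.trans (same u v)
      (≡.trans (cong₂ (multiplicity F) (Fin.cast-is-id ≡.refl u) (Fin.cast-is-id ≡.refl v)) (same′ u v)) }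
  }

module Evaluation (K : CommutativeRing 0ℓ 0ℓ) where
  open PolynomialRing K
  open GraphModule K
  open ColouringSums P X
  open TutteSymmetricFunction K using
    (FormalSum; FormalSumOn; coefficientOf; Ext; T; ℓ-loop; ℓ-multi; ℓ-os+; T-iso; T-loop; T-multi; T-os+)
  open FormalSums P ≋-isEquivalence _≋?_ using (coefficientAt; combination-null)

  open Algebra.Definitions.RawSemiring (Semiring.rawSemiring P.semiring) using (_^_)

  P-module : LeftModule P.ring 0ℓ 0ℓ
  P-module = TensorUnit.leftModule
  private
    module PM = Subtraction P-module
    module GM = Subtraction 𝔾

  coefficientAt-Of : ∀ G L → coefficientAt G L ≡ coefficientOf G L
  coefficientAt-Of G []            = ≡.refl
  coefficientAt-Of G ((c , H) ∷ L) =
    cong ((if does (G ≋? H) then c else 0ₚ) ⊕_) (coefficientAt-Of G L)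

  module _ {k} (α : Vec ℕ k) where
    value : FormalSum → Poly
    value = PM.combination (W α)

    private
      value-null : ∀ L → (∀ G → coefficientOf G L ≈ᴾ 0ₚ) → value L ≈ᴾ 0ₚ
      value-null L null = combination-null {W α} (λ {G} {H} G≋H → W-≅ α {G} {H} (≋⇒≅ {G} {H} G≋H)) L
        λ G → subst (_≈ᴾ 0ₚ) (≡.sym (coefficientAt-Of G L)) (null G)

      value-cong : ∀ {L M} → L 𝔾.≈ᴹ M → value L ≈ᴾ value M
      value-cong {L} {M} L≈M = PM.sub-unique {value L} {value M}
        (P.trans (P.+-congˡ {value L} (P.sym (PM.combination-neg (W α) M)))
          (P.trans (P.sym (PM.combination-++ (W α) L (𝔾.-ᴹ M)))
            (value-null (L GM.-ᴹ M) λ G → coefficientwise (GM.x-x≈0 {L} {M} L≈M G))))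

    evaluation : LinearMap 𝔾 P-module
    evaluation = record
      { ⟪_⟫    = value
      ; resp   = λ {L} {M} → value-cong {L} {M}
      ; +-homo = PM.combination-++ (W α)
      ; *-homo = PM.combination-scale (W α)
      }

    private
      module evaluation = LinearMap evaluation

      value-iso : ∀ L → T-iso L → value L ≈ᴾ 0ₚ
      value-iso L (G , H , G≅H , e) =
        P.trans (value-cong {L} {(1ₚ , G) ∷ (⊖ 1ₚ , H) ∷ []} e) (W-iso α {G} {H} G≅H)

      value-T : ∀ {m} (ℓ : FormalSumOn m) →
        (∀ (κ : Colouring k m) → PM.combination (λ F → (1ₚ ⊕ X) ^ e κ F) ℓ ≈ᴾ 0ₚ) →
        ∀ L → T ℓ L → value L ≈ᴾ 0ₚ
      value-T ℓ relation L (N , m≤N , E , L≈Ext) = P.trans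
        (value-cong {L} {Ext m≤N ℓ E} L≈Ext)
        (subst (_≈ᴾ 0ₚ)
          (≡.sym (PM.combination-map (W α) (λ F → N , E ++ relabel (λ i → inject≤ i m≤N) F) ℓ))
          (W-Ext α ℓ relation (λ i → inject≤ i m≤N) E))

      value-relators : ∀ L → relators L → value L ≈ᴾ 0ₚ
      value-relators L (inj₁ i) =
        evaluation.vanishes-on-span {T-iso} (λ {L} → value-iso L) {L} i
      value-relators L (inj₂ (inj₁ s)) =
        evaluation.vanishes-on-span {T-loop ∪ T-multi}
          (λ { {L} (inj₁ r) → value-T ℓ-loop loop-relation L r
             ; {L} (inj₂ r) → value-T ℓ-multi multi-relation L r }) {L} s
      value-relators L (inj₂ (inj₂ s)) =
        evaluation.vanishes-on-span {T-os+} (λ {L} → value-T ℓ-os+ os+-relation L) {L} s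

    value-span : ∀ L → ⟨S⟩ L → value L ≈ᴾ 0ₚ
    value-span L = evaluation.vanishes-on-span {relators} (λ {L} → value-relators L) {L}

    -- Evaluation kills the relators and so descends to the quotient; this also gives the inclusion
    -- of the span in the kernel.
    evaluationQ : LinearMap Q P-module
    evaluationQ = record
      { ⟪_⟫    = value
      ; resp   = λ {L} {M} L~M → PM.sub-unique {value L} {value M}
          (P.trans (P.sym (evaluation.sub-homo L M)) (value-span (L GM.-ᴹ M) (difference L~M)))
      ; +-homo = PM.combination-++ (W α)
      ; *-homo = PM.combination-scale (W α)
      }

    open Algebra.Definitions.RawMonoid P.+-rawMonoid using () renaming (_×_ to _×ᴾ_)

    value-starForest : ∀ {n} (r : Fin n → Fin n) idem →
      value (starForest (n , r , idem)) ≈ᴾ admissible r α ×ᴾ (X ^ leaves r (allFin n))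
    value-starForest {n} r idem = P.trans
      (stars-homo P X evaluationQ r (allFin n) (λ E → graph (n , E))
        (λ E → P.trans (P.+-identityʳ _) (P.*-identityˡ (W α (n , E)))) [])
      (W-forest r α)

-- The Tutte symmetric function compared with its polynomial coefficients at each monomial

module Coefficients (K : CommutativeRing 0ℓ 0ℓ) where
  open PolynomialRing K
  open Evaluation K using (value)
  open TutteSymmetricFunction K using
    (SymmetricFunction; module SymmetricFunction; Λ; XB; KerXB; XB-graph;
     XB-coefficient; contribution; ∑κ; coefficient)
    renaming (_^_ to _^ᵗ_)
  private
    module K = CommutativeRing K
    module P = CommutativeRing P
    module Λ = RawLeftModule Λ
    module ΛP = Polynomials Λ
  open Algebra.Definitions.RawSemiring (Semiring.rawSemiring P.semiring) using (_^_)
  open ColouringSums P X using (W; weight)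
  open ListSums P using (∑; ∑-++; ∑-map)
  open Algebra.Properties.CommutativeMonoid.Sum K.+-commutativeMonoid
    using ()
    renaming (sum to sumᴷ; sum-cong-≋ to sumᴷ-cong; sum-replicate-zero to sumᴷ-zero)

  private
    ∑κ-cong : ∀ {m} n {F G : Colouring m n → K.Carrier} →
              (∀ κ → F κ K.≈ G κ) → ∑κ n F K.≈ ∑κ n G
    ∑κ-cong zero    F≈G = F≈G []
    ∑κ-cong (suc n) F≈G = sumᴷ-cong λ i → ∑κ-cong n λ κ → F≈G (i ∷ κ)

    ∑κ-zero : ∀ {m} n {F : Colouring m n → K.Carrier} →
              (∀ κ → F κ K.≈ K.0#) → ∑κ n F K.≈ K.0#
    ∑κ-zero     zero    F≈0 = F≈0 []
    ∑κ-zero {m} (suc n) F≈0 = K.trans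
      (sumᴷ-cong λ i → ∑κ-zero n λ κ → F≈0 (i ∷ κ)) (sumᴷ-zero m)

    -- Stated for arbitrary `g` because the tail of a tabulated list is tabulated by `g ∘ suc`.
    ∑-tabulate : ∀ {m k n} (g : Fin m → Fin k) (ys : List (Colouring k n)) F j →
      coefficient (∑ (cartesianProductWith _∷_ (List.tabulate g) ys) F) j K.≈
      sumᴷ λ i → coefficient (∑ ys λ κ → F (g i ∷ κ)) j
    ∑-tabulate {zero}  g ys F j = K.refl
    ∑-tabulate {suc m} g ys F j = K.trans
      (at (∑-++ (map (g zero ∷_) ys) (cartesianProductWith _∷_ (List.tabulate (g ∘ suc)) ys) F) j)
      (K.trans
        (coefficient-⊕ (∑ (map (g zero ∷_) ys) F)
          (∑ (cartesianProductWith _∷_ (List.tabulate (g ∘ suc)) ys) F) j)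
        (K.+-cong (at (∑-map (g zero ∷_) ys F) j) (∑-tabulate (g ∘ suc) ys F j)))

    coefficient-∑ : ∀ {k} n (F : Colouring k n → Poly) j →
      coefficient (∑ (colourings k n) F) j K.≈ ∑κ n λ κ → coefficient (F κ) j
    coefficient-∑     zero    F j = at (P.+-identityʳ (F [])) j
    coefficient-∑ {k} (suc n) F j = K.trans (∑-tabulate (λ i → i) (colourings k n) F j)
      (sumᴷ-cong λ i → coefficient-∑ n (λ κ → F (i ∷ κ)) j)

    -- `XB-graph` lists the coefficients of `t` only up to the number of edges; this bound shows
    -- that the truncation loses nothing.
    power-degree : ∀ m j → m < j → coefficient ((1ₚ ⊕ X) ^ m) j K.≈ K.0#
    power-degree zero    (suc j) _         = K.refl
    power-degree (suc m) (suc j) (s≤s m<j) = K.trans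
      (at (P.distribʳ p 1ₚ X) (suc j))
      (K.trans (coefficient-⊕ (1ₚ ⊗ p) (X ⊗ p) (suc j))
        (K.trans
          (K.+-cong (K.trans (at (P.*-identityˡ p) (suc j)) (power-degree m (suc j) (ℕ.m<n⇒m<1+n m<j)))
                    (K.trans (at (X-⊗ p) (suc j)) (power-degree m j m<j)))
          (K.+-identityˡ K.0#)))
      where p = (1ₚ ⊕ X) ^ m

    -- The two powers differ only in the equality of the underlying raw ring, which _^_ ignores.
    power-≡ : ∀ p m → p ^ m ≡ p ^ᵗ m
    power-≡ p zero    = ≡.refl
    power-≡ p (suc m) = cong (p ⊗_) (power-≡ p m)

    coefficient-weight : ∀ {k n} (α : Vec ℕ k) (E : Edges n) κ j →
      coefficient (weight α E κ) j ≡ contribution E j α κ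
    coefficient-weight α E κ j with does (hasMonomial? α κ)
    ... | true  = cong (λ p → coefficient p j) (power-≡ (1ₚ ⊕ X) (e κ E))
    ... | false = ≡.refl

    contribution-beyond : ∀ {k n} (α : Vec ℕ k) (E : Edges n) κ j →
      length E < j → contribution E j α κ K.≈ K.0#
    contribution-beyond α E κ j E<j with does (hasMonomial? α κ)
    ... | true  = K.trans (K.reflexive (cong (λ p → coefficient p j) (≡.sym (power-≡ (1ₚ ⊕ X) (e κ E)))))
      (power-degree (e κ E) j (ℕ.≤-<-trans (length-filter (monochromatic? κ) E) E<j))
    ... | false = K.refl

    module _ {k} (α : Vec ℕ k) where
      -- Extracts the coefficient at one monomial, from Λ[t] to polynomials. It commutes with the
      -- list operations up to propositional equality, so XB turns into `value α` term by term.
      at-α : List SymmetricFunction → Poly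
      at-α = map λ f → SymmetricFunction.at f α

      at-α-+ : ∀ p q → at-α (p ΛP.+ₚ q) ≡ at-α p ⊕ at-α q
      at-α-+ []      q       = ≡.refl
      at-α-+ (x ∷ p) []      = ≡.refl
      at-α-+ (x ∷ p) (y ∷ q) = cong (_ ∷_) (at-α-+ p q)

      at-α-* : ∀ c p → at-α (c ΛP.*ₚ p) ≡ c ⊗ at-α p
      at-α-* []      p = ≡.refl
      at-α-* (a ∷ c) p = ≡.trans (at-α-+ (map (a Λ.*ₗ_) p) (Λ.0ᴹ ∷ c ΛP.*ₚ p))
        -- Both nested maps fuse to the same map, since `at` of a scalar multiple unfolds to a
        -- product.
        (cong₂ _⊕_ (≡.trans (≡.sym (map-∘ p)) (map-∘ p)) (cong (K.0# ∷_) (at-α-* c p)))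

      at-α-coefficient : ∀ p j → SymmetricFunction.at (ΛP.coefficient p j) α ≡ coefficient (at-α p) j
      at-α-coefficient []      j       = ≡.refl
      at-α-coefficient (x ∷ p) zero    = ≡.refl
      at-α-coefficient (x ∷ p) (suc j) = at-α-coefficient p j

      at-α-applyUpTo : ∀ f m j → (∀ i → m ≤ i → SymmetricFunction.at (f i) α K.≈ K.0#) →
        coefficient (at-α (applyUpTo f m)) j K.≈ SymmetricFunction.at (f j) α
      at-α-applyUpTo f zero    j       beyond = K.sym (beyond j z≤n)
      at-α-applyUpTo f (suc m) zero    beyond = K.refl
      at-α-applyUpTo f (suc m) (suc j) beyond =
        at-α-applyUpTo (f ∘ suc) m j λ i m≤i → beyond (suc i) (s≤s m≤i)

      at-α-graph : ∀ G → at-α (XB-graph G) ≈ᴾ W α G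
      at-α-graph (n , E) .at j = K.trans
        (at-α-applyUpTo (XB-coefficient E) (suc (length E)) j λ i E<i →
          ∑κ-zero n λ κ → contribution-beyond α E κ i E<i)
        (K.sym (K.trans (coefficient-∑ n (weight α E) j)
          (∑κ-cong n λ κ → K.reflexive (coefficient-weight α E κ j))))

      at-α-XB : ∀ L → at-α (XB L) ≈ᴾ value α L
      at-α-XB []            = P.refl
      at-α-XB ((c , G) ∷ L) = P.trans
        (P.reflexive (≡.trans (at-α-+ (c ΛP.*ₚ XB-graph G) (XB L))
          (cong (_⊕ at-α (XB L)) (at-α-* c (XB-graph G)))))
        (P.+-cong (P.*-congˡ {c} (at-α-graph G)) (at-α-XB L))

  KerXB⇒value : ∀ L → KerXB L → ∀ {k} (α : Vec ℕ k) → value α L ≈ᴾ 0ₚ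
  KerXB⇒value L ker α = P.trans (P.sym (at-α-XB α L))
    (coefficientwise λ j → K.trans (K.reflexive (≡.sym (at-α-coefficient α (XB L) j))) (ker j α))

  value⇒KerXB : ∀ L → (∀ {k} (α : Vec ℕ k) → value α L ≈ᴾ 0ₚ) → KerXB L
  value⇒KerXB L vanish j α = K.trans (K.reflexive (at-α-coefficient α (XB L) j))
    (at (P.trans (at-α-XB α L) (vanish α)) j)

-- Separation of the star forests and the equality of span and kernel

module Kernel (K : CommutativeRing 0ℓ 0ℓ) (torsion-free : TorsionFree K) where
  open PolynomialRing K
  open GraphModule K
  open Evaluation K
  open Coefficients K
  open ColouringSums P X using (admissible; admissible?; leaves)
  open Algebra.Properties.Semiring.Mult P.semiring using (×-comm-*)
  open Algebra.Definitions.RawSemiring (Semiring.rawSemiring P.semiring) using (_^_)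
  open Algebra.Definitions.RawMonoid P.+-rawMonoid using () renaming (_×_ to _×ᴾ_)
  open TutteSymmetricFunction K using (I; S₁; S₂; Span; KerXB)

  private
    -- The partition of the forest, indexed by its own vertices: the size of the star at a root, and
    -- 0 at every other vertex.
    starSizes : (b : ∃ Roots) → Vec ℕ (proj₁ b)
    starSizes (n , r , _) = tabulate (occurrences (tabulate r))

    -- A condition on a natural number and hence decidable, whereas equality in `K` is not assumed
    -- to be.
    Null : (b b′ : ∃ Roots) → Set
    Null b (_ , r′ , _) = admissible r′ (starSizes b) ≡ 0

    null? : ∀ b b′ → Dec (Null b b′)
    null? b (_ , r′ , _) = admissible r′ (starSizes b) ℕ.≟ 0

    null : ∀ {b b′} → Null b b′ → value (starSizes b) (starForest b′) ≈ᴾ 0ₚ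
    null {b} {b′@(n , r′ , idem′)} none = P.trans (value-starForest (starSizes b) r′ idem′)
      (P.reflexive (cong (_×ᴾ (X ^ leaves r′ (allFin n))) none))

    rankOf : ∃ Roots → ℕ
    rankOf (_ , r , _) = rank r

    -- A nonzero count yields a colouring that merges stars of `b′` into classes with the sizes of
    -- the stars of `b`; as `b′` has no more stars than `b`, nothing is really merged and the
    -- forests are isomorphic.
    non-null : ∀ {b b′} → ¬ Null b b′ → rankOf b′ ≤ rankOf b → starForest b′ ~ starForest b
    non-null {b@(n , r , idem)} {m , r′ , idem′} ¬null rank≤
      with extract (admissible? r′ (starSizes b)) (colourings n m) ¬null
    ... | κ , (monomial , closed) , _ = starForest-conjugate {idem′ = idem′} {idem}
      (conjugate idem′ idem (lookup κ) (λ v → ≡.sym (closed v)) sizes rank≤)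
      where
      open ≡.≡-Reasoning
      sizes : ∀ i → # (λ v → does (i Fin.≟ lookup κ v)) ≡ # (λ v → does (i Fin.≟ r v))
      sizes i = begin
        # (λ v → does (i Fin.≟ lookup κ v))             ≡⟨ occurrences-# κ i ⟨
        occurrences κ i                                 ≡⟨ monomial i ⟩
        lookup (starSizes b) i                          ≡⟨ lookup∘tabulate (occurrences (tabulate r)) i ⟩
        occurrences (tabulate r) i                      ≡⟨ occurrences-# (tabulate r) i ⟩
        # (λ v → does (i Fin.≟ lookup (tabulate r) v))
          ≡⟨ #-cong (λ v → cong (λ j → does (i Fin.≟ j)) (lookup∘tabulate r v)) ⟩
        # (λ v → does (i Fin.≟ r v))                    ∎

    -- Witnessed by the colouring that gives each vertex its root as colour.
    ¬null-self : ∀ b → ¬ Null b b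
    ¬null-self b@(n , r , idem) none = contradiction
      (filter-some (admissible? r (starSizes b)) (lose (∈-colourings (tabulate r))
        ((λ i → ≡.sym (lookup∘tabulate (occurrences (tabulate r)) i)) ,
         λ v → ≡.trans (lookup∘tabulate r v)
           (≡.trans (≡.sym (idem v)) (≡.sym (lookup∘tabulate r (r v)))))))
      (ℕ.<-irrefl (≡.sym none))

    X^-cancel : ∀ d c → c ⊗ (X ^ d) ≈ᴾ 0ₚ → c ≈ᴾ 0ₚ
    X^-cancel zero    c eq = P.trans (P.sym (P.*-identityʳ c)) eq
    X^-cancel (suc d) c eq = X^-cancel d c (X-cancel (c ⊗ (X ^ d))
      (P.trans (P.sym (P.*-assoc X c (X ^ d)))
        (P.trans (P.*-congʳ {X ^ d} (P.*-comm X c)) (P.trans (P.*-assoc c X (X ^ d)) eq))))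

    ×-cancel′ : ∀ n p → n ≢ 0 → n ×ᴾ p ≈ᴾ 0ₚ → p ≈ᴾ 0ₚ
    ×-cancel′ zero    p n≢0 eq = contradiction ≡.refl n≢0
    ×-cancel′ (suc n) p _   eq = ×-cancel torsion-free n p eq

    -- The value of `b` at its own star sizes is a positive multiple of a power of `t`, and both
    -- factors can be cancelled.
    cancel : ∀ b c → c ⊗ value (starSizes b) (starForest b) ≈ᴾ 0ₚ → c ≈ᴾ 0ₚ
    cancel b@(n , r , idem) c eq = X^-cancel d c
      (×-cancel′ N (c ⊗ (X ^ d)) (¬null-self b)
        (P.trans (P.sym (×-comm-* N c (X ^ d)))
          (P.trans (P.*-congˡ {c} (P.sym (value-starForest (starSizes b) r idem))) eq)))
      where
      N = admissible r (starSizes b)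
      d = leaves r (allFin n)

  -- For the inclusion of the kernel in the span, the element is replaced modulo the relators by a
  -- combination of star forests with the same evaluations; all of these are zero, so elimination
  -- makes the combination zero in the quotient.
  kernel-spanned : Span (I ∪ S₁ ∪ S₂) ≐ KerXB
  kernel-spanned =
      (λ {L} s → value⇒KerXB L λ α → value-span α L s)
    , (λ {L} ker →
        let (M , L~M) = starForest-expansion L
        in ~0⇒span (Q.≈ᴹ-trans {L} L~M
          (Elimination.independent Q starForest rankOf (λ b → evaluationQ (starSizes b))
            null? (λ {b} {b′} → null {b} {b′}) (λ {b} {b′} → non-null {b} {b′}) ¬null-self cancel M
            λ b → P.trans (P.sym (LinearMap.resp (evaluationQ (starSizes b)) L~M))
              (KerXB⇒value L ker (starSizes b)))))

-- The complex numbers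

-- The complex numbers

open import Defs

module _ (R : CommutativeRing 0ℓ 0ℓ) where
  open CommutativeRing R
  open Algebra.Properties.Semiring.Mult semiring using (×-assoc-*) renaming (_×_ to _×ᴿ_)

  invertible⇒torsionFree : (inv : ℕ → Carrier) → (∀ n → inv n * (suc n ×ᴿ 1#) ≈ 1#) → TorsionFree R
  invertible⇒torsionFree inv inverse n x nx≈0 = begin
    x                              ≈⟨ *-identityˡ x ⟨
    1# * x                         ≈⟨ *-congʳ (inverse n) ⟨
    (inv n * (suc n ×ᴿ 1#)) * x    ≈⟨ *-assoc (inv n) (suc n ×ᴿ 1#) x ⟩
    inv n * ((suc n ×ᴿ 1#) * x)
      ≈⟨ *-congˡ (trans (×-assoc-* (suc n) 1# x) (×-congʳ (suc n) (*-identityˡ x))) ⟩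
    inv n * (suc n ×ᴿ x)           ≈⟨ *-congˡ nx≈0 ⟩
    inv n * 0#                     ≈⟨ zeroʳ (inv n) ⟩
    0#                             ∎
    where
    open import Relation.Binary.Reasoning.Setoid setoid
    open Algebra.Properties.Semiring.Mult semiring using (×-congʳ)

  adjoinI-torsionFree : TorsionFree R → TorsionFree (AdjoinI.commutativeRing R)
  adjoinI-torsionFree free n z eq =
      free n (re z) (trans (reflexive (≡.sym (re-× (suc n) z))) (re-≈ eq))
    , free n (im z) (trans (reflexive (≡.sym (im-× (suc n) z))) (im-≈ eq))
    where
    open AdjoinI R
    open _≈ᶜ_
    open Algebra.Definitions.RawMonoid (CommutativeRing.+-rawMonoid commutativeRing)
      using () renaming (_×_ to _×ᶜ_)

    re-× : ∀ n z → re (n ×ᶜ z) ≡ n ×ᴿ re z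
    re-× zero    z = ≡.refl
    re-× (suc n) z = cong (re z +_) (re-× n z)

    im-× : ∀ n z → im (n ×ᶜ z) ≡ n ×ᴿ im z
    im-× zero    z = ≡.refl
    im-× (suc n) z = cong (im z +_) (im-× n z)

private
  -- Recursive in the same way as the multiples of 1 in the reals, so that the two agree term by
  -- term.
  natural : ℕ → ℚ
  natural zero    = 0ℚ
  natural (suc n) = 1ℚ ℚ.+ natural n

  natural-nonNeg : ∀ n → ℚ.NonNegative (natural n)
  natural-nonNeg zero    = _
  natural-nonNeg (suc n) = ℚ.nonNeg+nonNeg⇒nonNeg 1ℚ (natural n) {{natural-nonNeg n}}

  natural-nonZero : ∀ n → ℚ.NonZero (natural (suc n))
  natural-nonZero n = ℚ.pos⇒nonZero (natural (suc n))
    {{ℚ.pos+nonNeg⇒pos 1ℚ (natural n) {{natural-nonNeg n}}}}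

  inverse : ℕ → ℚ
  inverse n = ℚ.1/_ (natural (suc n)) {{natural-nonZero n}}

  module Reals = CommutativeRing ℝ-commutativeRing
  open Algebra.Properties.Semiring.Mult Reals.semiring using () renaming (_×_ to _×ʳ_)

  term-× : ∀ n k → ℝ.term (n ×ʳ Reals.1#) k ≡ natural n
  term-× zero    k = ≡.refl
  term-× (suc n) k = cong (1ℚ ℚ.+_) (term-× n k)

  term-inverse : ∀ n k → inverse n ℚ.* ℝ.term (suc n ×ʳ Reals.1#) k ℚ.- 1ℚ ≡ 0ℚ
  term-inverse n k = ≡.trans
    (cong (ℚ._- 1ℚ) (≡.trans (cong (inverse n ℚ.*_) (term-× (suc n) k))
      (ℚ.*-inverseˡ (natural (suc n)) {{natural-nonZero n}})))
    (ℚ.+-inverseʳ 1ℚ)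

ℝ-torsionFree : TorsionFree ℝ-commutativeRing
ℝ-torsionFree = invertible⇒torsionFree ℝ-commutativeRing (λ n → constant (inverse n)) λ n →
  null (Limits.null-0 ℕ._≤_ {λ k → inverse n ℚ.* ℝ.term (suc n ×ʳ Reals.1#) k ℚ.- 1ℚ} (term-inverse n))

theorem12 : Span (I ∪ S₁ ∪ S₂) ≐ KerXB
theorem12 = Kernel.kernel-spanned ℂ-commutativeRing
  (adjoinI-torsionFree ℝ-commutativeRing ℝ-torsionFree)
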